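{- Let $P$ be a finite $(3+1)$-free poset and $\lambda$ a partition with $\lambda_1\le 2$. Then $$\mathfrak{m}^P_\lambda(\mathbf{u})\equiv\sum_{T\in\mathrm{LT}_P(\lambda)}\mathbf{u}_{\mathrm{colword}(T)}\pmod{I^P_H}.$$
   Context: $a<_Pb$: strict order; $a\sim_Pb$: incomparable or equal. $\mathcal{U}_P=\mathbb{Z}\langle u_a:a\in P\rangle$. $e^P_k(\mathbf{u})=\sum u_{a_1}\cdots u_{a_k}$ over $a_1>_P\cdots>_Pa_k$ ($e^P_0=1$, $e^P_k=0$ for $k<0$). $\mathfrak{J}^P_\mu(\mathbf{u})=\sum_{\pi\in S_j}\mathrm{sgn}(\pi)\prod_{i=1}^je^P_{\mu'_i+\pi(i)-i}(\mathbf{u})$ with $j=\mu_1$; $\mathfrak{m}^P_\lambda=\sum_\mu(K^{ -1})_{\lambda\mu}\mathfrak{J}^P_\mu$ with $K$ the Kostka matrix. $I^P_H$: two-sided ideal generated by $u_cu_a-u_au_c$ ($a<_Pc$) and $u_cu_au_b-u_bu_cu_a$ ($a\sim_Pb$, $b\sim_Pc$, $a<_Pc$). $P$-tableau: filling of a Young diagram with $T(1,c)<_PT(2,c)<_P\cdots$ down columns and $T(r,c+1)\not<_PT(r,c)$ along rows; colword reads columns bottom to top, left to right. For chains $C,D$ of $P$, $\mathrm{inc}_P(C,D)$ is the bipartite graph with parts $C$ and $D$ (taken disjointly) and an edge $c$—$d$ whenever $c\sim_Pd$; a ladder of $(C,D)$ is (the vertex set of) a connected component. A ladder $L$ is balanced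 if $|L\cap C|=|L\cap D|$ and left unbalanced if $|L\cap C|>|L\cap D|$. For a $P$-tableau $T$ with at most two columns $T_1,T_2$ (viewed as chains; $T_2$ possibly empty), its ladders are those of $(T_1,T_2)$; $T$ is a left $P$-tableau if each of its ladders is balanced or left unbalanced. $\mathrm{LT}_P(\lambda)$ is the set of left $P$-tableaux of shape $\lambda$. -}

module Defs where

open import Level using (0ℓ)
open import Algebra.Bundles using (Ring)
open import Data.Empty using (⊥)
open import Data.Fin.Base using (Fin)
import Data.Fin.Properties as Fin
open import Data.Integer.Base as ℤ using (ℤ; +_; -[1+_]; 0ℤ; 1ℤ; -1ℤ)
open import Data.List.Base using (List; []; _∷_; _++_; map; concat; concatMap; length; filter; foldr; reverse; zip; zipWith; upTo; allFin; lookup; cartesianProductWith)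
import Data.List.Properties as List
open import Data.List.Membership.Propositional using (_∈_)
open import Data.List.Membership.Propositional.Properties using (∈-++⁺ˡ; ∈-++⁺ʳ; ∈-map⁺; ∈-allFin)
open import Data.List.Relation.Unary.All using (All; all?)
open import Data.List.Relation.Unary.Any using (here; there)
open import Data.List.Relation.Unary.Linked using (Linked; linked?)
open import Data.List.Relation.Unary.Unique.Propositional using (Unique)
open import Data.Nat.Base as ℕ using (ℕ; zero; suc; _≤_; _<_; _≥_; _>_)
open import Data.Nat.ListAction using (sum)
open import Data.Nat.Properties using (_≟_; _≤?_; _<?_; _≥?_; ≡-decSetoid)
open import Data.List.Relation.Unary.Unique.DecSetoid ≡-decSetoid using (unique?)
open import Data.Product.Base using (_×_; _,_; proj₁; proj₂; uncurry)
open import Data.Sum.Base using (_⊎_; inj₁; inj₂)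
import Data.Sum.Properties as Sum
open import Relation.Binary.Core using (Rel)
open import Relation.Binary.Definitions using (DecidableEquality) renaming (Decidable to Decidable₂)
open import Relation.Binary.Construct.Closure.ReflexiveTransitive using (Star; ε; _◅_; _◅◅_)
open import Relation.Binary.PropositionalEquality using (_≡_; refl)
open import Relation.Binary.Structures using (IsDecStrictPartialOrder)
open import Relation.Nullary using (¬_; Dec; yes; no)
open import Relation.Nullary.Decidable using (map′; ¬?; _×-dec_; _⊎-dec_)
open import Relation.Unary using (Pred; Decidable)

------------------------------------------------------------------------
-- Finite enumerations

words : {A : Set} → List A → ℕ → List (List A)
words as zero    = [] ∷ []
words as (suc k) = cartesianProductWith _∷_ as (words as k)

-- All lists of lists over `as` whose successive lengths are `ls`.
fillings : {A : Set} → List A → List ℕ → List (List (List A))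
fillings as []       = [] ∷ []
fillings as (l ∷ ls) = cartesianProductWith _∷_ (words as l) (fillings as ls)

------------------------------------------------------------------------
-- Partitions and Kostka numbers

IsPartition : List ℕ → Set
IsPartition μ = Linked _≥_ μ × All (_> 0) μ

isPartition? : Decidable IsPartition
isPartition? μ = linked? _≥?_ μ ×-dec all? (0 <?_) μ

partitions : ℕ → List (List ℕ)
partitions n =
  filter (λ μ → isPartition? μ ×-dec (sum μ ≟ n))
         (concatMap (words (upTo (suc n))) (upTo (suc n)))

firstPart : List ℕ → ℕ
firstPart []      = 0
firstPart (p ∷ _) = p

-- The entry of index i (from 0) counts the parts that are ≥ i + 1.
conjugate : List ℕ → List ℕ
conjugate μ = map (λ i → length (filter (i <?_) μ)) (upTo (firstPart μ))

-- A tableau is given here by its list of rows, from the top; its entries are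
-- shifted down by one, so that they start from 0.  `zip` truncates to the
-- shorter list, so it pairs each cell of a row with the cell above it.
IsSemistandard : List (List ℕ) → Set
IsSemistandard T =
  All (Linked _≤_) T × Linked (λ R S → All (uncurry _<_) (zip R S)) T

isSemistandard? : Decidable IsSemistandard
isSemistandard? T =
  all? (linked? _≤?_) T ×-dec
  linked? (λ R S → all? (λ rs → proj₁ rs <? proj₂ rs) (zip R S)) T

content : ℕ → List (List ℕ) → List ℕ
content l T = map (λ i → length (filter (i ≟_) (concat T))) (upTo l)

kostka : List ℕ → List ℕ → ℕ
kostka μ ν =
  length (filter (λ T → isSemistandard? T ×-dec
                        List.≡-dec _≟_ (content (length ν) T) ν)
                 (fillings (upTo (length ν)) μ))

δ : List ℕ → List ℕ → ℤ
δ μ ν with List.≡-dec _≟_ μ ν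
... | yes _ = 1ℤ
... | no  _ = 0ℤ

∑ℤ : {A : Set} → List A → (A → ℤ) → ℤ
∑ℤ as f = foldr (λ a s → f a ℤ.+ s) 0ℤ as

-- M is the two-sided inverse of the Kostka matrix indexed by the partitions
-- of n.  That matrix is unitriangular, so its inverse exists and is unique;
-- the values of M elsewhere play no role.
IsInverseKostka : ℕ → (List ℕ → List ℕ → ℤ) → Set
IsInverseKostka n M = ∀ {μ ν} → μ ∈ partitions n → ν ∈ partitions n →
  (∑ℤ (partitions n) (λ κ → + kostka μ κ ℤ.* M κ ν) ≡ δ μ ν) ×
  (∑ℤ (partitions n) (λ κ → M μ κ ℤ.* + kostka κ ν) ≡ δ μ ν)

------------------------------------------------------------------------
-- Permutations of {0, …, j-1} in one-line notation

permutations : ℕ → List (List ℕ)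
permutations j = filter unique? (words (upTo j) j)

inversions : List ℕ → ℕ
inversions []      = 0
inversions (p ∷ π) = length (filter (_<? p) π) ℕ.+ inversions π

sgn : List ℕ → ℤ
sgn π = -1ℤ ℤ.^ inversions π

------------------------------------------------------------------------
-- ℤ⟨A⟩, as the free (noncommutative, unital) ring on A: ring expressions
-- modulo the congruence generated by the ring axioms

module FreeRing (A : Set) where

  infix  8 -_
  infixl 7 _*_
  infixl 6 _+_
  infix  4 _≈_

  data Expr : Set where
    u       : A → Expr
    0# 1#   : Expr
    _+_ _*_ : Expr → Expr → Expr
    -_      : Expr → Expr

  data _≈_ : Rel Expr 0ℓ where
    ≈-refl      : ∀ {x} → x ≈ x
    ≈-sym       : ∀ {x y} → x ≈ y → y ≈ x
    ≈-trans     : ∀ {x y z} → x ≈ y → y ≈ z → x ≈ z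
    +-cong      : ∀ {x y z w} → x ≈ y → z ≈ w → x + z ≈ y + w
    *-cong      : ∀ {x y z w} → x ≈ y → z ≈ w → x * z ≈ y * w
    -‿cong      : ∀ {x y} → x ≈ y → - x ≈ - y
    +-assoc     : ∀ x y z → (x + y) + z ≈ x + (y + z)
    +-comm      : ∀ x y → x + y ≈ y + x
    +-identityˡ : ∀ x → 0# + x ≈ x
    -‿inverseˡ  : ∀ x → - x + x ≈ 0#
    *-assoc     : ∀ x y z → (x * y) * z ≈ x * (y * z)
    *-identityˡ : ∀ x → 1# * x ≈ x
    *-identityʳ : ∀ x → x * 1# ≈ x
    distribˡ    : ∀ x y z → x * (y + z) ≈ x * y + x * z
    distribʳ    : ∀ x y z → (y + z) * x ≈ y * x + z * x

  ring : Ring 0ℓ 0ℓ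
  ring = record
    { Carrier = Expr ; _≈_ = _≈_ ; _+_ = _+_ ; _*_ = _*_ ; -_ = -_ ; 0# = 0# ; 1# = 1#
    ; isRing = record
      { +-isAbelianGroup = record
        { isGroup = record
          { isMonoid = record
            { isSemigroup = record
              { isMagma = record
                { isEquivalence = record { refl = ≈-refl ; sym = ≈-sym ; trans = ≈-trans }
                ; ∙-cong = +-cong }
              ; assoc = +-assoc }
            ; identity = +-identityˡ , λ x → ≈-trans (+-comm x 0#) (+-identityˡ x) }
          ; inverse = -‿inverseˡ , λ x → ≈-trans (+-comm x (- x)) (-‿inverseˡ x)
          ; ⁻¹-cong = -‿cong }
        ; comm = +-comm }
      ; *-cong = *-cong
      ; *-assoc = *-assoc
      ; *-identity = *-identityˡ , *-identityʳ
      ; distrib = distribˡ , distribʳ } }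

module RingNotions (R : Ring 0ℓ 0ℓ) where

  open Ring R
  open import Algebra.Definitions.RawMonoid +-rawMonoid using () renaming (_×_ to _ℕ·_)

  infixr 8 _·_

  _·_ : ℤ → Carrier → Carrier
  (+ n)    · x = n ℕ· x
  -[1+ n ] · x = - (suc n ℕ· x)

  ∑ : {I : Set} → List I → (I → Carrier) → Carrier
  ∑ is f = foldr (λ i s → f i + s) 0# is

  ∏ : List Carrier → Carrier
  ∏ = foldr _*_ 1#

  data ⟨_⟩ (G : Pred Carrier 0ℓ) : Pred Carrier 0ℓ where
    gen  : ∀ {x} → G x → ⟨ G ⟩ x
    resp : ∀ {x y} → x ≈ y → ⟨ G ⟩ x → ⟨ G ⟩ y
    zer  : ⟨ G ⟩ 0#
    add  : ∀ {x y} → ⟨ G ⟩ x → ⟨ G ⟩ y → ⟨ G ⟩ (x + y)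
    neg  : ∀ {x} → ⟨ G ⟩ x → ⟨ G ⟩ (- x)
    mulˡ : ∀ x {y} → ⟨ G ⟩ y → ⟨ G ⟩ (x * y)
    mulʳ : ∀ y {x} → ⟨ G ⟩ x → ⟨ G ⟩ (x * y)

  infix 4 _≡_[mod_]

  _≡_[mod_] : Carrier → Carrier → Pred Carrier 0ℓ → Set
  x ≡ y [mod I ] = I (x - y)

------------------------------------------------------------------------
-- Reachability in a finite directed graph is decidable (Warshall)

module Reachability {V : Set} (_⟶_ : Rel V 0ℓ) (_⟶?_ : Decidable₂ _⟶_)
  (_≟ᵥ_ : DecidableEquality V) (vs : List V) (complete : ∀ v → v ∈ vs) where

  private
    -- A walk from v to w all of whose intermediate vertices lie in the list.
    Via : List V → Rel V 0ℓ
    Via []       v w = v ≡ w ⊎ v ⟶ w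
    Via (x ∷ xs) v w = Via xs v w ⊎ (Via xs v x × Via xs x w)

    via? : ∀ xs → Decidable₂ (Via xs)
    via? []       v w = (v ≟ᵥ w) ⊎-dec (v ⟶? w)
    via? (x ∷ xs) v w = via? xs v w ⊎-dec (via? xs v x ×-dec via? xs x w)

    sound : ∀ xs {v w} → Via xs v w → Star _⟶_ v w
    sound []       (inj₁ refl)    = ε
    sound []       (inj₂ e)       = e ◅ ε
    sound (x ∷ xs) (inj₁ p)       = sound xs p
    sound (x ∷ xs) (inj₂ (p , q)) = sound xs p ◅◅ sound xs q

    base : ∀ xs {v w} → Via [] v w → Via xs v w
    base []       p = p
    base (x ∷ xs) p = inj₁ (base xs p)

    join : ∀ {x} xs {v w} → x ∈ xs → Via xs v x → Via xs x w → Via xs v w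
    join (_ ∷ xs) (here refl) p q = inj₂ (to p , from q)
      where
      to : ∀ {v x} → Via (x ∷ xs) v x → Via xs v x
      to (inj₁ p)       = p
      to (inj₂ (p , _)) = p
      from : ∀ {x w} → Via (x ∷ xs) x w → Via xs x w
      from (inj₁ q)       = q
      from (inj₂ (_ , q)) = q
    join (_ ∷ xs) (there i) (inj₁ p)        (inj₁ q)        = inj₁ (join xs i p q)
    join (_ ∷ xs) (there i) (inj₁ p)        (inj₂ (q , q′)) = inj₂ (join xs i p q , q′)
    join (_ ∷ xs) (there i) (inj₂ (p , p′)) (inj₁ q)        = inj₂ (p , join xs i p′ q)
    join (_ ∷ xs) (there i) (inj₂ (p , _))  (inj₂ (_ , q′)) = inj₂ (p , q′)

    total : ∀ {v w} → Star _⟶_ v w → Via vs v w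
    total ε       = base vs (inj₁ refl)
    total (e ◅ p) = join vs (complete _) (base vs (inj₂ e)) (total p)

  reachable? : Decidable₂ (Star _⟶_)
  reachable? v w = map′ (sound vs) total (via? vs v w)

------------------------------------------------------------------------
-- Finite posets, given by their strict order

record FinitePoset : Set₁ where
  infix 4 _≺_
  field
    Carrier                 : Set
    _≺_                     : Rel Carrier 0ℓ
    isDecStrictPartialOrder : IsDecStrictPartialOrder _≡_ _≺_
    elements                : List Carrier
    elements-unique         : Unique elements
    elements-complete       : ∀ a → a ∈ elements

  open IsDecStrictPartialOrder isDecStrictPartialOrder public
    using () renaming (_<?_ to _≺?_; _≟_ to _≟ₚ_; irrefl to ≺-irrefl; trans to ≺-trans; asym to ≺-asym)

module PosetNotions (P : FinitePoset) where

  open FinitePoset P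

  infix 4 _≻_ _∼_

  _≻_ : Rel Carrier 0ℓ
  a ≻ b = b ≺ a

  -- Incomparable or equal.
  _∼_ : Rel Carrier 0ℓ
  a ∼ b = ¬ (a ≺ b) × ¬ (b ≺ a)

  _∼?_ : Decidable₂ _∼_
  a ∼? b = ¬? (a ≺? b) ×-dec ¬? (b ≺? a)

  -- In this configuration d is automatically distinct from a, b and c.
  [3+1]-Free : Set
  [3+1]-Free = ∀ {a b c d} → a ≺ b → b ≺ c → d ∼ a → d ∼ b → d ∼ c → ⊥

  open FreeRing Carrier public using (u) renaming (Expr to 𝓤; ring to 𝓤-ring)
  open Ring 𝓤-ring using (_*_; _-_; 0#)
  open RingNotions 𝓤-ring public

  uʷ : List Carrier → 𝓤
  uʷ w = ∏ (map u w)

  e : ℤ → 𝓤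
  e (+ k)    = ∑ (filter (linked? (λ a b → b ≺? a)) (words elements k)) uʷ
  e -[1+ _ ] = 0#

  𝔍 : List ℕ → 𝓤
  𝔍 μ = ∑ (permutations j) λ π →
          sgn π · ∏ (zipWith factor (conjugate μ) (zip (upTo j) π))
    where
    j : ℕ
    j = firstPart μ
    factor : ℕ → ℕ × ℕ → 𝓤
    factor μ′ᵢ (i , πᵢ) = e ((+ μ′ᵢ ℤ.+ + πᵢ) ℤ.- + i)

  -- K⁻¹ stands for the inverse Kostka matrix in degree sum μ.
  𝔪 : (K⁻¹ : List ℕ → List ℕ → ℤ) → List ℕ → 𝓤
  𝔪 K⁻¹ μ = ∑ (partitions (sum μ)) λ ν → K⁻¹ μ ν · 𝔍 ν

  data HGenerator : Pred 𝓤 0ℓ where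
    comm   : ∀ {a c} → a ≺ c → HGenerator (u c * u a - u a * u c)
    rotate : ∀ {a b c} → a ∼ b → b ∼ c → a ≺ c →
             HGenerator (u c * u a * u b - u b * u c * u a)

  I-H : Pred 𝓤 0ℓ
  I-H = ⟨ HGenerator ⟩

  -- The bipartite graph inc(C , D).  Vertices are positions in the lists C
  -- and D; when these are chains, positions correspond to elements.
  module Incomparability (C D : List Carrier) where

    Vertex : Set
    Vertex = Fin (length C) ⊎ Fin (length D)

    Edge : Rel Vertex 0ℓ
    Edge (inj₁ i) (inj₂ j) = lookup C i ∼ lookup D j
    Edge (inj₂ j) (inj₁ i) = lookup C i ∼ lookup D j
    Edge (inj₁ _) (inj₁ _) = ⊥
    Edge (inj₂ _) (inj₂ _) = ⊥

    edge? : Decidable₂ Edge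
    edge? (inj₁ i) (inj₂ j) = lookup C i ∼? lookup D j
    edge? (inj₂ j) (inj₁ i) = lookup C i ∼? lookup D j
    edge? (inj₁ _) (inj₁ _) = no λ ()
    edge? (inj₂ _) (inj₂ _) = no λ ()

    vertices : List Vertex
    vertices = map inj₁ (allFin (length C)) ++ map inj₂ (allFin (length D))

    vertices-complete : ∀ v → v ∈ vertices
    vertices-complete (inj₁ i) = ∈-++⁺ˡ (∈-map⁺ inj₁ (∈-allFin i))
    vertices-complete (inj₂ j) = ∈-++⁺ʳ _ (∈-map⁺ inj₂ (∈-allFin j))

    -- As Edge is symmetric, Ladder v is the connected component of v, and
    -- every ladder is of this form.
    Ladder : Vertex → Pred Vertex 0ℓ
    Ladder = Star Edge

    ladder? : Decidable₂ Ladder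
    ladder? = Reachability.reachable? Edge edge? (Sum.≡-dec Fin._≟_ Fin._≟_)
                vertices vertices-complete

    ∣Ladder_∩C∣ ∣Ladder_∩D∣ : Vertex → ℕ
    ∣Ladder v ∩C∣ = length (filter (λ i → ladder? v (inj₁ i)) (allFin (length C)))
    ∣Ladder v ∩D∣ = length (filter (λ j → ladder? v (inj₂ j)) (allFin (length D)))

    Balanced LeftUnbalanced : Vertex → Set
    Balanced       v = ∣Ladder v ∩C∣ ≡ ∣Ladder v ∩D∣
    LeftUnbalanced v = ∣Ladder v ∩C∣ > ∣Ladder v ∩D∣

    AllLaddersLeft : Set
    AllLaddersLeft = ∀ v → Balanced v ⊎ LeftUnbalanced v

    allLaddersLeft? : Dec AllLaddersLeft
    allLaddersLeft? = map′
      (λ { (f , g) (inj₁ i) → f i ; (f , g) (inj₂ j) → g j })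
      (λ h → (λ i → h (inj₁ i)) , (λ j → h (inj₂ j)))
      (Fin.all? (λ i → left? (inj₁ i)) ×-dec Fin.all? (λ j → left? (inj₂ j)))
      where
      left? : Decidable (λ v → Balanced v ⊎ LeftUnbalanced v)
      left? v = (∣Ladder v ∩C∣ ≟ ∣Ladder v ∩D∣) ⊎-dec (∣Ladder v ∩D∣ <? ∣Ladder v ∩C∣)

  -- P-tableaux are given by their list of columns, each read from the top.
  -- `zip` pairs each cell of a column with its neighbour in the previous one.
  IsPTableau : List (List Carrier) → Set
  IsPTableau T =
    All (Linked _≺_) T × Linked (λ C D → All (λ (c , d) → ¬ (d ≺ c)) (zip C D)) T

  isPTableau? : Decidable IsPTableau
  isPTableau? T =
    all? (linked? _≺?_) T ×-dec
    linked? (λ C D → all? (λ cd → ¬? (proj₂ cd ≺? proj₁ cd)) (zip C D)) T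

  colword : List (List Carrier) → List Carrier
  colword = concatMap reverse

  column₁ column₂ : List (List Carrier) → List Carrier
  column₁ []          = []
  column₁ (C ∷ _)     = C
  column₂ []          = []
  column₂ (_ ∷ [])    = []
  column₂ (_ ∷ D ∷ _) = D

  -- Meaningful for P-tableaux with at most two columns.
  IsLeft : List (List Carrier) → Set
  IsLeft T = Incomparability.AllLaddersLeft (column₁ T) (column₂ T)

  isLeft? : Decidable IsLeft
  isLeft? T = Incomparability.allLaddersLeft? (column₁ T) (column₂ T)

  LT : List ℕ → List (List (List Carrier))
  LT μ = filter (λ T → isPTableau? T ×-dec isLeft? T) (fillings elements (conjugate μ))

{-# OPTIONS --safe #-}
-- Modulo I-H, comparable elements commute, and an element commutes with a chain
-- in which it has two incomparable neighbours.  As P is (3+1)-free, every ladder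
-- is a path or a 4-cycle, and the ladders of a pair of chains (C , D) are totally
-- ordered.  On an unbalanced ladder every element of the shorter side has two
-- neighbours on the longer one, so exchanging its two sides does not change
-- u_C u_D modulo I-H.  Turning all unbalanced ladders to the left, and counting
-- the pairs with the same normal form, yields
--   e_{n-k} e_k ≡ Σ_l binom(n-2l, k-l) X_l,
-- where X_l is the sum over the left P-tableaux of shape 2ˡ1ⁿ⁻²ˡ (left pairs of
-- chains satisfy the row condition automatically).  By the reflection principle
-- the Kostka number of shape 2ᵏ1ⁿ⁻²ᵏ and content 2ˡ1ⁿ⁻²ˡ is
-- binom(n-2l, k-l) - binom(n-2l, k-l-1), so the two-column 𝔍 expand in the X_l
-- by the Kostka matrix.  Inverting it gives the theorem, since the rows of K⁻¹
-- indexed by two-column partitions vanish at all other partitions.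
module Submission where

open import Algebra.Bundles using (CommutativeMonoid; Ring)
open import Data.Empty using (⊥; ⊥-elim)
open import Data.Fin.Base using (Fin; suc; zero)
open import Data.Integer.Base as ℤ using (+_; -1ℤ; -[1+_]; 0ℤ; 1ℤ; _⊖_; ℤ)
import Data.Integer.Properties as ℤ
open import Data.List.Base using (List; []; [_]; _++_; _∷_; allFin; applyUpTo; cartesianProductWith; concat; concatMap; drop; filter; foldr; length; lookup; map; replicate; reverse; upTo; zip)
open import Data.List.Membership.Propositional using (_∈_; _∉_)
open import Data.List.Membership.Propositional.Properties using (∈-++⁺ʳ; ∈-++⁺ˡ; ∈-++⁻; ∈-allFin; ∈-cartesianProductWith⁺; ∈-cartesianProductWith⁻; ∈-concat⁺′; ∈-filter⁺; ∈-filter⁻; ∈-lookup; ∈-map⁺; ∈-map⁻; ∈-upTo⁺; ∈-upTo⁻; ∈-∃++)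
import Data.List.Properties as List
open import Data.List.Relation.Binary.Permutation.Propositional as Perm using (_↭_; ↭-prep; ↭-sym; ↭-trans)
open import Data.List.Relation.Binary.Permutation.Propositional.Properties using (shift; ↭-length)
open import Data.List.Relation.Unary.All as All using (All; []; _∷_; all?)
import Data.List.Relation.Unary.All.Properties as All
open import Data.List.Relation.Unary.AllPairs as AllPairs using (AllPairs; []; _∷_; allPairs?)
import Data.List.Relation.Unary.AllPairs.Properties as AllPairs
open import Data.List.Relation.Unary.Any as Any using (here; there)
open import Data.List.Relation.Unary.Any.Properties as Any using (reverse⁻)
open import Data.List.Relation.Unary.Linked as Linked using (Linked; [-]; []; _∷_; linked?)
open import Data.List.Relation.Unary.Linked.Properties using (AllPairs⇒Linked; Linked⇒AllPairs)
open import Data.List.Relation.Unary.Unique.Propositional using (Unique)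
open import Data.List.Relation.Unary.Unique.Propositional.Properties as Unique using (Unique[x∷xs]⇒x∉xs)
open import Data.Nat.Base as ℕ using (_<_; _>_; _∸_; _≤_; _≥_; suc; s≤s; zero; z≤n; ℕ; ⌊_/2⌋)
open import Data.Nat.Induction using (<-rec)
open import Data.Nat.ListAction using (sum)
import Data.Nat.Properties as ℕ
open import Data.Product.Base using (_,_; _×_; proj₁; proj₂; uncurry; ∃; ∃₂)
import Data.Product.Properties as Product
open import Data.Sum.Base as Sum using (_⊎_; inj₁; inj₂)
open import Data.Unit.Base using (tt; ⊤)
open import Defs
open import Function.Base as Function using (_∘_; id)
open import Level using (0ℓ)
open import Relation.Binary.Construct.Closure.ReflexiveTransitive as Star using (Star; _◅_; _◅◅_)
open import Relation.Binary.Definitions using (DecidableEquality; tri<; tri>; tri≈)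
open import Relation.Binary.PropositionalEquality using (_≡_; _≢_; cong; cong₂; module ≡-Reasoning; refl; subst; subst₂; sym; trans)
open import Relation.Nullary using (Dec; no; yes; ¬_)
open import Relation.Nullary.Decidable using (_×-dec_)
open import Relation.Unary using (Decidable; Pred)
open import Algebra.Properties.CommutativeSemigroup ℕ.+-commutativeSemigroup
  using () renaming (interchange to +-interchange)

-- Finite enumerations and sums

-- A ladder is defined as a component of a graph on positions, a form that is hard to reorient and
-- to count. The proof works instead with a list of blocks, each traced by an alternating path, such
-- that everything in a block lies below everything in the later blocks. Two chains determine
-- exactly one such list, so it can be computed from them, changed block by block and read back;
-- components return only where `IsLeft` is compared with it. (3+1)-freeness acts through one fact
-- and its mirror image: an element incomparable to two elements of a chain lies below all that is
-- above both and above all that is below both. This forces the next vertex of a path, separates a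
-- finished path from the rest, and lets an element pass the remainder of a chain. The binomials
-- arise because an unbalanced path has a surplus of exactly one. A left pair with lengths n - l and
-- l therefore has n - 2l unbalanced blocks, and the pairs with lengths n - k and k over it come
-- from turning k - l of them.

module _ {A : Set} where

  unique-∷ : ∀ {x} {xs : List A} → x ∉ xs → Unique xs → Unique (x ∷ xs)
  unique-∷ x∉ u = All.tabulate (λ { y∈ refl → x∉ y∈ }) ∷ u

  unique-middle : ∀ {x} (ys : List A) {zs} → Unique (ys ++ x ∷ zs) →
                  x ∉ ys ++ zs × Unique (ys ++ zs)
  unique-middle []       u@(_ ∷ v) = Unique[x∷xs]⇒x∉xs u , v
  unique-middle {x} (y ∷ ys) {zs} (a ∷ u) =
    let x∉ , v = unique-middle ys u in
    (λ { (here refl) → All.lookup a (∈-++⁺ʳ ys (here refl)) refl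
       ; (there p)   → x∉ p }) ,
    unique-∷ (λ y∈ → All.lookup a (widen y∈) refl) v
    where
    widen : ∀ {y} → y ∈ ys ++ zs → y ∈ ys ++ x ∷ zs
    widen p with ∈-++⁻ ys p
    ... | inj₁ q = ∈-++⁺ˡ q
    ... | inj₂ q = ∈-++⁺ʳ ys (there q)

  unique-↭ : {xs ys : List A} → Unique xs → Unique ys →
             (∀ {z} → z ∈ xs → z ∈ ys) → (∀ {z} → z ∈ ys → z ∈ xs) → xs ↭ ys
  unique-↭ {[]}     {[]}     _ _ _ _ = Perm.refl
  unique-↭ {[]}     {y ∷ ys} _ _ _ g with () ← g (here refl)
  unique-↭ {x ∷ xs} {ys}     u@(_ ∷ u′) v f g
    with ys₁ , ys₂ , refl ← ∈-∃++ (f (here refl)) =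
    ↭-trans (↭-prep x (unique-↭ u′ (proj₂ (unique-middle ys₁ v)) f′ g′))
            (↭-sym (shift x ys₁ ys₂))
    where
    x∉xs = Unique[x∷xs]⇒x∉xs u
    f′ : ∀ {z} → z ∈ xs → z ∈ ys₁ ++ ys₂
    f′ z∈ with ∈-++⁻ ys₁ (f (there z∈))
    ... | inj₁ p           = ∈-++⁺ˡ p
    ... | inj₂ (here refl) = ⊥-elim (x∉xs z∈)
    ... | inj₂ (there p)   = ∈-++⁺ʳ ys₁ p
    g″ : ∀ {z} → z ∈ ys₁ ++ ys₂ → z ∈ ys₁ ++ x ∷ ys₂
    g″ p with ∈-++⁻ ys₁ p
    ... | inj₁ q = ∈-++⁺ˡ q
    ... | inj₂ q = ∈-++⁺ʳ ys₁ (there q)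
    g′ : ∀ {z} → z ∈ ys₁ ++ ys₂ → z ∈ xs
    g′ p with g (g″ p)
    ... | there q   = q
    ... | here refl = ⊥-elim (proj₁ (unique-middle ys₁ v) p)

module _ {A B : Set} where

  unique-map : (f : A → B) (g : B → A) {xs : List A} →
               (∀ {x} → x ∈ xs → g (f x) ≡ x) → Unique xs → Unique (map f xs)
  unique-map f g         inv []      = []
  unique-map f g {x ∷ xs} inv (a ∷ u) =
    unique-∷ (λ p → let y , y∈ , eq = ∈-map⁻ f p in
                     All.lookup a y∈ (trans (sym (inv (here refl)))
                                     (trans (cong g eq) (inv (there y∈)))))
             (unique-map f g (inv ∘ there) u)

  bijection-↭ : (f : A → B) (g : B → A) {xs : List A} {ys : List B} →
                Unique xs → Unique ys →
                (∀ {x} → x ∈ xs → f x ∈ ys × g (f x) ≡ x) →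
                (∀ {y} → y ∈ ys → g y ∈ xs × f (g y) ≡ y) → map f xs ↭ ys
  bijection-↭ f g {xs} {ys} u v F G =
    unique-↭ (unique-map f g (proj₂ ∘ F) u) v
      (λ p → let x , x∈ , eq = ∈-map⁻ f p in subst (_∈ ys) (sym eq) (proj₁ (F x∈)))
      (λ y∈ → subst (_∈ map f xs) (proj₂ (G y∈)) (∈-map⁺ f (proj₁ (G y∈))))

  bijection-length : (f : A → B) (g : B → A) {xs : List A} {ys : List B} →
                     Unique xs → Unique ys →
                     (∀ {x} → x ∈ xs → f x ∈ ys × g (f x) ≡ x) →
                     (∀ {y} → y ∈ ys → g y ∈ xs × f (g y) ≡ y) → length xs ≡ length ys
  bijection-length f g {xs} u v F G =
    trans (sym (List.length-map f xs)) (↭-length (bijection-↭ f g u v F G))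

module FiniteSums (M : CommutativeMonoid 0ℓ 0ℓ) where

  open CommutativeMonoid M renaming (refl to ≈-refl; sym to ≈-sym; trans to ≈-trans)
  open import Algebra.Properties.CommutativeSemigroup commutativeSemigroup using (interchange; x∙yz≈y∙xz)
  open import Relation.Binary.Reasoning.Setoid setoid

  ∑ : {I : Set} → List I → (I → Carrier) → Carrier
  ∑ is f = foldr (λ i s → f i ∙ s) ε is

  module _ {I : Set} where

    ∑-cong : {f g : I → Carrier} (xs : List I) →
             (∀ {x} → x ∈ xs → f x ≈ g x) → ∑ xs f ≈ ∑ xs g
    ∑-cong []       h = ≈-refl
    ∑-cong (x ∷ xs) h = ∙-cong (h (here refl)) (∑-cong xs (h ∘ there))

    ∑-ε : {f : I → Carrier} (xs : List I) → (∀ {x} → x ∈ xs → f x ≈ ε) → ∑ xs f ≈ ε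
    ∑-ε []       h = ≈-refl
    ∑-ε (x ∷ xs) h = ≈-trans (∙-cong (h (here refl)) (∑-ε xs (h ∘ there))) (identityˡ ε)

    ∑-↭ : (f : I → Carrier) {xs ys : List I} → xs ↭ ys → ∑ xs f ≈ ∑ ys f
    ∑-↭ f Perm.refl          = ≈-refl
    ∑-↭ f (Perm.prep x p)    = ∙-congˡ (∑-↭ f p)
    ∑-↭ f (Perm.swap x y p)  = ≈-trans (x∙yz≈y∙xz _ _ _) (∙-congˡ (∙-congˡ (∑-↭ f p)))
    ∑-↭ f (Perm.trans p q)   = ≈-trans (∑-↭ f p) (∑-↭ f q)

    ∑-++ : (f : I → Carrier) (xs ys : List I) → ∑ (xs ++ ys) f ≈ ∑ xs f ∙ ∑ ys f
    ∑-++ f []       ys = ≈-sym (identityˡ _)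
    ∑-++ f (x ∷ xs) ys = ≈-trans (∙-congˡ (∑-++ f xs ys)) (≈-sym (assoc _ _ _))

    ∑-∙ : (f g : I → Carrier) (xs : List I) → ∑ xs (λ x → f x ∙ g x) ≈ ∑ xs f ∙ ∑ xs g
    ∑-∙ f g []       = ≈-sym (identityˡ ε)
    ∑-∙ f g (x ∷ xs) = ≈-trans (∙-congˡ (∑-∙ f g xs)) (interchange _ _ _ _)

    ∑-support : {P : Pred I 0ℓ} (P? : Decidable P) (f : I → Carrier) (xs : List I) →
                (∀ {x} → x ∈ xs → ¬ P x → f x ≈ ε) → ∑ xs f ≈ ∑ (filter P? xs) f
    ∑-support P? f []       h = ≈-refl
    ∑-support P? f (x ∷ xs) h with P? x
    ... | yes _ = ∙-congˡ (∑-support P? f xs (h ∘ there))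
    ... | no ¬p = ≈-trans (∙-cong (h (here refl) ¬p) (∑-support P? f xs (h ∘ there))) (identityˡ _)

    ∑-single : {f : I → Carrier} {xs : List I} {x : I} → Unique xs → x ∈ xs →
               (∀ {y} → y ∈ xs → y ≢ x → f y ≈ ε) → ∑ xs f ≈ f x
    ∑-single {xs = _ ∷ xs} (a ∷ u) (here refl) h =
      ≈-trans (∙-congˡ (∑-ε xs (λ y∈ → h (there y∈) (λ { refl → All.lookup a y∈ refl })))) (identityʳ _)
    ∑-single {xs = _ ∷ xs} (a ∷ u) (there x∈) h =
      ≈-trans (∙-cong (h (here refl) (All.lookup a x∈)) (∑-single u x∈ (h ∘ there))) (identityˡ _)

  ∑-map : {I J : Set} (h : I → J) (f : J → Carrier) (xs : List I) →
          ∑ (map h xs) f ≡ ∑ xs (f ∘ h)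
  ∑-map h f []       = refl
  ∑-map h f (x ∷ xs) = cong (f (h x) ∙_) (∑-map h f xs)

  ∑-bijection : {I J : Set} (h : I → J) (k : J → I) {xs : List I} {ys : List J}
                {f : I → Carrier} {g : J → Carrier} →
                Unique xs → Unique ys →
                (∀ {x} → x ∈ xs → h x ∈ ys × k (h x) ≡ x) →
                (∀ {y} → y ∈ ys → k y ∈ xs × h (k y) ≡ y) →
                (∀ {x} → x ∈ xs → f x ≈ g (h x)) → ∑ xs f ≈ ∑ ys g
  ∑-bijection h k {xs} {ys} {f} {g} u v F G e = begin
    ∑ xs f          ≈⟨ ∑-cong xs e ⟩
    ∑ xs (g ∘ h)    ≡⟨ ∑-map h g xs ⟨
    ∑ (map h xs) g  ≈⟨ ∑-↭ g (bijection-↭ h k u v F G) ⟩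
    ∑ ys g          ∎

  ∑-swap : {I J : Set} (f : I → J → Carrier) (xs : List I) (ys : List J) →
           ∑ xs (λ x → ∑ ys (f x)) ≈ ∑ ys (λ y → ∑ xs (λ x → f x y))
  ∑-swap f []       ys = ≈-sym (∑-ε ys (λ _ → ≈-refl))
  ∑-swap f (x ∷ xs) ys = ≈-trans (∙-congˡ (∑-swap f xs ys)) (≈-sym (∑-∙ _ _ ys))

  ∑-cartesianProductWith : {I J K : Set} (h : I → J → K) (f : K → Carrier)
    (xs : List I) (ys : List J) →
    ∑ (cartesianProductWith h xs ys) f ≈ ∑ xs (λ x → ∑ ys (λ y → f (h x y)))
  ∑-cartesianProductWith h f []       ys = ≈-refl
  ∑-cartesianProductWith h f (x ∷ xs) ys =
    ≈-trans (∑-++ f (map (h x) ys) _)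
            (∙-cong (reflexive (∑-map (h x) f ys)) (∑-cartesianProductWith h f xs ys))

  ∑-fibres : {I J : Set} (_≟_ : DecidableEquality J) (h : I → J) (f : I → Carrier)
             (xs : List I) {ys : List J} → Unique ys → (∀ {x} → x ∈ xs → h x ∈ ys) →
             ∑ xs f ≈ ∑ ys (λ y → ∑ (filter (λ x → h x ≟ y) xs) f)
  ∑-fibres _≟_ h f []       {ys} u into = ≈-sym (∑-ε ys (λ _ → ≈-refl))
  ∑-fibres _≟_ h f (x ∷ xs) {ys} u into = ≈-sym (begin
    ∑ ys (λ y → ∑ (filter (λ x → h x ≟ y) (x ∷ xs)) f)
      ≈⟨ ∑-cong ys (λ {y} _ → split y) ⟩
    ∑ ys (λ y → indicator y ∙ ∑ (filter (λ x → h x ≟ y) xs) f)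
      ≈⟨ ∑-∙ _ _ ys ⟩
    ∑ ys indicator ∙ ∑ ys (λ y → ∑ (filter (λ x → h x ≟ y) xs) f)
      ≈⟨ ∙-cong (∑-single u (into (here refl)) vanish) (≈-sym (∑-fibres _≟_ h f xs u (into ∘ there))) ⟩
    indicator (h x) ∙ ∑ xs f
      ≈⟨ ∙-congʳ hit ⟩
    f x ∙ ∑ xs f ∎)
    where
    indicator : _ → Carrier
    indicator y with h x ≟ y
    ... | yes _ = f x
    ... | no _  = ε
    split : ∀ y → ∑ (filter (λ x → h x ≟ y) (x ∷ xs)) f ≈ indicator y ∙ ∑ (filter (λ x → h x ≟ y) xs) f
    split y with h x ≟ y
    ... | yes _ = ≈-refl
    ... | no _  = ≈-sym (identityˡ _)
    vanish : ∀ {y} → y ∈ ys → y ≢ h x → indicator y ≈ ε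
    vanish {y} _ ne with h x ≟ y
    ... | yes e = ⊥-elim (ne (sym e))
    ... | no _  = ≈-refl
    hit : indicator (h x) ≈ f x
    hit with h x ≟ h x
    ... | yes _ = ≈-refl
    ... | no ne = ⊥-elim (ne refl)

-- Integer multiples in a ring, and its quotient by an ideal

module IntegerMultiples (R : Ring 0ℓ 0ℓ) where

  open Ring R renaming (refl to ≈-refl; sym to ≈-sym; trans to ≈-trans)
  open RingNotions R
  open import Algebra.Properties.Ring R using (-‿distribˡ-*; -0#≈0#; -‿+-comm; -‿involutive)
  open import Algebra.Properties.CommutativeSemigroup
    (CommutativeMonoid.commutativeSemigroup +-commutativeMonoid) using (interchange)
  open import Algebra.Properties.CommutativeMonoid.Mult +-commutativeMonoid using (×-congʳ; ×-homo-+; ×-distrib-+)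
  open import Algebra.Properties.Semiring.Mult semiring using (×-assoc-*)
  open import Algebra.Definitions.RawMonoid +-rawMonoid using () renaming (_×_ to _ℕ·_)
  open import Relation.Binary.Reasoning.Setoid setoid

  -‿interchange : ∀ a b c d → (a + b) - (c + d) ≈ (a - c) + (b - d)
  -‿interchange a b c d = ≈-trans (+-congˡ (≈-sym (-‿+-comm c d))) (interchange a b (- c) (- d))

  ⊖-· : ∀ m n x → (m ⊖ n) · x ≈ m ℕ· x - n ℕ· x
  ⊖-· zero    zero    x = ≈-sym (-‿inverseʳ 0#)
  ⊖-· zero    (suc n) x = ≈-sym (+-identityˡ _)
  ⊖-· (suc m) zero    x = ≈-sym (≈-trans (+-congˡ -0#≈0#) (+-identityʳ _))
  ⊖-· (suc m) (suc n) x = begin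
    (suc m ⊖ suc n) · x                ≡⟨ cong (_· x) (ℤ.[1+m]⊖[1+n]≡m⊖n m n) ⟩
    (m ⊖ n) · x                        ≈⟨ ⊖-· m n x ⟩
    m ℕ· x - n ℕ· x                    ≈⟨ +-identityˡ _ ⟨
    0# + (m ℕ· x - n ℕ· x)             ≈⟨ +-congʳ (-‿inverseʳ x) ⟨
    (x - x) + (m ℕ· x - n ℕ· x)        ≈⟨ -‿interchange _ _ _ _ ⟨
    suc m ℕ· x - suc n ℕ· x            ∎

  ·-homo-+ : ∀ i j x → (i ℤ.+ j) · x ≈ i · x + j · x
  ·-homo-+ (+ m)    (+ n)    x = ×-homo-+ x m n
  ·-homo-+ (+ m)    -[1+ n ] x = ⊖-· m (suc n) x
  ·-homo-+ -[1+ m ] (+ n)    x = ≈-trans (⊖-· n (suc m) x) (+-comm _ _)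
  ·-homo-+ -[1+ m ] -[1+ n ] x = begin
    - (suc (suc (m ℕ.+ n)) ℕ· x)       ≈⟨ -‿cong (+-congˡ (×-homo-+ x (suc m) n)) ⟩
    - (x + (suc m ℕ· x + n ℕ· x))      ≈⟨ -‿cong (+-assoc _ _ _) ⟨
    - ((x + suc m ℕ· x) + n ℕ· x)      ≈⟨ -‿cong (+-congʳ (+-comm _ _)) ⟩
    - ((suc m ℕ· x + x) + n ℕ· x)      ≈⟨ -‿cong (+-assoc _ _ _) ⟩
    - (suc m ℕ· x + suc n ℕ· x)        ≈⟨ -‿+-comm _ _ ⟨
    - (suc m ℕ· x) + - (suc n ℕ· x)    ∎

  ·-neg : ∀ i x → (ℤ.- i) · x ≈ - (i · x)
  ·-neg (+ zero)  x = ≈-sym -0#≈0#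
  ·-neg (+ suc n) x = ≈-refl
  ·-neg -[1+ n ]  x = ≈-sym (-‿involutive _)

  ·-assoc⁺ : ∀ m j x → (+ m ℤ.* j) · x ≈ m ℕ· (j · x)
  ·-assoc⁺ zero    j x = reflexive (cong (_· x) (ℤ.*-zeroˡ j))
  ·-assoc⁺ (suc m) j x = begin
    (+ suc m ℤ.* j) · x          ≡⟨ cong (_· x) (ℤ.suc-* (+ m) j) ⟩
    (j ℤ.+ + m ℤ.* j) · x        ≈⟨ ·-homo-+ j (+ m ℤ.* j) x ⟩
    j · x + (+ m ℤ.* j) · x      ≈⟨ +-congˡ (·-assoc⁺ m j x) ⟩
    suc m ℕ· (j · x)             ∎

  ·-assoc : ∀ i j x → (i ℤ.* j) · x ≈ i · (j · x)
  ·-assoc (+ m)    j x = ·-assoc⁺ m j x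
  ·-assoc -[1+ m ] j x = begin
    (-[1+ m ] ℤ.* j) · x         ≡⟨ cong (_· x) (ℤ.neg-distribˡ-* (+ suc m) j) ⟨
    (ℤ.- (+ suc m ℤ.* j)) · x    ≈⟨ ·-neg (+ suc m ℤ.* j) x ⟩
    - ((+ suc m ℤ.* j) · x)      ≈⟨ -‿cong (·-assoc⁺ (suc m) j x) ⟩
    - (suc m ℕ· (j · x))         ∎

  ℕ·-zeroʳ : ∀ n → n ℕ· 0# ≈ 0#
  ℕ·-zeroʳ zero    = ≈-refl
  ℕ·-zeroʳ (suc n) = ≈-trans (+-identityˡ _) (ℕ·-zeroʳ n)

  ·-zeroʳ : ∀ i → i · 0# ≈ 0#
  ·-zeroʳ (+ n)    = ℕ·-zeroʳ n
  ·-zeroʳ -[1+ n ] = ≈-trans (-‿cong (ℕ·-zeroʳ (suc n))) -0#≈0#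

  ·-distrib-+ : ∀ i x y → i · (x + y) ≈ i · x + i · y
  ·-distrib-+ (+ n)    x y = ×-distrib-+ x y n
  ·-distrib-+ -[1+ n ] x y =
    ≈-trans (-‿cong (×-distrib-+ x y (suc n))) (≈-sym (-‿+-comm _ _))

  ·-distrib-∑ : {I : Set} (i : ℤ) (xs : List I) (f : I → Carrier) →
                i · ∑ xs f ≈ ∑ xs (λ x → i · f x)
  ·-distrib-∑ i []       f = ·-zeroʳ i
  ·-distrib-∑ i (x ∷ xs) f = ≈-trans (·-distrib-+ i _ _) (+-congˡ (·-distrib-∑ i xs f))

  ∑ℤ-· : {I : Set} (xs : List I) (c : I → ℤ) (x : Carrier) →
         ∑ℤ xs c · x ≈ ∑ xs (λ i → c i · x)
  ∑ℤ-· []       c x = ≈-refl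
  ∑ℤ-· (i ∷ xs) c x = ≈-trans (·-homo-+ (c i) _ x) (+-congˡ (∑ℤ-· xs c x))

  ℕ·-1* : ∀ n x → n ℕ· x ≈ (n ℕ· 1#) * x
  ℕ·-1* n x = ≈-sym (≈-trans (×-assoc-* n 1# x) (×-congʳ n (*-identityˡ x)))

  -- As a product, a multiple inherits congruence modulo an ideal from multiplication; `·-cong-≃` is
  -- obtained in this way.
  ·-1* : ∀ i x → i · x ≈ (i · 1#) * x
  ·-1* (+ n)    x = ℕ·-1* n x
  ·-1* -[1+ n ] x = ≈-trans (-‿cong (ℕ·-1* (suc n) x)) (-‿distribˡ-* _ x)

  1·x≈x : ∀ x → 1ℤ · x ≈ x
  1·x≈x x = +-identityʳ x

  -1·x≈-x : ∀ x → -1ℤ · x ≈ - x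
  -1·x≈-x x = -‿cong (+-identityʳ x)

  ∑-const : {I : Set} (xs : List I) (x : Carrier) → ∑ xs (λ _ → x) ≈ (+ length xs) · x
  ∑-const []       x = ≈-refl
  ∑-const (_ ∷ xs) x = +-congˡ (∑-const xs x)

module Quotient (R : Ring 0ℓ 0ℓ) (G : Pred (Ring.Carrier R) 0ℓ) where

  open Ring R renaming (refl to ≈-refl; sym to ≈-sym; trans to ≈-trans)
  open RingNotions R
  open IntegerMultiples R using (-‿interchange; ·-1*)
  open import Algebra.Properties.Ring R using (-‿+-comm; -‿involutive; x[y-z]≈xy-xz; [y-z]x≈yx-zx)
  open import Relation.Binary.Reasoning.Setoid setoid

  infix 4 _≃_
  _≃_ : Carrier → Carrier → Set
  x ≃ y = x ≡ y [mod ⟨ G ⟩ ]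

  ≈⇒≃ : ∀ {x y} → x ≈ y → x ≃ y
  ≈⇒≃ {x} {y} e = resp (≈-sym (≈-trans (+-congʳ e) (-‿inverseʳ y))) zer

  ≃-sym : ∀ {x y} → x ≃ y → y ≃ x
  ≃-sym {x} {y} p = resp (begin
    - (x - y)      ≈⟨ -‿+-comm x (- y) ⟨
    - x + - - y    ≈⟨ +-congˡ (-‿involutive y) ⟩
    - x + y        ≈⟨ +-comm _ _ ⟩
    y - x          ∎) (neg p)

  ≃-trans : ∀ {x y z} → x ≃ y → y ≃ z → x ≃ z
  ≃-trans {x} {y} {z} p q = resp (begin
    (x - y) + (y - z)    ≈⟨ +-assoc _ _ _ ⟩
    x + (- y + (y - z))  ≈⟨ +-congˡ (+-assoc _ _ _) ⟨
    x + ((- y + y) - z)  ≈⟨ +-congˡ (+-congʳ (-‿inverseˡ y)) ⟩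
    x + (0# - z)         ≈⟨ +-congˡ (+-identityˡ _) ⟩
    x - z                ∎) (add p q)

  ≃-+-cong : ∀ {x y z w} → x ≃ y → z ≃ w → x + z ≃ y + w
  ≃-+-cong p q = resp (≈-sym (-‿interchange _ _ _ _)) (add p q)

  ≃-neg-cong : ∀ {x y} → x ≃ y → - x ≃ - y
  ≃-neg-cong p = resp (≈-sym (-‿+-comm _ _)) (neg p)

  ≃-*-cong : ∀ {x y z w} → x ≃ y → z ≃ w → x * z ≃ y * w
  ≃-*-cong {x} {y} {z} {w} p q = ≃-trans
    (resp ([y-z]x≈yx-zx z x y) (mulʳ z p))
    (resp (x[y-z]≈xy-xz y z w) (mulˡ y q))

  -- Carrier and operations stay those of `R`, and only the equality is coarsened. Sums and
  -- multiples formed in `R` are thus definitionally those of the quotient, and the lemmas on finite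
  -- sums apply to them modulo the ideal.
  quotient : Ring 0ℓ 0ℓ
  quotient = record
    { Carrier = Carrier ; _≈_ = _≃_ ; _+_ = _+_ ; _*_ = _*_ ; -_ = -_ ; 0# = 0# ; 1# = 1#
    ; isRing = record
      { +-isAbelianGroup = record
        { isGroup = record
          { isMonoid = record
            { isSemigroup = record
              { isMagma = record
                { isEquivalence = record { refl = ≈⇒≃ ≈-refl ; sym = ≃-sym ; trans = ≃-trans }
                ; ∙-cong = ≃-+-cong }
              ; assoc = λ x y z → ≈⇒≃ (+-assoc x y z) }
            ; identity = (λ x → ≈⇒≃ (+-identityˡ x)) , (λ x → ≈⇒≃ (+-identityʳ x)) }
          ; inverse = (λ x → ≈⇒≃ (-‿inverseˡ x)) , (λ x → ≈⇒≃ (-‿inverseʳ x))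
          ; ⁻¹-cong = ≃-neg-cong }
        ; comm = λ x y → ≈⇒≃ (+-comm x y) }
      ; *-cong = ≃-*-cong
      ; *-assoc = λ x y z → ≈⇒≃ (*-assoc x y z)
      ; *-identity = (λ x → ≈⇒≃ (*-identityˡ x)) , (λ x → ≈⇒≃ (*-identityʳ x))
      ; distrib = (λ x y z → ≈⇒≃ (distribˡ x y z)) , (λ x y z → ≈⇒≃ (distribʳ x y z)) } }

  ·-cong-≃ : ∀ i {x y} → x ≃ y → i · x ≃ i · y
  ·-cong-≃ i {x} {y} p = ≃-trans (≈⇒≃ (·-1* i x))
    (≃-trans (≃-*-cong (≈⇒≃ ≈-refl) p) (≈⇒≃ (≈-sym (·-1* i y))))

-- Ladders

module LadderDecomposition (P : FinitePoset) (free : PosetNotions.[3+1]-Free P) where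

  open FinitePoset P
  open PosetNotions P using (_∼_)

  data Comparison (a b : Carrier) : Set where
    lt : a ≺ b → Comparison a b
    gt : b ≺ a → Comparison a b
    in∼ : a ∼ b → Comparison a b

  compare : ∀ a b → Comparison a b
  compare a b with a ≺? b | b ≺? a
  ... | yes p | _     = lt p
  ... | no _  | yes q = gt q
  ... | no p  | no q  = in∼ (p , q)

  ∼-sym : ∀ {a b} → a ∼ b → b ∼ a
  ∼-sym (p , q) = q , p

  -- Otherwise `d` would lie above `c`, hence above `b`, or form a 3+1 with the chain. This lemma
  -- and its mirror image `below` are where the hypothesis `free` is applied.
  above : ∀ {a b c d} → a ≺ b → b ≺ c → d ∼ a → d ∼ b → d ≺ c
  above {a} {b} {c} {d} p q r s with compare d c
  ... | lt t  = t
  ... | gt t  = ⊥-elim (proj₂ s (≺-trans q t))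
  ... | in∼ t = ⊥-elim (free p q r s t)

  below : ∀ {a b c d} → a ≺ b → b ≺ c → d ∼ b → d ∼ c → a ≺ d
  below {a} {b} {c} {d} p q r s with compare a d
  ... | lt t  = t
  ... | gt t  = ⊥-elim (proj₁ r (≺-trans t p))
  ... | in∼ t = ⊥-elim (free p q (∼-sym t) r s)

  Chain : List Carrier → Set
  Chain = AllPairs _≺_

  Blocks : Set
  Blocks = List (List Carrier × List Carrier)

  -- A path of inc(A , B) that starts at the least element of A and
  -- alternates between A and B.  The further edge of a 4-cycle is not excluded.
  data Zig : List Carrier → List Carrier → Set where
    odd  : ∀ {a} → Zig [ a ] []
    even : ∀ {a b} → a ∼ b → Zig [ a ] [ b ]
    step : ∀ {a b a′ A B} → a ∼ b → b ∼ a′ → Zig (a′ ∷ A) B → Zig (a ∷ a′ ∷ A) (b ∷ B)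

  Block : List Carrier → List Carrier → Set
  Block A B = Zig A B ⊎ Zig B A

  Under : List Carrier → List Carrier → Carrier → Set
  Under C D x = All (x ≺_) C × All (x ≺_) D

  Separated : (A B C D : List Carrier) → Set
  Separated A B C D = All (Under C D) A × All (Under C D) B

  left right : Blocks → List Carrier
  left  []             = []
  left  ((A , _) ∷ bs) = A ++ left bs
  right []             = []
  right ((_ , B) ∷ bs) = B ++ right bs

  data Valid : Blocks → Set where
    []   : Valid []
    cons : ∀ {A B bs} → Chain A → Chain B → Block A B →
           Separated A B (left bs) (right bs) → Valid bs → Valid ((A , B) ∷ bs)

  -- The invariant of the search for a path from `a`: of the remaining elements of the other chain,
  -- at most the first is incomparable to `a`, so it is the only candidate for the next vertex.
  Near : Carrier → List Carrier → Set
  Near a []       = ⊤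
  Near a (b ∷ bs) = ¬ (b ≺ a) × All (a ≺_) bs

  record Initial (a : Carrier) (As Bs : List Carrier) : Set where
    constructor initial
    field
      {A B C D} : List Carrier
      eqA : As ≡ A ++ C
      eqB : Bs ≡ B ++ D
      zig : Zig (a ∷ A) B
      sep : Separated (a ∷ A) B C D

  up : ∀ {a b cs} → a ≺ b → All (b ≺_) cs → All (a ≺_) cs
  up p = All.map (≺-trans p)

  -- `Near` leaves one candidate for the neighbour of `a`, so the path is forced. It stops when the
  -- next candidate is missing or lies above the current end, and everything left over then lies
  -- above the whole path.
  initialPath : ∀ a As Bs → Chain (a ∷ As) → Chain Bs → Near a Bs → Initial a As Bs
  initialPath a As [] (p ∷ _) _ _ = initial {A = []} {B = []} refl refl odd (((p , []) ∷ []) , [])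
  initialPath a As (b ∷ Bs) (p ∷ _) _ (_ , q) with compare a b
  ... | lt a≺b = initial {A = []} {B = []} refl refl odd (((p , a≺b ∷ q) ∷ []) , [])
  initialPath a As (b ∷ Bs) _ _ (b⊀a , _) | gt b≺a = ⊥-elim (b⊀a b≺a)
  initialPath a [] (b ∷ Bs) _ (r ∷ _) (_ , q) | in∼ a∼b =
    initial {A = []} {B = [ b ]} refl refl (even a∼b) ((([] , q) ∷ []) , (([] , r) ∷ []))
  initialPath a (a′ ∷ As) (b ∷ Bs) ((a≺a′ ∷ p) ∷ (p′ ∷ u)) (r ∷ v) (_ , q) | in∼ a∼b
    with compare b a′
  ... | lt b≺a′ = initial {A = []} {B = [ b ]} refl refl (even a∼b)
                    (((a≺a′ ∷ p , q) ∷ []) , ((b≺a′ ∷ up b≺a′ p′ , r) ∷ []))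
  ... | gt a′≺b = ⊥-elim (proj₁ a∼b (≺-trans a≺a′ a′≺b))
  -- The search continues from `a′`. If `a′` is incomparable to both `b` and `b₂`, then `above` puts
  -- it below the rest of `Bs`, which restores `Near`; the same lemma puts `b` below the rest of
  -- `As`.
  ... | in∼ b∼a′ = extend (initialPath a′ As Bs (p′ ∷ u) v (near Bs r v))
    where
    near : ∀ Bs → All (b ≺_) Bs → Chain Bs → Near a′ Bs
    near []        _           _       = tt
    near (b₂ ∷ Bs) (b≺b₂ ∷ _) (w ∷ _) =
      b₂⊀a′ , All.map above′ w
      where
      b₂⊀a′ : ¬ (b₂ ≺ a′)
      b₂⊀a′ t = proj₁ b∼a′ (≺-trans b≺b₂ t)
      above′ : ∀ {t} → b₂ ≺ t → a′ ≺ t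
      above′ b₂≺t with compare a′ b₂
      ... | lt s  = ≺-trans s b₂≺t
      ... | gt s  = ⊥-elim (b₂⊀a′ s)
      ... | in∼ s = above b≺b₂ b₂≺t (∼-sym b∼a′) s
    b≺As : All (b ≺_) As
    b≺As = All.map (λ a′≺t → above a≺a′ a′≺t (∼-sym a∼b) b∼a′) p′
    extend : Initial a′ As Bs → Initial a (a′ ∷ As) (b ∷ Bs)
    extend (initial {A} {B} {C} {D} refl refl z (s ∷ sA , sB)) =
      initial {A = a′ ∷ A} {B = b ∷ B} refl refl (step a∼b b∼a′ z)
        ((All.++⁻ʳ A p , All.++⁻ʳ B q) ∷ s ∷ sA , (All.++⁻ʳ A b≺As , All.++⁻ʳ B r) ∷ sB)

  record FirstBlock (C D : List Carrier) : Set where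
    constructor firstBlock
    field
      {A B C′ D′} : List Carrier
      eqC : C ≡ A ++ C′
      eqD : D ≡ B ++ D′
      block : Block A B
      sep : Separated A B C′ D′
      shorter : length C′ ℕ.+ length D′ < length C ℕ.+ length D

  swapFirst : ∀ {C D} → FirstBlock C D → FirstBlock D C
  swapFirst {C} {D} (firstBlock {C′ = C′} {D′} p q b (s , t) l) =
    firstBlock q p (Sum.swap b) (All.map (λ (x , y) → y , x) t , All.map (λ (x , y) → y , x) s)
      (subst₂ _<_ (ℕ.+-comm (length C′) (length D′)) (ℕ.+-comm (length C) (length D)) l)

  fromInitial : ∀ {a As Bs} → Initial a As Bs → FirstBlock (a ∷ As) Bs
  fromInitial (initial {A} {B} {C} {D} refl refl z s) =
    firstBlock refl refl (inj₁ z) s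
      (s≤s (ℕ.+-mono-≤ (suffix A C) (suffix B D)))
    where
    suffix : ∀ (A C : List Carrier) → length C ≤ length (A ++ C)
    suffix A C = subst (length C ≤_) (sym (List.length-++ A)) (ℕ.m≤n+m _ _)

  NonEmpty : List Carrier → List Carrier → Set
  NonEmpty [] [] = ⊥
  NonEmpty _  _  = ⊤

  -- The path must start at a least element of one chain that has at most one neighbour. If both
  -- chains are nonempty, `c` or `d` qualifies unless `c ∼ d` and each has a second neighbour. Then
  -- the two least elements of each chain form a 4-cycle, and `above` makes it a block of its own.
  chainFirst : ∀ C D → Chain C → Chain D → NonEmpty C D → FirstBlock C D
  chainFirst (c ∷ C) []      u v _ = fromInitial (initialPath c C [] u v tt)
  chainFirst []      (d ∷ D) u v _ = swapFirst (fromInitial (initialPath d D [] v u tt))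
  chainFirst (c ∷ C) (d ∷ D) u@(p ∷ _) v@(q ∷ _) _ with compare c d
  ... | lt c≺d = fromInitial (initialPath c C (d ∷ D) u v (≺-asym c≺d , up c≺d q))
  ... | gt d≺c = swapFirst (fromInitial (initialPath d D (c ∷ C) v u (≺-asym d≺c , up d≺c p)))
  chainFirst (c ∷ C) (d ∷ []) u v _ | in∼ c∼d =
    fromInitial (initialPath c C (d ∷ []) u v (proj₂ c∼d , []))
  chainFirst (c ∷ []) (d ∷ D@(_ ∷ _)) u v _ | in∼ c∼d =
    swapFirst (fromInitial (initialPath d D (c ∷ []) v u (proj₁ c∼d , [])))
  chainFirst (c ∷ c₂ ∷ C) (d ∷ d₂ ∷ D) u@((c≺c₂ ∷ cs) ∷ p ∷ _) v@((d≺d₂ ∷ ds) ∷ q ∷ _) _ | in∼ c∼d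
    with compare c d₂ | compare d c₂
  ... | lt c≺d₂ | _       =
    fromInitial (initialPath c (c₂ ∷ C) (d ∷ d₂ ∷ D) u v (proj₂ c∼d , c≺d₂ ∷ up c≺d₂ q))
  ... | gt d₂≺c | _       = ⊥-elim (proj₂ c∼d (≺-trans d≺d₂ d₂≺c))
  ... | in∼ _   | lt d≺c₂ =
    swapFirst (fromInitial (initialPath d (d₂ ∷ D) (c ∷ c₂ ∷ C) v u (proj₁ c∼d , d≺c₂ ∷ up d≺c₂ p)))
  ... | in∼ _   | gt c₂≺d = ⊥-elim (proj₁ c∼d (≺-trans c≺c₂ c₂≺d))
  -- Three edges make up the `Zig`; the fourth, `c ∼ d₂`, serves to derive `c₂ ∼ d₂` and the
  -- separation.
  ... | in∼ c∼d₂ | in∼ d∼c₂ = firstBlock {A = c ∷ c₂ ∷ []} {B = d ∷ d₂ ∷ []} refl refl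
    (inj₁ (step c∼d d∼c₂ (even c₂∼d₂)))
    ((cs , All.map (λ t → above d≺d₂ t c∼d c∼d₂) q) ∷
     (p , All.map (λ t → above d≺d₂ t (∼-sym d∼c₂) c₂∼d₂) q) ∷ [] ,
     (All.map (λ t → above c≺c₂ t (∼-sym c∼d) d∼c₂) p , ds) ∷
     (All.map (λ t → above c≺c₂ t (∼-sym c∼d₂) (∼-sym c₂∼d₂)) p , q) ∷ [])
    (s≤s (ℕ.m≤n⇒m≤1+n (ℕ.+-monoʳ-≤ (length C) (ℕ.m≤n⇒m≤1+n (ℕ.m≤n⇒m≤1+n ℕ.≤-refl)))))
    where
    c₂∼d₂ : c₂ ∼ d₂
    c₂∼d₂ = (λ t → proj₁ c∼d₂ (≺-trans c≺c₂ t)) , (λ t → proj₁ d∼c₂ (≺-trans d≺d₂ t))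

  chain-++⁻ : ∀ A {C} → Chain (A ++ C) → Chain A × Chain C
  chain-++⁻ []      u       = [] , u
  chain-++⁻ (a ∷ A) (p ∷ u) = let v , w = chain-++⁻ A u in All.++⁻ˡ A p ∷ v , w

  -- The recursion continues with what remains after the first block, which is not a structural
  -- subterm, so the bound `n` on the total length carries the termination.
  decomposition : ∀ n C D → length C ℕ.+ length D ≤ n → Chain C → Chain D →
                  ∃ λ bs → Valid bs × left bs ≡ C × right bs ≡ D
  peel : ∀ n C D → length C ℕ.+ length D ≤ suc n → Chain C → Chain D → FirstBlock C D →
         ∃ λ bs → Valid bs × left bs ≡ C × right bs ≡ D
  decomposition _       []        []        _ _ _ = [] , [] , refl , refl
  decomposition (suc n) C@(_ ∷ _) D         l u v = peel n C D l u v (chainFirst C D u v tt)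
  decomposition (suc n) []        D@(_ ∷ _) l u v = peel n [] D l u v (chainFirst [] D u v tt)
  peel n _ _ l u v (firstBlock {A} {B} {C} {D} refl refl b s h)
    with u₁ , u₂ ← chain-++⁻ A u | v₁ , v₂ ← chain-++⁻ B v
    with bs , val , refl , refl ← decomposition n C D (ℕ.≤-pred (ℕ.≤-trans h l)) u₂ v₂ =
    (A , B) ∷ bs , cons u₁ v₁ b s val , refl , refl

-- Uniqueness of the block decomposition, and its reorientations

++-cancel : {A : Set} (xs ys : List A) {us vs : List A} → length xs ≡ length ys →
            xs ++ us ≡ ys ++ vs → xs ≡ ys × us ≡ vs
++-cancel []       []       _ e = refl , e
++-cancel (x ∷ xs) (y ∷ ys) l e with refl , e′ ← List.∷-injective e
  with refl , e″ ← ++-cancel xs ys (ℕ.suc-injective l) e′ = refl , e″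

choose : ℕ → ℕ → ℕ
choose _       zero    = 1
choose zero    (suc q) = 0
choose (suc r) (suc q) = choose r (suc q) ℕ.+ choose r q

module Ladders (P : FinitePoset) (free : PosetNotions.[3+1]-Free P) where

  open FinitePoset P
  open LadderDecomposition P free public

  -- A path that starts in an initial segment lying below everything else cannot leave it: an edge
  -- across the border would join comparable elements.
  absorb : ∀ {a A₁ B C D A′ B′ C′ D′} → Zig A′ B′ → Separated (a ∷ A₁) B C D →
           A′ ++ C′ ≡ a ∷ A₁ ++ C → B′ ++ D′ ≡ B ++ D →
           length A′ ≤ suc (length A₁) × length B′ ≤ length B
  absorb odd _ _ _ = s≤s z≤n , z≤n
  absorb {B = []} (even a∼b) (((_ , a≺b ∷ _) ∷ _) , _) refl refl = ⊥-elim (proj₁ a∼b a≺b)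
  absorb {B = _ ∷ _} (even a∼b) _ _ _ = s≤s z≤n , s≤s z≤n
  absorb {B = []} (step a∼b _ _) (((_ , a≺b ∷ _) ∷ _) , _) e refl with refl ← List.∷-injectiveˡ e =
    ⊥-elim (proj₁ a∼b a≺b)
  absorb {A₁ = []} {B = b ∷ _} (step _ b∼a′ _) (_ , (b≺a′ ∷ _ , _) ∷ _) refl f
    with refl ← List.∷-injectiveˡ f = ⊥-elim (proj₁ b∼a′ b≺a′)
  absorb {A₁ = a′ ∷ A₂} {B = b ∷ _} (step _ _ z) (_ ∷ s , _ ∷ t) e f
    with l , m ← absorb z (s , t) (List.∷-injectiveʳ e) (List.∷-injectiveʳ f) = s≤s l , s≤s m

  swapSep : ∀ {A B C D} → Separated A B C D → Separated B A D C
  swapSep (s , t) = All.map (λ (x , y) → y , x) t , All.map (λ (x , y) → y , x) s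

  absorbBlock : ∀ {A B C D A′ B′ C′ D′} → Block A B → Zig A′ B′ →
                Separated A B C D → Separated A′ B′ C′ D′ →
                A′ ++ C′ ≡ A ++ C → B′ ++ D′ ≡ B ++ D →
                length A′ ≤ length A × length B′ ≤ length B
  absorbBlock {A = a ∷ A} _          z s _ e f = absorb z s e f
  -- If `A` is empty, the block is a single element of the other chain below everything else, in
  -- particular below the first vertex of the given path. Each form of the path contradicts this.
  absorbBlock {A = []}    (inj₂ odd) odd (_ , (b≺a ∷ _ , _) ∷ []) ((_ , a≺b ∷ _) ∷ [] , _) refl refl =
    ⊥-elim (≺-asym a≺b b≺a)
  absorbBlock {A = []}    (inj₂ odd) (even a∼b) (_ , (b≺a ∷ _ , _) ∷ []) _ refl refl =
    ⊥-elim (proj₂ a∼b b≺a)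
  absorbBlock {A = []}    (inj₂ odd) (step a∼b _ _) (_ , (b≺a ∷ _ , _) ∷ []) _ refl refl =
    ⊥-elim (proj₂ a∼b b≺a)

  firstBlock-≤ : ∀ {A B C D A′ B′ C′ D′} → Block A B → Block A′ B′ →
                 Separated A B C D → Separated A′ B′ C′ D′ →
                 A′ ++ C′ ≡ A ++ C → B′ ++ D′ ≡ B ++ D →
                 length A′ ≤ length A × length B′ ≤ length B
  firstBlock-≤ b (inj₁ z) s s′ e f = absorbBlock b z s s′ e f
  firstBlock-≤ b (inj₂ z) s s′ e f =
    let l , m = absorbBlock (Sum.swap b) z (swapSep s) (swapSep s′) f e in m , l

  ¬block[] : ¬ Block [] []
  ¬block[] (inj₁ ())
  ¬block[] (inj₂ ())

  -- The two first blocks absorb each other, so their sides have equal lengths, and as prefixes of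
  -- the same chains they coincide. This makes `blocks` and `sides` inverse to each other.
  valid-unique : ∀ {bs bs′} → Valid bs → Valid bs′ →
                 left bs ≡ left bs′ → right bs ≡ right bs′ → bs ≡ bs′
  valid-unique [] [] _ _ = refl
  valid-unique [] (cons {A = []} {[]} _ _ b _ _) _ _ = ⊥-elim (¬block[] b)
  valid-unique (cons {A = []} {[]} _ _ b _ _) [] _ _ = ⊥-elim (¬block[] b)
  valid-unique {(A , B) ∷ _} {(A′ , B′) ∷ _} (cons _ _ b s v) (cons _ _ b′ s′ v′) e f
    with l , m ← firstBlock-≤ b b′ s s′ (sym e) (sym f)
       | l′ , m′ ← firstBlock-≤ b′ b s′ s e f
    with refl , e′ ← ++-cancel A A′ (ℕ.≤-antisym l′ l) e
       | refl , f′ ← ++-cancel B B′ (ℕ.≤-antisym m′ m) f =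
    cong (_ ∷_) (valid-unique v v′ e′ f′)

  valid-chains : ∀ {bs} → Valid bs → Chain (left bs) × Chain (right bs)
  valid-chains [] = [] , []
  valid-chains (cons u v _ (s , t) val) with p , q ← valid-chains val =
    AllPairs.++⁺ u p (All.map proj₁ s) , AllPairs.++⁺ v q (All.map proj₂ t)

  zig-length : ∀ {A B} → Zig A B → length A ≡ length B ⊎ length A ≡ suc (length B)
  zig-length odd          = inj₂ refl
  zig-length (even _)     = inj₁ refl
  zig-length (step _ _ z) = Sum.map (cong suc) (cong suc) (zig-length z)

  -- A path alternates between the sides, so its surplus is at most one. This is why `unbalanced`
  -- and `rights` can count blocks instead of elements.
  block-< : ∀ {A B} → Block A B → length B < length A → length A ≡ suc (length B)
  block-< {A} {B} (inj₁ z) l with zig-length z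
  ... | inj₁ e = ⊥-elim (ℕ.<-irrefl (sym e) l)
  ... | inj₂ e = e
  block-< {A} {B} (inj₂ z) l with zig-length z
  ... | inj₁ e = ⊥-elim (ℕ.<-irrefl e l)
  ... | inj₂ e = ⊥-elim (ℕ.<-asym l (subst (length A <_) (sym e) ℕ.≤-refl))

  -- Reorienting blocks

  data Reoriented : Blocks → Blocks → Set where
    []   : Reoriented [] []
    keep : ∀ {A B bs bs′} → Reoriented bs bs′ → Reoriented ((A , B) ∷ bs) ((A , B) ∷ bs′)
    flip : ∀ {A B bs bs′} → length A ≢ length B → Reoriented bs bs′ →
           Reoriented ((A , B) ∷ bs) ((B , A) ∷ bs′)

  reoriented-sym : ∀ {bs bs′} → Reoriented bs bs′ → Reoriented bs′ bs
  reoriented-sym []         = []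
  reoriented-sym (keep r)   = keep (reoriented-sym r)
  reoriented-sym (flip n r) = flip (n ∘ sym) (reoriented-sym r)

  reoriented-All : ∀ {bs bs′} {R : Carrier → Set} → Reoriented bs bs′ →
                   All R (left bs) × All R (right bs) → All R (left bs′) × All R (right bs′)
  reoriented-All [] p = p
  reoriented-All (keep {A} {B} r) (p , q)
    with p′ , q′ ← reoriented-All r (All.++⁻ʳ A p , All.++⁻ʳ B q) =
    All.++⁺ (All.++⁻ˡ A p) p′ , All.++⁺ (All.++⁻ˡ B q) q′
  reoriented-All (flip {A} {B} _ r) (p , q)
    with p′ , q′ ← reoriented-All r (All.++⁻ʳ A p , All.++⁻ʳ B q) =
    All.++⁺ (All.++⁻ˡ B q) p′ , All.++⁺ (All.++⁻ˡ A p) q′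

  reoriented-valid : ∀ {bs bs′} → Reoriented bs bs′ → Valid bs → Valid bs′
  reoriented-valid [] [] = []
  reoriented-valid (keep r) (cons u v b (s , t) val) =
    cons u v b (All.map (reoriented-All r) s , All.map (reoriented-All r) t) (reoriented-valid r val)
  reoriented-valid (flip _ r) (cons u v b (s , t) val) =
    cons v u (Sum.swap b) (All.map (reoriented-All r) t , All.map (reoriented-All r) s)
      (reoriented-valid r val)

  Left : Blocks → Set
  Left = All (λ (A , B) → length B ≤ length A)

  normal : Blocks → Blocks
  normal []             = []
  normal ((A , B) ∷ bs) with length A ℕ.<? length B
  ... | yes _ = (B , A) ∷ normal bs
  ... | no  _ = (A , B) ∷ normal bs

  rights : Blocks → ℕ
  rights []             = 0
  rights ((A , B) ∷ bs) with length A ℕ.<? length B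
  ... | yes _ = suc (rights bs)
  ... | no  _ = rights bs

  unbalanced : Blocks → ℕ
  unbalanced []             = 0
  unbalanced ((A , B) ∷ bs) with length B ℕ.<? length A
  ... | yes _ = suc (unbalanced bs)
  ... | no  _ = unbalanced bs

  normal-reoriented : ∀ bs → Reoriented bs (normal bs)
  normal-reoriented [] = []
  normal-reoriented ((A , B) ∷ bs) with length A ℕ.<? length B
  ... | yes l = flip (ℕ.<⇒≢ l) (normal-reoriented bs)
  ... | no  _ = keep (normal-reoriented bs)

  normal-left : ∀ bs → Left (normal bs)
  normal-left [] = []
  normal-left ((A , B) ∷ bs) with length A ℕ.<? length B
  ... | yes l = ℕ.<⇒≤ l ∷ normal-left bs
  ... | no  n = ℕ.≮⇒≥ n ∷ normal-left bs

  left-rights : ∀ {bs} → Left bs → rights bs ≡ 0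
  left-rights [] = refl
  left-rights {(A , B) ∷ bs} (p ∷ ps) with length A ℕ.<? length B
  ... | yes l = ⊥-elim (ℕ.<⇒≱ l p)
  ... | no  _ = left-rights ps

  -- For sides of lengths n - l and l this fixes the number of unbalanced blocks at n - 2l, the
  -- upper index of the binomial.
  left-unbalanced : ∀ {bs} → Valid bs → Left bs →
                    length (left bs) ≡ length (right bs) ℕ.+ unbalanced bs
  left-unbalanced [] _ = refl
  left-unbalanced {(A , B) ∷ bs} (cons _ _ b _ val) (p ∷ ps)
    rewrite List.length-++ A {left bs} | List.length-++ B {right bs} | left-unbalanced val ps
    with length B ℕ.<? length A
  ... | yes l rewrite block-< b l | ℕ.+-suc (length B ℕ.+ length (right bs)) (unbalanced bs)
                = cong suc (sym (ℕ.+-assoc (length B) _ _))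
  ... | no  n rewrite ℕ.≤-antisym p (ℕ.≮⇒≥ n) = sym (ℕ.+-assoc (length A) _ _)

  -- Turning a block to the left moves one element out of the second chain. If that chain has length
  -- b, and length l in the normal form, then `rights` is b - l, the lower index of the binomial.
  length-rights : ∀ {bs} → Valid bs →
    length (right bs) ≡ length (right (normal bs)) ℕ.+ rights bs
  length-rights [] = refl
  length-rights {(A , B) ∷ bs} (cons _ _ b _ val) with length A ℕ.<? length B
  ... | yes l rewrite List.length-++ A {right (normal bs)} | List.length-++ B {right bs}
                    | length-rights val | block-< (Sum.swap b) l
                    | ℕ.+-suc (length A ℕ.+ length (right (normal bs))) (rights bs) =
                cong suc (sym (ℕ.+-assoc (length A) _ _))
  ... | no  _ rewrite List.length-++ B {right (normal bs)} | List.length-++ B {right bs}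
                    | length-rights val = sym (ℕ.+-assoc (length B) _ _)

  length-reoriented : ∀ {bs bs′} → Reoriented bs bs′ →
    length (left bs) ℕ.+ length (right bs) ≡ length (left bs′) ℕ.+ length (right bs′)
  length-reoriented [] = refl
  length-reoriented (keep {A} {B} {bs} {bs′} r)
    rewrite List.length-++ A {left bs} | List.length-++ B {right bs}
          | List.length-++ A {left bs′} | List.length-++ B {right bs′} =
    trans (+-interchange (length A) _ (length B) _)
      (trans (cong (length A ℕ.+ length B ℕ.+_) (length-reoriented r))
             (+-interchange (length A) (length B) _ _))
  length-reoriented (flip {A} {B} {bs} {bs′} _ r)
    rewrite List.length-++ A {left bs} | List.length-++ B {right bs}
          | List.length-++ B {left bs′} | List.length-++ A {right bs′} =
    trans (+-interchange (length A) _ (length B) _)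
      (trans (cong₂ ℕ._+_ (ℕ.+-comm (length A) (length B)) (length-reoriented r))
             (+-interchange (length B) (length A) _ _))

  -- Meaningful for left blocks only: turns q of the unbalanced ones to the right.
  reorientations : Blocks → ℕ → List Blocks
  reorientations [] zero    = [ [] ]
  reorientations [] (suc q) = []
  reorientations ((A , B) ∷ bs) q with length B ℕ.<? length A
  reorientations ((A , B) ∷ bs) q       | no _  = map ((A , B) ∷_) (reorientations bs q)
  reorientations ((A , B) ∷ bs) zero    | yes _ = map ((A , B) ∷_) (reorientations bs zero)
  reorientations ((A , B) ∷ bs) (suc q) | yes _ =
    map ((A , B) ∷_) (reorientations bs (suc q)) ++ map ((B , A) ∷_) (reorientations bs q)

  reorientations-length : ∀ bs q → length (reorientations bs q) ≡ choose (unbalanced bs) q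
  reorientations-length [] zero = refl
  reorientations-length [] (suc q) = refl
  reorientations-length ((A , B) ∷ bs) q with length B ℕ.<? length A
  reorientations-length ((A , B) ∷ bs) q       | no _  =
    trans (List.length-map _ (reorientations bs q)) (reorientations-length bs q)
  reorientations-length ((A , B) ∷ bs) zero    | yes _ =
    trans (List.length-map _ (reorientations bs zero)) (reorientations-length bs zero)
  reorientations-length ((A , B) ∷ bs) (suc q) | yes _ =
    trans (List.length-++ (map ((A , B) ∷_) (reorientations bs (suc q))))
      (cong₂ ℕ._+_ (trans (List.length-map _ (reorientations bs (suc q))) (reorientations-length bs (suc q)))
                   (trans (List.length-map _ (reorientations bs q)) (reorientations-length bs q)))

  reorientations-unique : ∀ bs q → Unique (reorientations bs q)
  reorientations-unique [] zero = [] ∷ []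
  reorientations-unique [] (suc q) = []
  reorientations-unique ((A , B) ∷ bs) q with length B ℕ.<? length A
  reorientations-unique ((A , B) ∷ bs) q       | no _  =
    Unique.map⁺ List.∷-injectiveʳ (reorientations-unique bs q)
  reorientations-unique ((A , B) ∷ bs) zero    | yes _ =
    Unique.map⁺ List.∷-injectiveʳ (reorientations-unique bs zero)
  reorientations-unique ((A , B) ∷ bs) (suc q) | yes l =
    Unique.++⁺ (Unique.map⁺ List.∷-injectiveʳ (reorientations-unique bs (suc q)))
               (Unique.map⁺ List.∷-injectiveʳ (reorientations-unique bs q))
               (λ (p , q) → let _ , _ , e = ∈-map⁻ _ p ; _ , _ , f = ∈-map⁻ _ q
                                g = List.∷-injectiveˡ (trans (sym e) f)
                            in ℕ.<-irrefl (cong (length ∘ proj₂) g) l)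

  -- As `bs` is left, `normal` undoes exactly the turned blocks. With `reorientations-complete` this
  -- identifies the lists over a given normal form, so that `choose` counts them.
  reorientations-sound : ∀ bs q {bs′} → Left bs → bs′ ∈ reorientations bs q →
                         normal bs′ ≡ bs × rights bs′ ≡ q
  reorientations-sound [] zero _ (here refl) = refl , refl
  reorientations-sound ((A , B) ∷ bs) q _ i with length B ℕ.<? length A
  reorientations-sound ((A , B) ∷ bs) q (p ∷ ps) i | no _
    with bs″ , j , refl ← ∈-map⁻ _ i with length A ℕ.<? length B
  ... | yes l = ⊥-elim (ℕ.<⇒≱ l p)
  ... | no _ with refl , e ← reorientations-sound bs q ps j = refl , e
  reorientations-sound ((A , B) ∷ bs) zero (p ∷ ps) i | yes _
    with bs″ , j , refl ← ∈-map⁻ _ i with length A ℕ.<? length B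
  ... | yes l = ⊥-elim (ℕ.<⇒≱ l p)
  ... | no _ with refl , e ← reorientations-sound bs zero ps j = refl , e
  reorientations-sound ((A , B) ∷ bs) (suc q) (p ∷ ps) i | yes l
    with ∈-++⁻ (map ((A , B) ∷_) (reorientations bs (suc q))) i
  ... | inj₁ i′ with bs″ , j , refl ← ∈-map⁻ _ i′ with length A ℕ.<? length B
  ...   | yes l = ⊥-elim (ℕ.<⇒≱ l p)
  ...   | no _ with refl , e ← reorientations-sound bs (suc q) ps j = refl , e
  reorientations-sound ((A , B) ∷ bs) (suc q) (p ∷ ps) i | yes l | inj₂ i′
    with bs″ , j , refl ← ∈-map⁻ _ i′ with length B ℕ.<? length A
  ...   | no n = ⊥-elim (n l)
  ...   | yes _ with refl , e ← reorientations-sound bs q ps j = refl , cong suc e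

  reorientations-complete : ∀ bs → bs ∈ reorientations (normal bs) (rights bs)
  reorientations-complete [] = here refl
  reorientations-complete ((A , B) ∷ bs) with length A ℕ.<? length B
  reorientations-complete ((A , B) ∷ bs) | yes l with length A ℕ.<? length B
  ... | yes _ = ∈-++⁺ʳ _ (∈-map⁺ _ (reorientations-complete bs))
  ... | no  n = ⊥-elim (n l)
  reorientations-complete ((A , B) ∷ bs) | no n with length B ℕ.<? length A
  ... | no _  = ∈-map⁺ _ (reorientations-complete bs)
  ... | yes _ with rights bs | reorientations-complete bs
  ...   | zero  | i = ∈-map⁺ _ i
  ...   | suc q | i = ∈-++⁺ˡ (∈-map⁺ _ i)

  chain? : ∀ C → Dec (Chain C)
  chain? = allPairs? _≺?_

  -- Junk value [] unless both lists are chains.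
  blocks : List Carrier × List Carrier → Blocks
  blocks (C , D) with chain? C | chain? D
  ... | yes u | yes v = proj₁ (decomposition _ C D ℕ.≤-refl u v)
  ... | _     | _     = []

  blocks-valid : ∀ {C D} → Chain C → Chain D →
    Valid (blocks (C , D)) × left (blocks (C , D)) ≡ C × right (blocks (C , D)) ≡ D
  blocks-valid {C} {D} u v with chain? C | chain? D
  ... | yes u | yes v = proj₂ (decomposition _ C D ℕ.≤-refl u v)
  ... | no n  | _     = ⊥-elim (n u)
  ... | yes _ | no n  = ⊥-elim (n v)

  sides : Blocks → List Carrier × List Carrier
  sides bs = left bs , right bs

  blocks-sides : ∀ {bs} → Valid bs → blocks (sides bs) ≡ bs
  blocks-sides val with u , v ← valid-chains val with val′ , p , q ← blocks-valid u v =
    valid-unique val′ val p q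

  normalise : List Carrier × List Carrier → List Carrier × List Carrier
  normalise x = sides (normal (blocks x))

-- Words of chains modulo the ideal

module LadderWords (P : FinitePoset) (free : PosetNotions.[3+1]-Free P) where

  open FinitePoset P using (_≺_) renaming (Carrier to E)
  open PosetNotions P using (_∼_; u; uʷ; HGenerator; comm; rotate; gen; 𝓤; 𝓤-ring)
  open Ladders P free
  open Quotient 𝓤-ring HGenerator public
  open Ring quotient using (_*_; 1#; *-congˡ; *-congʳ; *-cong; *-assoc; *-identityˡ; *-identityʳ; setoid)
    renaming (refl to ≃-refl)
  open import Relation.Binary.Reasoning.Setoid setoid

  Commute : 𝓤 → 𝓤 → Set
  Commute x y = x * y ≃ y * x

  commute-1 : ∀ x → Commute x 1#
  commute-1 x = ≃-trans (*-identityʳ x) (≃-sym (*-identityˡ x))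

  commute-* : ∀ {x y z} → Commute x y → Commute x z → Commute x (y * z)
  commute-* {x} {y} {z} p q = begin
    x * (y * z)  ≈⟨ *-assoc x y z ⟨
    (x * y) * z  ≈⟨ *-congʳ p ⟩
    (y * x) * z  ≈⟨ *-assoc y x z ⟩
    y * (x * z)  ≈⟨ *-congˡ q ⟩
    y * (z * x)  ≈⟨ *-assoc y z x ⟨
    (y * z) * x  ∎

  commute-≺ : ∀ {a b} → a ≺ b → Commute (u a) (u b)
  commute-≺ p = ≃-sym (gen (comm p))

  commute-uʷ : ∀ {x} w → All (λ b → Commute x (u b)) w → Commute x (uʷ w)
  commute-uʷ []      []       = commute-1 _
  commute-uʷ (_ ∷ w) (p ∷ ps) = commute-* p (commute-uʷ w ps)

  uʷ-++ : ∀ v w → uʷ (v ++ w) ≃ uʷ v * uʷ w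
  uʷ-++ []      w = ≃-sym (*-identityˡ _)
  uʷ-++ (x ∷ v) w = ≃-trans (*-congˡ (uʷ-++ v w)) (≃-sym (*-assoc _ _ _))

  uʷ-reverse : ∀ {C} → Chain C → uʷ (reverse C) ≃ uʷ C
  uʷ-reverse []                  = ≃-refl
  uʷ-reverse {x ∷ C} (p ∷ chain) = begin
    uʷ (reverse (x ∷ C))        ≡⟨ cong uʷ (List.unfold-reverse x C) ⟩
    uʷ (reverse C ++ [ x ])     ≈⟨ uʷ-++ (reverse C) [ x ] ⟩
    uʷ (reverse C) * (u x * 1#) ≈⟨ *-cong (uʷ-reverse chain) (*-identityʳ _) ⟩
    uʷ C * u x                  ≈⟨ commute-uʷ C (All.map commute-≺ p) ⟨
    u x * uʷ C                  ∎

  commute-pair : ∀ {a b c} → a ∼ b → b ∼ c → a ≺ c → Commute (u b) (u a * u c)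
  commute-pair {a} {b} {c} p q r = begin
    u b * (u a * u c)  ≈⟨ *-congˡ (commute-≺ r) ⟩
    u b * (u c * u a)  ≈⟨ *-assoc _ _ _ ⟨
    u b * u c * u a    ≈⟨ gen (rotate p q r) ⟨
    u c * u a * u b    ≈⟨ *-congʳ (commute-≺ r) ⟨
    u a * u c * u b    ∎

  -- By `above` and `below`, the elements of the chain after `a′` lie above `b` and those before `a`
  -- lie below it, so `u b` passes each of them singly. It passes `a` and `a′` together, by
  -- `commute-pair`.
  commute-two : ∀ {b a a′} A₁ {A₂} → Chain (A₁ ++ a ∷ a′ ∷ A₂) → a ∼ b → b ∼ a′ →
                Commute (u b) (uʷ (A₁ ++ a ∷ a′ ∷ A₂))
  commute-two {b} {a} {a′} [] {A₂} ((a≺a′ ∷ _) ∷ p ∷ _) a∼b b∼a′ =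
    ≃-trans (*-congˡ (≃-sym (*-assoc _ _ _)))
      (≃-trans (commute-* (commute-pair a∼b b∼a′ a≺a′)
                 (commute-uʷ A₂ (All.map (λ t → commute-≺ (above a≺a′ t (∼-sym a∼b) b∼a′)) p)))
               (*-congʳ (*-assoc _ _ _)))
  commute-two (x ∷ A₁) (p ∷ chain) a∼b b∼a′ with All.++⁻ʳ A₁ p | chain-++⁻ A₁ chain
  ... | x≺a ∷ _ | _ , (a≺a′ ∷ _) ∷ _ =
    commute-* (≃-sym (commute-≺ (below x≺a a≺a′ (∼-sym a∼b) b∼a′))) (commute-two A₁ chain a∼b b∼a′)

  -- Every b on an odd path has two neighbours on the longer side.
  commute-odd : ∀ {A B} A₁ → Zig A B → length A ≡ suc (length B) → Chain (A₁ ++ A) →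
                All (λ b → Commute (uʷ (A₁ ++ A)) (u b)) B
  commute-odd A₁ odd _ _ = []
  commute-odd A₁ (step {a} {b} {a′} {A} p q z) l chain =
    ≃-sym (commute-two A₁ chain p q) ∷
    subst (λ w → All (λ b → Commute (uʷ w) (u b)) _) eq
      -- The visited `a` moves into the prefix, because every later `b` must commute with the whole
      -- longer side and not only with the rest of the path.
      (commute-odd (A₁ ++ [ a ]) z (ℕ.suc-injective l) (subst Chain (sym eq) chain))
    where
    eq : (A₁ ++ [ a ]) ++ a′ ∷ A ≡ A₁ ++ a ∷ a′ ∷ A
    eq = List.++-assoc A₁ [ a ] (a′ ∷ A)

  commute-zig : ∀ {A B} → Chain A → Zig A B → length A ≢ length B → Commute (uʷ A) (uʷ B)
  commute-zig {B = B} chain z n with zig-length z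
  ... | inj₁ e = ⊥-elim (n e)
  ... | inj₂ e = commute-uʷ B (commute-odd [] z e chain)

  commute-block : ∀ {A B} → Chain A → Chain B → Block A B → length A ≢ length B →
                  Commute (uʷ A) (uʷ B)
  commute-block c d (inj₁ z) n = commute-zig c z n
  commute-block c d (inj₂ z) n = ≃-sym (commute-zig d z (n ∘ sym))

  uᵖ : List E × List E → 𝓤
  uᵖ (C , D) = uʷ C * uʷ D

  -- Every element of `B` lies below every element of `C`, so `uʷ C` and `uʷ B` commute. Hence the
  -- word of a pair factors over its blocks, and each block can be turned by itself.
  uᵖ-separated : ∀ {A B C D} → Separated A B C D →
                 uᵖ (A ++ C , B ++ D) ≃ uᵖ (A , B) * uᵖ (C , D)
  uᵖ-separated {A} {B} {C} {D} (_ , s) = begin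
    uʷ (A ++ C) * uʷ (B ++ D)         ≈⟨ *-cong (uʷ-++ A C) (uʷ-++ B D) ⟩
    (uʷ A * uʷ C) * (uʷ B * uʷ D)     ≈⟨ *-assoc _ _ _ ⟩
    uʷ A * (uʷ C * (uʷ B * uʷ D))     ≈⟨ *-congˡ (*-assoc _ _ _) ⟨
    uʷ A * ((uʷ C * uʷ B) * uʷ D)     ≈⟨ *-congˡ (*-congʳ swap) ⟩
    uʷ A * ((uʷ B * uʷ C) * uʷ D)     ≈⟨ *-congˡ (*-assoc _ _ _) ⟩
    uʷ A * (uʷ B * (uʷ C * uʷ D))     ≈⟨ *-assoc _ _ _ ⟨
    (uʷ A * uʷ B) * (uʷ C * uʷ D)     ∎
    where
    swap : Commute (uʷ C) (uʷ B)
    swap = commute-uʷ B (All.map (λ (p , _) → ≃-sym (commute-uʷ C (All.map commute-≺ p))) s)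

  uᵖ-reoriented : ∀ {bs bs′} → Reoriented bs bs′ → Valid bs → uᵖ (sides bs) ≃ uᵖ (sides bs′)
  uᵖ-reoriented [] _ = ≃-refl
  uᵖ-reoriented r@(keep r′) v@(cons _ _ _ s val) with cons _ _ _ s′ _ ← reoriented-valid r v =
    ≃-trans (uᵖ-separated s) (≃-trans (*-congˡ (uᵖ-reoriented r′ val)) (≃-sym (uᵖ-separated s′)))
  uᵖ-reoriented r@(flip n r′) v@(cons c d b s val) with cons _ _ _ s′ _ ← reoriented-valid r v =
    ≃-trans (uᵖ-separated s)
      (≃-trans (*-cong (commute-block c d b n) (uᵖ-reoriented r′ val)) (≃-sym (uᵖ-separated s′)))

-- Pairs of chains and products of two elementary functions

module _ {A : Set} where

  ∈-words⁺ : ∀ {as : List A} w → All (_∈ as) w → w ∈ words as (length w)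
  ∈-words⁺ []      []       = here refl
  ∈-words⁺ (x ∷ w) (p ∷ ps) = ∈-cartesianProductWith⁺ _∷_ p (∈-words⁺ w ps)

  ∈-words⁻ : ∀ as k {w : List A} → w ∈ words as k → length w ≡ k × All (_∈ as) w
  ∈-words⁻ as zero    (here refl) = refl , []
  ∈-words⁻ as (suc k) i with _ , _ , p , q , refl ← ∈-cartesianProductWith⁻ _∷_ as (words as k) i
    with e , ps ← ∈-words⁻ as k q = cong suc e , p ∷ ps

  words-unique : ∀ {as : List A} k → Unique as → Unique (words as k)
  words-unique zero    u = [] ∷ []
  words-unique (suc k) u = Unique.cartesianProductWith⁺ _∷_ List.∷-injective u (words-unique k u)

  fillings-unique : ∀ {as : List A} ls → Unique as → Unique (fillings as ls)
  fillings-unique []       u = [] ∷ []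
  fillings-unique (l ∷ ls) u =
    Unique.cartesianProductWith⁺ _∷_ List.∷-injective (words-unique l u) (fillings-unique ls u)

  AllPairs-reverse : {R : A → A → Set} {xs : List A} → AllPairs R xs → AllPairs (Function.flip R) (reverse xs)
  AllPairs-reverse [] = []
  AllPairs-reverse {R} {x ∷ xs} (p ∷ ps) = subst (AllPairs (Function.flip R)) (sym (List.unfold-reverse x xs))
    (AllPairs.++⁺ (AllPairs-reverse ps) ([] ∷ [])
      (All.map (_∷ []) (All.tabulate (λ i → All.lookup p (reverse⁻ i)))))

-- Binomial coefficient r over (k - l), which is 0 for k < l.
chooseFrom : ℕ → ℕ → ℕ → ℕ
chooseFrom zero    r k       = choose r k
chooseFrom (suc l) r zero    = 0
chooseFrom (suc l) r (suc k) = chooseFrom l r k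

chooseFrom-+ : ∀ l r q → chooseFrom l r (l ℕ.+ q) ≡ choose r q
chooseFrom-+ zero    r q = refl
chooseFrom-+ (suc l) r q = chooseFrom-+ l r q

chooseFrom-< : ∀ l r k → k < l → chooseFrom l r k ≡ 0
chooseFrom-< (suc l) r zero    _       = refl
chooseFrom-< (suc l) r (suc k) (s≤s h) = chooseFrom-< l r k h

filter-none : {A : Set} {R : Pred A 0ℓ} (R? : Decidable R) (xs : List A) →
              (∀ {x} → x ∈ xs → ¬ R x) → filter R? xs ≡ []
filter-none R? []       h = refl
filter-none R? (x ∷ xs) h with R? x
... | yes r = ⊥-elim (h (here refl) r)
... | no _  = filter-none R? xs (h ∘ there)

module ChainPairs (P : FinitePoset) (free : PosetNotions.[3+1]-Free P) where

  open FinitePoset P renaming (Carrier to E)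
  open PosetNotions P using (uʷ; 𝓤; 𝓤-ring; e; ∑; _·_)
  open Ladders P free public
  open LadderWords P free public
  open Ring quotient using (_*_; _+_; +-congˡ; *-cong; setoid; distribˡ; distribʳ; zeroˡ; zeroʳ; +-commutativeMonoid)
    renaming (refl to ≃-refl)
  open import Relation.Binary.Reasoning.Setoid setoid
  open FiniteSums +-commutativeMonoid hiding (∑)
  open IntegerMultiples 𝓤-ring using (·-distrib-∑; ∑-const)

  chains : ℕ → List (List E)
  chains k = filter chain? (words elements k)

  ∈-elements : ∀ w → All (_∈ elements) w
  ∈-elements w = All.tabulate (λ _ → elements-complete _)

  ∈-chains⁺ : ∀ {C} → Chain C → C ∈ chains (length C)
  ∈-chains⁺ {C} c = ∈-filter⁺ chain? (∈-words⁺ C (∈-elements C)) c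

  ∈-chains⁻ : ∀ {k C} → C ∈ chains k → length C ≡ k × Chain C
  ∈-chains⁻ {k} i with j , c ← ∈-filter⁻ chain? {xs = words elements k} i =
    proj₁ (∈-words⁻ elements k j) , c

  chains-unique : ∀ k → Unique (chains k)
  chains-unique k = Unique.filter⁺ chain? (words-unique k elements-unique)

  -- `e` reads a chain downwards while `chains` lists it upwards; the letters of a chain commute, so
  -- `uʷ-reverse` identifies the two words.
  e-chains : ∀ k → e (+ k) ≃ ∑ (chains k) uʷ
  e-chains k = ∑-bijection reverse reverse
    (Unique.filter⁺ _ (words-unique k elements-unique)) (chains-unique k) to from
    (λ {w} i → ≃-trans (≈⇒≃ (Ring.reflexive 𝓤-ring (cong uʷ (sym (List.reverse-involutive w)))))
                       (uʷ-reverse (proj₂ (∈-chains⁻ {k} (proj₁ (to i))))))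
    where
    descending = linked? (λ a b → b ≺? a)
    lengths : ∀ {w} → length w ≡ k → reverse w ∈ words elements k
    lengths {w} refl = subst (λ n → reverse w ∈ words elements n) (List.length-reverse w)
                        (∈-words⁺ (reverse w) (∈-elements (reverse w)))
    to : ∀ {w} → w ∈ filter descending (words elements k) →
         reverse w ∈ chains k × reverse (reverse w) ≡ w
    to {w} i with j , l ← ∈-filter⁻ descending {xs = words elements k} i =
      ∈-filter⁺ chain? (lengths {w} (proj₁ (∈-words⁻ elements k j)))
        (AllPairs-reverse (Linked⇒AllPairs (Function.flip ≺-trans) l)) ,
      List.reverse-involutive w
    from : ∀ {C} → C ∈ chains k →
           reverse C ∈ filter descending (words elements k) × reverse (reverse C) ≡ C
    from {C} i with l , c ← ∈-chains⁻ {k} i =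
      ∈-filter⁺ descending (lengths {C} l) (AllPairs⇒Linked (AllPairs-reverse c)) ,
      List.reverse-involutive C

  Pair : Set
  Pair = List E × List E

  _≟ᵖ_ : (x y : Pair) → Dec (x ≡ y)
  _≟ᵖ_ = Product.≡-dec (List.≡-dec _≟ₚ_) (List.≡-dec _≟ₚ_)

  pairs : ℕ → ℕ → List Pair
  pairs a b = cartesianProductWith _,_ (chains a) (chains b)

  ∈-pairs⁺ : ∀ {C D} → Chain C → Chain D → (C , D) ∈ pairs (length C) (length D)
  ∈-pairs⁺ c d = ∈-cartesianProductWith⁺ _,_ (∈-chains⁺ c) (∈-chains⁺ d)

  ∈-pairs⁻ : ∀ {a b C D} → (C , D) ∈ pairs a b →
             (Chain C × length C ≡ a) × (Chain D × length D ≡ b)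
  ∈-pairs⁻ {a} {b} i with _ , _ , p , q , refl ← ∈-cartesianProductWith⁻ _,_ (chains a) (chains b) i
    with l , c ← ∈-chains⁻ {a} p | m , d ← ∈-chains⁻ {b} q = (c , l) , (d , m)

  pairs-unique : ∀ a b → Unique (pairs a b)
  pairs-unique a b = Unique.cartesianProductWith⁺ _,_ (λ { refl → refl , refl })
    (chains-unique a) (chains-unique b)

  left? : Decidable Left
  left? = all? (λ (A , B) → length B ℕ.≤? length A)

  leftPairs : ℕ → ℕ → List Pair
  leftPairs a b = filter (λ x → left? (blocks x)) (pairs a b)

  leftPairs-unique : ∀ a b → Unique (leftPairs a b)
  leftPairs-unique a b = Unique.filter⁺ _ (pairs-unique a b)

  *-distrib-∑ˡ : {I : Set} (x : 𝓤) (is : List I) (f : I → 𝓤) → x * ∑ is f ≃ ∑ is (λ i → x * f i)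
  *-distrib-∑ˡ x []       f = zeroʳ x
  *-distrib-∑ˡ x (i ∷ is) f = ≃-trans (distribˡ x _ _) (+-congˡ (*-distrib-∑ˡ x is f))

  *-distrib-∑ʳ : {I : Set} (x : 𝓤) (is : List I) (f : I → 𝓤) → ∑ is f * x ≃ ∑ is (λ i → f i * x)
  *-distrib-∑ʳ x []       f = zeroˡ x
  *-distrib-∑ʳ x (i ∷ is) f = ≃-trans (distribʳ x _ _) (+-congˡ (*-distrib-∑ʳ x is f))

  e*e-pairs : ∀ a b → e (+ a) * e (+ b) ≃ ∑ (pairs a b) uᵖ
  e*e-pairs a b = begin
    e (+ a) * e (+ b)                                        ≈⟨ *-cong (e-chains a) (e-chains b) ⟩
    ∑ (chains a) uʷ * ∑ (chains b) uʷ                        ≈⟨ *-distrib-∑ʳ _ (chains a) uʷ ⟩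
    ∑ (chains a) (λ C → uʷ C * ∑ (chains b) uʷ)              ≈⟨ ∑-cong (chains a) (λ {C} _ → *-distrib-∑ˡ (uʷ C) (chains b) uʷ) ⟩
    ∑ (chains a) (λ C → ∑ (chains b) (λ D → uᵖ (C , D)))     ≈⟨ ∑-cartesianProductWith _,_ uᵖ (chains a) (chains b) ⟨
    ∑ (pairs a b) uᵖ                                         ∎

  record Normalised (a b : ℕ) (x : Pair) : Set where
    field
      valid       : Valid (blocks x)
      sides-eq    : sides (blocks x) ≡ x
      valid′      : Valid (normal (blocks x))
      blocks-norm : blocks (normalise x) ≡ normal (blocks x)
      total       : length (proj₁ (normalise x)) ℕ.+ length (proj₂ (normalise x)) ≡ a ℕ.+ b
      right-eq    : b ≡ length (proj₂ (normalise x)) ℕ.+ rights (blocks x)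
      order       : length (proj₂ (normalise x)) ≤ length (proj₁ (normalise x))
      same        : uᵖ x ≃ uᵖ (normalise x)

  normalised : ∀ {a b x} → x ∈ pairs a b → Normalised a b x
  normalised {a} {b} {C , D} i with (c , refl) , (d , refl) ← ∈-pairs⁻ {a} {b} i
    with _ , p , q ← blocks-valid c d = record
    { valid       = val
    ; sides-eq    = cong₂ _,_ p q
    ; valid′      = val′
    ; blocks-norm = blocks-sides val′
    ; total       = trans (sym (length-reoriented r)) (cong₂ (λ X Y → length X ℕ.+ length Y) p q)
    ; right-eq    = trans (cong length (sym q)) (length-rights val)
    ; order       = subst (length (right (normal bs)) ≤_) (sym (left-unbalanced val′ (normal-left bs))) (ℕ.m≤m+n _ _)
    ; same        = subst (λ y → uᵖ y ≃ uᵖ (sides (normal bs))) (cong₂ _,_ p q) (uᵖ-reoriented r val)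
    }
    where
    bs = blocks (C , D)
    r = normal-reoriented bs
    val = proj₁ (blocks-valid c d)
    val′ = reoriented-valid r val

  rightSize : Pair → ℕ
  rightSize x = length (proj₂ (normalise x))

  half-bound : ∀ {r l n} → r ≤ l → l ℕ.+ r ≡ n → r ≤ ⌊ n /2⌋
  half-bound {r} {l} p refl =
    subst (_≤ ⌊ l ℕ.+ r /2⌋) (sym (ℕ.n≡⌊n+n/2⌋ r)) (ℕ.⌊n/2⌋-mono (ℕ.+-monoˡ-≤ r p))

  -- The double filter matches the two stages in which `e*e-expansion` splits its sum: by the second
  -- length of the normal form, then by the normal form itself.
  fibre : ℕ → ℕ → ℕ → Pair → List Pair
  fibre a b l p = filter (λ x → normalise x ≟ᵖ p) (filter (λ x → rightSize x ℕ.≟ l) (pairs a b))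

  ∈-fibre⁻ : ∀ {a b l p x} → x ∈ fibre a b l p → x ∈ pairs a b × rightSize x ≡ l × normalise x ≡ p
  ∈-fibre⁻ {a} {b} {l} {p} i with j , e ← ∈-filter⁻ (λ x → normalise x ≟ᵖ p) {xs = filter (λ x → rightSize x ℕ.≟ l) (pairs a b)} i
    with k , f ← ∈-filter⁻ (λ x → rightSize x ℕ.≟ l) {xs = pairs a b} j = k , f , e

  -- Through `blocks` and `sides`, the pairs with normal form `p` correspond to the ways of turning
  -- b - l of the a + b - 2l unbalanced blocks of `p` to the right.
  fibre-length : ∀ a b l {p} → p ∈ leftPairs (a ℕ.+ b ∸ l) l →
                 length (fibre a b l p) ≡ chooseFrom l (a ℕ.+ b ∸ l ∸ l) b
  fibre-length a b l {p@(C , D)} i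
    with j , isLeft ← ∈-filter⁻ (λ x → left? (blocks x)) {xs = pairs (a ℕ.+ b ∸ l) l} i
    with (c , c-len) , (d , d-len) ← ∈-pairs⁻ {a ℕ.+ b ∸ l} {l} j
    with l ℕ.≤? b
  -- Normalising never lengthens the second chain, so the fibre is empty when `l` exceeds `b`, in
  -- agreement with the value 0 of `chooseFrom`.
  ... | no l≰b = trans (cong length (filter-none _ (filter _ (pairs a b)) (λ k e → l≰b (bound k))))
                       (sym (chooseFrom-< l _ b (ℕ.≰⇒> l≰b)))
    where
    bound : ∀ {x} → x ∈ filter (λ x → rightSize x ℕ.≟ l) (pairs a b) → l ≤ b
    bound k with k′ , refl ← ∈-filter⁻ (λ x → rightSize x ℕ.≟ l) {xs = pairs a b} k =
      subst (_ ≤_) (sym (Normalised.right-eq (normalised {a} {b} k′))) (ℕ.m≤m+n _ _)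
  ... | yes l≤b with q , refl ← ℕ.m≤n⇒∃[o]m+o≡n l≤b =
    trans (bijection-length blocks sides
             (Unique.filter⁺ _ (Unique.filter⁺ _ (pairs-unique a b)))
             (reorientations-unique (blocks p) q) to from)
      (trans (reorientations-length (blocks p) q)
        (trans (cong (λ r → choose r q) unb) (sym (chooseFrom-+ l _ q))))
    where
    val = proj₁ (blocks-valid c d)
    left-p : left (blocks p) ≡ C
    left-p = proj₁ (proj₂ (blocks-valid c d))
    right-p : right (blocks p) ≡ D
    right-p = proj₂ (proj₂ (blocks-valid c d))
    unb : unbalanced (blocks p) ≡ a ℕ.+ b ∸ l ∸ l
    unb = trans (sym (ℕ.m+n∸m≡n l _)) (cong (_∸ l) (trans (sym size) c-len))
      where
      size : length C ≡ l ℕ.+ unbalanced (blocks p)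
      size = trans (cong length (sym left-p)) (trans (left-unbalanced val isLeft)
               (cong (ℕ._+ unbalanced (blocks p)) (trans (cong length right-p) d-len)))
    to : ∀ {x} → x ∈ fibre a b l p → blocks x ∈ reorientations (blocks p) q × sides (blocks x) ≡ x
    to {x} k with k′ , e , f ← ∈-fibre⁻ {a} {l ℕ.+ q} {l} {p} k =
      subst₂ (λ bs r → blocks x ∈ reorientations bs r)
        (trans (sym (Normalised.blocks-norm N)) (cong blocks f))
        (ℕ.+-cancelˡ-≡ l _ _ (trans (cong (ℕ._+ rights (blocks x)) (sym e)) (sym (Normalised.right-eq N))))
        (reorientations-complete (blocks x)) ,
      Normalised.sides-eq N
      where N = normalised {a} {l ℕ.+ q} k′
    from : ∀ {bs} → bs ∈ reorientations (blocks p) q → sides bs ∈ fibre a b l p × blocks (sides bs) ≡ bs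
    from {bs} k with e , f ← reorientations-sound (blocks p) q isLeft k =
      ∈-filter⁺ _ (∈-filter⁺ _ in-pairs (trans (cong (length ∘ proj₂) norm) d-len)) norm ,
      blocks-sides v
      where
      r : Reoriented bs (blocks p)
      r = subst (Reoriented bs) e (normal-reoriented bs)
      v = reoriented-valid (reoriented-sym r) val
      norm : normalise (sides bs) ≡ p
      norm = trans (cong (sides ∘ normal) (blocks-sides v))
                   (trans (cong sides e) (cong₂ _,_ left-p right-p))
      right-len : length (right bs) ≡ l ℕ.+ q
      right-len = trans (length-rights v)
        (cong₂ ℕ._+_ (trans (cong (length ∘ right) e) (trans (cong length right-p) d-len)) f)
      left-len : length (left bs) ≡ a
      left-len = ℕ.+-cancelʳ-≡ (l ℕ.+ q) _ _
        (trans (cong (length (left bs) ℕ.+_) (sym right-len))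
          (trans (length-reoriented r)
            (trans (cong₂ ℕ._+_ (trans (cong length left-p) c-len) (trans (cong length right-p) d-len))
              (ℕ.m∸n+n≡m (ℕ.≤-trans (ℕ.m≤m+n l q) (ℕ.m≤n+m (l ℕ.+ q) a))))))
      in-pairs : sides bs ∈ pairs a (l ℕ.+ q)
      in-pairs = subst₂ (λ m n → sides bs ∈ pairs m n) left-len right-len
        (∈-pairs⁺ (proj₁ (valid-chains v)) (proj₂ (valid-chains v)))

  X : ℕ → ℕ → 𝓤
  X n l = ∑ (leftPairs (n ∸ l) l) uᵖ

  e*e-expansion : ∀ a b → e (+ a) * e (+ b) ≃
    ∑ (upTo (suc ⌊ a ℕ.+ b /2⌋)) (λ l → (+ chooseFrom l (a ℕ.+ b ∸ l ∸ l) b) · X (a ℕ.+ b) l)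
  e*e-expansion a b = begin
    e (+ a) * e (+ b)
      ≈⟨ e*e-pairs a b ⟩
    ∑ (pairs a b) uᵖ
      ≈⟨ ∑-fibres ℕ._≟_ rightSize uᵖ (pairs a b) (Unique.upTo⁺ _) bound ⟩
    ∑ (upTo (suc ⌊ n /2⌋)) (λ l → ∑ (filter (λ x → rightSize x ℕ.≟ l) (pairs a b)) uᵖ)
      ≈⟨ ∑-cong (upTo (suc ⌊ n /2⌋)) (λ {l} _ → inner l) ⟩
    ∑ (upTo (suc ⌊ n /2⌋)) (λ l → (+ chooseFrom l (n ∸ l ∸ l) b) · X n l) ∎
    where
    n = a ℕ.+ b
    bound : ∀ {x} → x ∈ pairs a b → rightSize x ∈ upTo (suc ⌊ n /2⌋)
    bound i = ∈-upTo⁺ (s≤s (half-bound (Normalised.order N) (Normalised.total N)))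
      where N = normalised {a} {b} i
    into : ∀ l {x} → x ∈ filter (λ x → rightSize x ℕ.≟ l) (pairs a b) → normalise x ∈ leftPairs (n ∸ l) l
    into l {x} i with j , refl ← ∈-filter⁻ (λ x → rightSize x ℕ.≟ l) {xs = pairs a b} i =
      ∈-filter⁺ _ (subst (λ m → normalise x ∈ pairs m (rightSize x))
                    (trans (sym (ℕ.m+n∸n≡m _ (rightSize x))) (cong (_∸ rightSize x) (Normalised.total N)))
                    (∈-pairs⁺ (proj₁ (valid-chains (Normalised.valid′ N)))
                              (proj₂ (valid-chains (Normalised.valid′ N)))))
        (subst Left (sym (Normalised.blocks-norm N)) (normal-left (blocks x)))
      where N = normalised {a} {b} j
    inner : ∀ l → ∑ (filter (λ x → rightSize x ℕ.≟ l) (pairs a b)) uᵖ ≃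
                  (+ chooseFrom l (n ∸ l ∸ l) b) · X n l
    inner l = begin
      ∑ (filter (λ x → rightSize x ℕ.≟ l) (pairs a b)) uᵖ
        ≈⟨ ∑-fibres _≟ᵖ_ normalise uᵖ (filter (λ x → rightSize x ℕ.≟ l) (pairs a b))
             (leftPairs-unique (n ∸ l) l) (into l) ⟩
      ∑ (leftPairs (n ∸ l) l) (λ p → ∑ (fibre a b l p) uᵖ)
        ≈⟨ ∑-cong (leftPairs (n ∸ l) l) (λ {p} i → begin
             ∑ (fibre a b l p) uᵖ              ≈⟨ ∑-cong (fibre a b l p) (λ {x} → to-p l p) ⟩
             ∑ (fibre a b l p) (λ _ → uᵖ p)    ≈⟨ ≈⇒≃ (∑-const (fibre a b l p) (uᵖ p)) ⟩
             (+ length (fibre a b l p)) · uᵖ p ≡⟨ cong (λ m → (+ m) · uᵖ p) (fibre-length a b l i) ⟩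
             (+ chooseFrom l (n ∸ l ∸ l) b) · uᵖ p ∎) ⟩
      ∑ (leftPairs (n ∸ l) l) (λ p → (+ chooseFrom l (n ∸ l ∸ l) b) · uᵖ p)
        ≈⟨ ≈⇒≃ (·-distrib-∑ (+ chooseFrom l (n ∸ l ∸ l) b) (leftPairs (n ∸ l) l) uᵖ) ⟨
      (+ chooseFrom l (n ∸ l ∸ l) b) · X n l ∎
      where
      to-p : ∀ l p {x} → x ∈ fibre a b l p → uᵖ x ≃ uᵖ p
      to-p l p i with j , _ , refl ← ∈-fibre⁻ {a} {b} {l} {p} i = Normalised.same (normalised {a} {b} j)

-- Ladders as components, and the row condition

module _ {A : Set} where

  unique-lookup : ∀ {xs : List A} → Unique xs → ∀ i j → lookup xs i ≡ lookup xs j → i ≡ j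
  unique-lookup (_ ∷ _) zero    zero    _ = refl
  unique-lookup {_ ∷ xs} (p ∷ _) zero (suc j) e = ⊥-elim (All.lookup p (∈-lookup {xs = xs} j) e)
  unique-lookup {_ ∷ xs} (p ∷ _) (suc i) zero e = ⊥-elim (All.lookup p (∈-lookup {xs = xs} i) (sym e))
  unique-lookup (_ ∷ u) (suc i) (suc j) e = cong suc (unique-lookup u i j e)

  ∈-position : ∀ {xs : List A} {x} → x ∈ xs → ∃ λ i → lookup xs i ≡ x
  ∈-position i = Any.index i , sym (Any.lookup-index i)

  -- Ladders are counted by positions, blocks consist of elements. A chain has no repeated element,
  -- so `lookup` translates one count into the other.
  count-positions : ∀ {C A : List A} {Q : Pred (Fin (length C)) 0ℓ} (Q? : Decidable Q) →
    Unique C → Unique A → (∀ {x} → x ∈ A → x ∈ C) →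
    (∀ i → Q i → lookup C i ∈ A) → (∀ i → lookup C i ∈ A → Q i) →
    length (filter Q? (allFin (length C))) ≡ length A
  count-positions {C} {A} {Q} Q? uC uA sub to from =
    trans (sym (List.length-map (lookup C) (filter Q? (allFin (length C)))))
      (↭-length (unique-↭
        (Unique.map⁺ (unique-lookup uC _ _) (Unique.filter⁺ Q? (Unique.allFin⁺ _))) uA f g))
    where
    f : ∀ {z} → z ∈ map (lookup C) (filter Q? (allFin (length C))) → z ∈ A
    f m with i , j , refl ← ∈-map⁻ (lookup C) m = to i (proj₂ (∈-filter⁻ Q? {xs = allFin _} j))
    g : ∀ {z} → z ∈ A → z ∈ map (lookup C) (filter Q? (allFin (length C)))
    g m with i , refl ← ∈-position (sub m) = ∈-map⁺ (lookup C) (∈-filter⁺ Q? (∈-allFin i) (from i m))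

module LeftTableaux (P : FinitePoset) (free : PosetNotions.[3+1]-Free P) where

  open FinitePoset P renaming (Carrier to E)
  open PosetNotions P using (_∼_; module Incomparability)
  open Ladders P free public

  chain-unique : ∀ {C} → Chain C → Unique C
  chain-unique = AllPairs.map (λ { p refl → ≺-irrefl refl p })

  block-⊆ : ∀ {A B bs} → (A , B) ∈ bs →
            (∀ {x} → x ∈ A → x ∈ left bs) × (∀ {x} → x ∈ B → x ∈ right bs)
  block-⊆ (here refl) = ∈-++⁺ˡ , ∈-++⁺ˡ
  block-⊆ {bs = (A₀ , B₀) ∷ _} (there m) with p , q ← block-⊆ m = ∈-++⁺ʳ A₀ ∘ p , ∈-++⁺ʳ B₀ ∘ q

  covered : ∀ {x} bs → x ∈ left bs → ∃₂ λ A B → (A , B) ∈ bs × x ∈ A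
  covered ((A , B) ∷ bs) m with ∈-++⁻ A m
  ... | inj₁ p = A , B , here refl , p
  ... | inj₂ p with A′ , B′ , q , r ← covered bs p = A′ , B′ , there q , r

  covered′ : ∀ {x} bs → x ∈ right bs → ∃₂ λ A B → (A , B) ∈ bs × x ∈ B
  covered′ ((A , B) ∷ bs) m with ∈-++⁻ B m
  ... | inj₁ p = A , B , here refl , p
  ... | inj₂ p with A′ , B′ , q , r ← covered′ bs p = A′ , B′ , there q , r

  valid-block : ∀ {A B bs} → Valid bs → (A , B) ∈ bs → Block A B × Chain A × Chain B
  valid-block (cons c d b _ _) (here refl) = b , c , d
  valid-block (cons _ _ _ _ v) (there m)   = valid-block v m

  -- By separation, the elements of all other blocks are comparable to `x`, so no edge leaves a
  -- block.
  closedʳ : ∀ {A B bs x y} → Valid bs → (A , B) ∈ bs → x ∈ A → y ∈ right bs → x ∼ y → y ∈ B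
  closedʳ {B = B} (cons _ _ _ (s , _) _) (here refl) p q r with ∈-++⁻ B q
  ... | inj₁ t = t
  ... | inj₂ t = ⊥-elim (proj₁ r (All.lookup (proj₂ (All.lookup s p)) t))
  closedʳ {bs = (_ , B₀) ∷ _} (cons _ _ _ (_ , s) v) (there m) p q r with ∈-++⁻ B₀ q
  ... | inj₁ t = ⊥-elim (proj₂ r (All.lookup (proj₁ (All.lookup s t)) (proj₁ (block-⊆ m) p)))
  ... | inj₂ t = closedʳ v m p t r

  closedˡ : ∀ {A B bs x y} → Valid bs → (A , B) ∈ bs → y ∈ B → x ∈ left bs → x ∼ y → x ∈ A
  closedˡ {A = A} (cons _ _ _ (_ , s) _) (here refl) p q r with ∈-++⁻ A q
  ... | inj₁ t = t
  ... | inj₂ t = ⊥-elim (proj₂ r (All.lookup (proj₁ (All.lookup s p)) t))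
  closedˡ {bs = (A₀ , _) ∷ _} (cons _ _ _ (s , _) v) (there m) p q r with ∈-++⁻ A₀ q
  ... | inj₁ t = ⊥-elim (proj₁ r (All.lookup (proj₂ (All.lookup s t)) (proj₂ (block-⊆ m) p)))
  ... | inj₂ t = closedˡ v m p t r

  module _ {V : Set} (Edge : V → V → Set) (edge-sym : ∀ {v w} → Edge v w → Edge w v) where

    -- At x v says that the vertex v carries the element x.
    zig-connected : ∀ {a A B h} (At Bt : E → V → Set) →
      (∀ {x v w} → At x v → At x w → v ≡ w) →
      All (λ x → ∃ (At x)) A →
      (∀ {x y v w} → At x v → Bt y w → x ∼ y → Edge v w) →
      All (λ y → ∃ (Bt y)) B →
      Zig (a ∷ A) B → At a h →
      (∀ {x v} → x ∈ a ∷ A → At x v → Star Edge v h) ×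
      (∀ {y w} → y ∈ B → Bt y w → Star Edge w h)
    zig-connected At Bt unique _ edge _ odd t =
      (λ { (here refl) s → subst (λ v → Star Edge v _) (unique t s) Star.ε }) , λ ()
    zig-connected At Bt unique _ edge _ (even p) t =
      (λ { (here refl) s → subst (λ v → Star Edge v _) (unique t s) Star.ε }) ,
      (λ { (here refl) s → edge-sym (edge t s p) ◅ Star.ε })
    zig-connected At Bt unique ((h′ , t′) ∷ eA) edge ((k , r) ∷ eB) (step p q z) t
      with f , g ← zig-connected At Bt unique eA edge eB z t′ =
      (λ { (here refl) s → subst (λ v → Star Edge v _) (unique t s) Star.ε
         ; (there m) s → f m s ◅◅ bridge }) ,
      (λ { (here refl) s → edge-sym (edge t s p) ◅ Star.ε
         ; (there m) s → g m s ◅◅ bridge })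
      where
      -- The roots of the shorter and of the longer path have the first element of the other side as
      -- a common neighbour.
      bridge : Star Edge h′ _
      bridge = edge t′ r (∼-sym q) ◅ edge-sym (edge t r p) ◅ Star.ε

  module _ {bs : Blocks} (valid : Valid bs) where

    open Incomparability (left bs) (right bs)

    private
      chainC = proj₁ (valid-chains valid)
      chainD = proj₂ (valid-chains valid)

    AtC AtD : E → Vertex → Set
    AtC x v = ∃ λ i → v ≡ inj₁ i × lookup (left bs) i ≡ x
    AtD y v = ∃ λ j → v ≡ inj₂ j × lookup (right bs) j ≡ y

    edge-sym : ∀ {v w} → Edge v w → Edge w v
    edge-sym {inj₁ _} {inj₂ _} e = e
    edge-sym {inj₂ _} {inj₁ _} e = e

    AtC-unique : ∀ {x v w} → AtC x v → AtC x w → v ≡ w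
    AtC-unique (i , refl , p) (j , refl , q) =
      cong inj₁ (unique-lookup (chain-unique chainC) i j (trans p (sym q)))

    AtD-unique : ∀ {x v w} → AtD x v → AtD x w → v ≡ w
    AtD-unique (i , refl , p) (j , refl , q) =
      cong inj₂ (unique-lookup (chain-unique chainD) i j (trans p (sym q)))

    AtC-exists : ∀ {A} → (∀ {x} → x ∈ A → x ∈ left bs) → All (λ x → ∃ (AtC x)) A
    AtC-exists sub = All.tabulate (λ m → let i , e = ∈-position (sub m) in inj₁ i , i , refl , e)

    AtD-exists : ∀ {B} → (∀ {x} → x ∈ B → x ∈ right bs) → All (λ x → ∃ (AtD x)) B
    AtD-exists sub = All.tabulate (λ m → let i , e = ∈-position (sub m) in inj₂ i , i , refl , e)

    AtC-edge : ∀ {x y v w} → AtC x v → AtD y w → x ∼ y → Edge v w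
    AtC-edge (_ , refl , refl) (_ , refl , refl) r = r

    AtD-edge : ∀ {x y v w} → AtD x v → AtC y w → x ∼ y → Edge v w
    AtD-edge (_ , refl , refl) (_ , refl , refl) r = ∼-sym r

    InBlock : List E → List E → Vertex → Set
    InBlock A B (inj₁ i) = lookup (left bs) i ∈ A
    InBlock A B (inj₂ j) = lookup (right bs) j ∈ B

    block-connected : ∀ {A B} → (A , B) ∈ bs → ∃ λ h → InBlock A B h × (∀ v → InBlock A B v → Star Edge v h)
    block-connected m with block-⊆ m | valid-block valid m
    block-connected {a ∷ A} m | p , q | inj₁ z , _
      with i , refl ← ∈-position (p (here refl))
      with f , g ← zig-connected Edge edge-sym AtC AtD AtC-unique (AtC-exists (p ∘ there)) AtC-edge
                     (AtD-exists q) z (i , refl , refl) =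
      inj₁ i , here refl , λ { (inj₁ k) r → f r (k , refl , refl) ; (inj₂ k) r → g r (k , refl , refl) }
    block-connected {B = b ∷ B} m | p , q | inj₂ z , _
      with i , refl ← ∈-position (q (here refl))
      with f , g ← zig-connected Edge edge-sym AtD AtC AtD-unique (AtD-exists (q ∘ there)) AtD-edge
                     (AtC-exists p) z (i , refl , refl) =
      inj₂ i , here refl , λ { (inj₁ k) r → g r (k , refl , refl) ; (inj₂ k) r → f r (k , refl , refl) }

    block-closed : ∀ {A B v w} → (A , B) ∈ bs → InBlock A B v → Star Edge v w → InBlock A B w
    block-closed m r Star.ε = r
    block-closed {v = inj₁ i} m r (_◅_ {j = inj₂ j} e s) =
      block-closed m (closedʳ valid m r (∈-lookup {xs = right bs} j) e) s
    block-closed {v = inj₂ i} m r (_◅_ {j = inj₁ j} e s) =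
      block-closed m (closedˡ valid m r (∈-lookup {xs = left bs} j) e) s

    -- The ladder of `v` is its block: `block-connected` gives one inclusion and `block-closed` the
    -- other.
    ladder-counts : ∀ {A B v} → (A , B) ∈ bs → InBlock A B v →
                    ∣Ladder v ∩C∣ ≡ length A × ∣Ladder v ∩D∣ ≡ length B
    ladder-counts {A} {B} {v} m r
      with h , _ , conn ← block-connected m | _ , cA , cB ← valid-block valid m =
      count-positions (λ i → ladder? v (inj₁ i)) (chain-unique chainC) (chain-unique cA)
        (proj₁ (block-⊆ m)) (λ i → block-closed m r) (λ i → reach (inj₁ i)) ,
      count-positions (λ j → ladder? v (inj₂ j)) (chain-unique chainD) (chain-unique cB)
        (proj₂ (block-⊆ m)) (λ i → block-closed m r) (λ i → reach (inj₂ i))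
      where
      reach : ∀ w → InBlock A B w → Star Edge v w
      reach w s = conn v r ◅◅ Star.reverse edge-sym (conn w s)

    vertex-block : ∀ v → ∃₂ λ A B → (A , B) ∈ bs × InBlock A B v
    vertex-block (inj₁ i) = covered bs (∈-lookup {xs = left bs} i)
    vertex-block (inj₂ j) = covered′ bs (∈-lookup {xs = right bs} j)

    ladders⇒left : AllLaddersLeft → Left bs
    ladders⇒left h = All.tabulate (λ m → let v , r , _ = block-connected m in go (ladder-counts m r) (h v))
      where
      go : ∀ {v a b} → ∣Ladder v ∩C∣ ≡ a × ∣Ladder v ∩D∣ ≡ b → Balanced v ⊎ LeftUnbalanced v → b ≤ a
      go (refl , refl) (inj₁ e) = ℕ.≤-reflexive (sym e)
      go (refl , refl) (inj₂ l) = ℕ.<⇒≤ l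

    left⇒ladders : Left bs → AllLaddersLeft
    left⇒ladders h v with A , B , m , r ← vertex-block v with e , f ← ladder-counts m r
      with ℕ.m≤n⇒m<n∨m≡n (All.lookup h m)
    ... | inj₁ l = inj₂ (subst₂ _<_ (sym f) (sym e) l)
    ... | inj₂ l = inj₁ (trans e (trans (sym l) (sym f)))

  RowCondition : List E → List E → Set
  RowCondition C D = All (λ (c , d) → ¬ (d ≺ c)) (zip C D)

  -- If the earlier blocks have no surplus, these incomparable pairs are the rows of the block. If
  -- they have one, `a ∼ b` still keeps all later elements of `B` from lying below `a`.
  data Dominates : List E → List E → Set where
    []  : ∀ {A} → Dominates A []
    _∷_ : ∀ {a b A B} → a ∼ b → Dominates A B → Dominates (a ∷ A) (b ∷ B)

  zig-dominates : ∀ {A B} → Zig A B → Dominates A B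
  zig-dominates odd          = []
  zig-dominates (even p)     = p ∷ []
  zig-dominates (step p _ z) = p ∷ zig-dominates z

  zig-dominates′ : ∀ {A B} → Zig B A → length B ≤ length A → Dominates A B
  zig-dominates′ odd ()
  zig-dominates′ (even p)     _       = ∼-sym p ∷ []
  zig-dominates′ (step p _ z) (s≤s l) = ∼-sym p ∷ zig-dominates′ z l

  block-dominates : ∀ {A B} → Block A B → length B ≤ length A → Dominates A B
  block-dominates (inj₁ z) _ = zig-dominates z
  block-dominates (inj₂ z) l = zig-dominates′ z l

  NotAbove : List E → List E → Set
  NotAbove H D = All (λ h → All (λ d → ¬ (d ≺ h)) D) H

  -- H holds the cells of the first column that are still without a right neighbour.
  row-block : ∀ {A B C D} H → Dominates A B → Chain B → All (λ x → All (x ≺_) D) A →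
              NotAbove H (B ++ D) → (∀ H → NotAbove H D → RowCondition (H ++ C) D) →
              RowCondition (H ++ A ++ C) (B ++ D)
  row-block {A} {C = C} {D} H [] _ s n k =
    subst (λ w → RowCondition w D) (List.++-assoc H A C)
      (k (H ++ A) (All.++⁺ n (All.map (All.map ≺-asym) s)))
  row-block [] (p ∷ dom) (_ ∷ c) (_ ∷ s) _ k = proj₂ p ∷ row-block [] dom c s [] k
  -- The left neighbour of `b` is the cell that has waited longest, `h`, and `a` joins the end of
  -- the queue. A later element of `B` below `a` would put `b` below `a`, against `a ∼ b`.
  row-block {a ∷ A} {b ∷ B} {C} {D} (h ∷ H) (p ∷ dom) (b≺B ∷ c) (a≺D ∷ s) ((q ∷ _) ∷ n) k =
    q ∷ subst (λ w → RowCondition w (B ++ D)) (List.++-assoc H [ a ] (A ++ C))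
          (row-block (H ++ [ a ]) dom c s
            (All.++⁺ (All.map (λ { (_ ∷ t) → t }) n)
                     (All.++⁺ (All.map (λ t r → proj₂ p (≺-trans t r)) b≺B) (All.map ≺-asym a≺D) ∷ []))
            k)

  -- In left blocks only the first column can have a surplus, which waits in `H`. So the left
  -- neighbour of a cell is its partner in the block or an element that comes earlier in the first
  -- column, and the cell lies below neither.
  left-row : ∀ {bs} → Valid bs → Left bs → ∀ H → NotAbove H (right bs) → RowCondition (H ++ left bs) (right bs)
  left-row [] [] H _ = subst (λ w → All _ w) (sym (zip-[] (H ++ []))) []
    where
    zip-[] : ∀ (H : List E) → zip H ([] {A = E}) ≡ []
    zip-[] []      = refl
    zip-[] (_ ∷ _) = refl
  left-row (cons _ d b (s , _) v) (l ∷ ls) H n =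
    row-block H (block-dominates b l) d (All.map proj₂ s) n (left-row v ls)

-- The partition 2ˡ1ⁿ⁻²ˡ of n; junk (truncated subtraction) unless 2 l ≤ n.
twoColumn : ℕ → ℕ → List ℕ
twoColumn n l = replicate l 2 ++ replicate (n ∸ l ∸ l) 1

count-positive : ∀ l m → length (filter (0 ℕ.<?_) (replicate l 2 ++ replicate m 1)) ≡ l ℕ.+ m
count-positive zero    zero    = refl
count-positive zero    (suc m) = cong suc (count-positive zero m)
count-positive (suc l) m       = cong suc (count-positive l m)

count-twos : ∀ l m → length (filter (1 ℕ.<?_) (replicate l 2 ++ replicate m 1)) ≡ l
count-twos zero    zero    = refl
count-twos zero    (suc m) = count-twos zero m
count-twos (suc l) m       = cong suc (count-twos l m)

l+[n∸l∸l] : ∀ {n l} → l ℕ.+ l ≤ n → l ℕ.+ (n ∸ l ∸ l) ≡ n ∸ l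
l+[n∸l∸l] {n} {l} h = ℕ.m+[n∸m]≡n (subst (_≤ n ∸ l) (ℕ.m+n∸m≡n l l) (ℕ.∸-monoˡ-≤ l h))

conjugate-twoColumn : ∀ {n l} → suc l ℕ.+ suc l ≤ n →
  conjugate (twoColumn n (suc l)) ≡ n ∸ suc l ∷ suc l ∷ []
conjugate-twoColumn {n} {l} h = cong₂ (λ a b → a ∷ b ∷ [])
  (trans (count-positive (suc l) (n ∸ suc l ∸ suc l)) (l+[n∸l∸l] {n} {suc l} h))
  (count-twos (suc l) (n ∸ suc l ∸ suc l))

conjugate-oneColumn : ∀ n → conjugate (twoColumn (suc n) 0) ≡ suc n ∷ []
conjugate-oneColumn n = cong (_∷ []) (count-positive 0 (suc n))

-- Sums over left tableaux as sums over pairs of chains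

module LeftTableauSums (P : FinitePoset) (free : PosetNotions.[3+1]-Free P) where

  open FinitePoset P renaming (Carrier to E)
  open PosetNotions P
    using (uʷ; ∑; LT; colword; isPTableau?; isLeft?; column₁; column₂; module Incomparability)
  open ChainPairs P free
  open LeftTableaux P free using (ladders⇒left; left⇒ladders; left-row)
  open Ring quotient using (1#; _+_; *-congʳ; *-cong; *-identityˡ; *-identityʳ; +-commutativeMonoid)
    renaming (refl to ≃-refl)
  open FiniteSums +-commutativeMonoid hiding (∑)

  Ladders≤ : List E → List E → Set
  Ladders≤ C D = Incomparability.AllLaddersLeft C D

  isLeft⇒left : ∀ {C D} → Chain C → Chain D → Ladders≤ C D → Left (blocks (C , D))
  isLeft⇒left c d h with v , p , q ← blocks-valid c d =
    ladders⇒left v (subst₂ Ladders≤ (sym p) (sym q) h)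

  left⇒isLeft : ∀ {C D} → Chain C → Chain D → Left (blocks (C , D)) → Ladders≤ C D
  left⇒isLeft c d h with v , p , q ← blocks-valid c d = subst₂ Ladders≤ p q (left⇒ladders v h)

  left⇒row : ∀ {C D} → Chain C → Chain D → Left (blocks (C , D)) →
             All (λ (c , d) → ¬ (d ≺ c)) (zip C D)
  left⇒row c d h with v , p , q ← blocks-valid c d =
    subst₂ (λ C D → All (λ (c , d) → ¬ (d ≺ c)) (zip C D)) p q (left-row v h [] [])

  linked⇒chain : ∀ {C} → Linked _≺_ C → Chain C
  linked⇒chain = Linked⇒AllPairs ≺-trans

  chain⇒linked : ∀ {C} → Chain C → Linked _≺_ C
  chain⇒linked = AllPairs⇒Linked

  ∈-fillings⁻ : ∀ {l ls} {T : List (List E)} → T ∈ fillings elements (l ∷ ls) →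
    ∃₂ λ C T′ → T ≡ C ∷ T′ × length C ≡ l × T′ ∈ fillings elements ls
  ∈-fillings⁻ {l} {ls} i
    with C , T′ , p , q , refl ← ∈-cartesianProductWith⁻ _∷_ (words elements l) (fillings elements ls) i =
    C , T′ , refl , proj₁ (∈-words⁻ elements l p) , q

  ∈-fillings⁺ : ∀ {ls T′} C → T′ ∈ fillings elements ls → C ∷ T′ ∈ fillings elements (length C ∷ ls)
  ∈-fillings⁺ C i = ∈-cartesianProductWith⁺ _∷_ (∈-words⁺ C (∈-elements C)) i

  columnPair : List (List E) → Pair
  columnPair T = column₁ T , column₂ T

  colword₀ : 1# ≃ uᵖ ([] , [])
  colword₀ = ≃-sym (*-identityˡ 1#)

  colword₁ : ∀ {C} → Chain C → uʷ (colword (C ∷ [])) ≃ uᵖ (C , [])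
  colword₁ {C} c = ≃-trans (uʷ-++ (reverse C) []) (*-congʳ (uʷ-reverse c))

  colword₂ : ∀ {C D} → Chain C → Chain D → uʷ (colword (C ∷ D ∷ [])) ≃ uᵖ (C , D)
  colword₂ {C} {D} c d = ≃-trans (uʷ-++ (reverse C) (reverse D ++ []))
    (*-cong (uʷ-reverse c) (≃-trans (uʷ-++ (reverse D) []) (≃-trans (*-identityʳ _) (uʷ-reverse d))))

  -- Abstract in the two predicates, whose normal forms are too large to be unfolded.
  module ColumnSums
    {Good : Pred (List (List E)) 0ℓ} (good? : Decidable Good) {Q : Pred Pair 0ℓ} (q? : Decidable Q)
    (good₀ : Good [] → Q ([] , [])) (good₀′ : Q ([] , []) → Good [])
    (good₁ : ∀ {C} → Good (C ∷ []) → Chain C × Q (C , []))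
    (good₁′ : ∀ {C} → Chain C → Q (C , []) → Good (C ∷ []))
    (good₂ : ∀ {C D} → Good (C ∷ D ∷ []) → Chain C × Chain D × Q (C , D))
    (good₂′ : ∀ {C D} → Chain C → Chain D → Q (C , D) → Good (C ∷ D ∷ [])) where

    goods : List ℕ → List (List (List E))
    goods ls = filter good? (fillings elements ls)

    goods-unique : ∀ ls → Unique (goods ls)
    goods-unique ls = Unique.filter⁺ good? (fillings-unique ls elements-unique)

    qs : ℕ → ℕ → List Pair
    qs a b = filter q? (pairs a b)

    qs-unique : ∀ a b → Unique (qs a b)
    qs-unique a b = Unique.filter⁺ q? (pairs-unique a b)

    ∈-qs⁻ : ∀ {a b C D} → (C , D) ∈ qs a b →
      (Chain C × length C ≡ a) × (Chain D × length D ≡ b) × Q (C , D)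
    ∈-qs⁻ {a} {b} i with j , h ← ∈-filter⁻ q? {xs = pairs a b} i
      with c , d ← ∈-pairs⁻ {a} {b} j = c , d , h

    ∈-qs⁺ : ∀ {C D} → Chain C → Chain D → Q (C , D) → (C , D) ∈ qs (length C) (length D)
    ∈-qs⁺ c d h = ∈-filter⁺ q? (∈-pairs⁺ c d) h

    noColumn-sum : ∑ (goods []) (λ T → uʷ (colword T)) ≃ ∑ (qs 0 0) uᵖ
    noColumn-sum = ∑-bijection columnPair (λ _ → []) (goods-unique []) (qs-unique 0 0) to from
      (λ i → value (proj₁ (∈-filter⁻ good? {xs = fillings elements []} i)))
      where
      value : ∀ {T} → T ∈ fillings elements [] → uʷ (colword T) ≃ uᵖ (columnPair T)
      value (here refl) = colword₀
      to : ∀ {T} → T ∈ goods [] → columnPair T ∈ qs 0 0 × [] ≡ T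
      to i with here refl , h ← ∈-filter⁻ good? {xs = fillings elements []} i =
        ∈-qs⁺ [] [] (good₀ h) , refl
      from : ∀ {x} → x ∈ qs 0 0 → [] ∈ goods [] × ([] , []) ≡ x
      from {[] , []} i with _ , _ , h ← ∈-qs⁻ {0} {0} i =
        ∈-filter⁺ good? (here refl) (good₀′ h) , refl
      from {_ ∷ _ , _}  i with (_ , ()) , _ ← ∈-qs⁻ {0} {0} i
      from {[] , _ ∷ _} i with _ , (_ , ()) , _ ← ∈-qs⁻ {0} {0} i

    oneColumn-sum : ∀ a → ∑ (goods (a ∷ [])) (λ T → uʷ (colword T)) ≃ ∑ (qs a 0) uᵖ
    oneColumn-sum a = ∑-bijection columnPair (λ (C , _) → C ∷ []) (goods-unique (a ∷ [])) (qs-unique a 0)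
      to from value
      where
      split : ∀ {T} → T ∈ goods (a ∷ []) →
              ∃ λ C → T ≡ C ∷ [] × length C ≡ a × Chain C × Q (C , [])
      split i with j , h ← ∈-filter⁻ good? {xs = fillings elements (a ∷ [])} i
        with C , _ , refl , l , here refl ← ∈-fillings⁻ {a} {[]} j = C , refl , l , good₁ h
      to : ∀ {T} → T ∈ goods (a ∷ []) → columnPair T ∈ qs a 0 × column₁ T ∷ [] ≡ T
      to i with C , refl , refl , c , h ← split i = ∈-qs⁺ c [] h , refl
      value : ∀ {T} → T ∈ goods (a ∷ []) → uʷ (colword T) ≃ uᵖ (columnPair T)
      value i with C , refl , refl , c , h ← split i = colword₁ c
      from : ∀ {x} → x ∈ qs a 0 → proj₁ x ∷ [] ∈ goods (a ∷ []) × (proj₁ x , []) ≡ x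
      from {C , []} i with (c , refl) , _ , h ← ∈-qs⁻ {a} {0} i =
        ∈-filter⁺ good? (∈-fillings⁺ {[]} C (here refl)) (good₁′ c h) , refl
      from {C , _ ∷ _} i with _ , (_ , ()) , _ ← ∈-qs⁻ {a} {0} i

    twoColumn-sum : ∀ a b → ∑ (goods (a ∷ b ∷ [])) (λ T → uʷ (colword T)) ≃ ∑ (qs a b) uᵖ
    twoColumn-sum a b = ∑-bijection columnPair (λ (C , D) → C ∷ D ∷ []) (goods-unique (a ∷ b ∷ []))
      (qs-unique a b) to from value
      where
      split : ∀ {T} → T ∈ goods (a ∷ b ∷ []) → ∃₂ λ C D → T ≡ C ∷ D ∷ [] ×
              length C ≡ a × length D ≡ b × Chain C × Chain D × Q (C , D)
      split i with j , h ← ∈-filter⁻ good? {xs = fillings elements (a ∷ b ∷ [])} i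
        with C , _ , refl , l , k ← ∈-fillings⁻ {a} {b ∷ []} j
        with D , _ , refl , m , here refl ← ∈-fillings⁻ {b} {[]} k = C , D , refl , l , m , good₂ h
      to : ∀ {T} → T ∈ goods (a ∷ b ∷ []) → columnPair T ∈ qs a b × column₁ T ∷ column₂ T ∷ [] ≡ T
      to i with C , D , refl , refl , refl , c , d , h ← split i = ∈-qs⁺ c d h , refl
      value : ∀ {T} → T ∈ goods (a ∷ b ∷ []) → uʷ (colword T) ≃ uᵖ (columnPair T)
      value i with C , D , refl , refl , refl , c , d , h ← split i = colword₂ c d
      from : ∀ {x} → x ∈ qs a b →
             proj₁ x ∷ proj₂ x ∷ [] ∈ goods (a ∷ b ∷ []) × (proj₁ x , proj₂ x) ≡ x
      from {C , D} i with (c , refl) , (d , refl) , h ← ∈-qs⁻ {a} {b} i =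
        ∈-filter⁺ good? (∈-fillings⁺ {b ∷ []} C (∈-fillings⁺ {[]} D (here refl))) (good₂′ c d h) , refl

    -- The conjugate has zero, one or two entries, according as `n` is 0, only `l` is 0, or `l` is
    -- positive, whereas `qs` always consists of two chains, possibly empty.
    good-sum : ∀ n l → l ℕ.+ l ≤ n →
      ∑ (goods (conjugate (twoColumn n l))) (λ T → uʷ (colword T)) ≃ ∑ (qs (n ∸ l) l) uᵖ
    good-sum zero    zero    _ = noColumn-sum
    good-sum (suc n) zero    _ =
      subst (λ ls → ∑ (goods ls) (λ T → uʷ (colword T)) ≃ ∑ (qs (suc n) 0) uᵖ)
        (sym (conjugate-oneColumn n)) (oneColumn-sum (suc n))
    good-sum n       (suc l) h =
      subst (λ ls → ∑ (goods ls) (λ T → uʷ (colword T)) ≃ ∑ (qs (n ∸ suc l) (suc l)) uᵖ)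
        (sym (conjugate-twoColumn h)) (twoColumn-sum (n ∸ suc l) (suc l))

  -- The two filters agree since the ladder counts translate into `Left` on the blocks, and
  -- `left⇒row` supplies the row condition that pairs of chains do not impose.
  LT-sum : ∀ n l → l ℕ.+ l ≤ n → ∑ (LT (twoColumn n l)) (λ T → uʷ (colword T)) ≃ X n l
  LT-sum = ColumnSums.good-sum
    (λ T → isPTableau? T ×-dec isLeft? T) (λ x → left? (blocks x))
    (λ (_ , h) → isLeft⇒left [] [] h)
    (λ h → ([] , []) , left⇒isLeft [] [] h)
    (λ { ((p ∷ [] , _) , h) → linked⇒chain p , isLeft⇒left (linked⇒chain p) [] h })
    (λ c h → (chain⇒linked c ∷ [] , [-]) , left⇒isLeft c [] h)
    (λ { ((p ∷ q ∷ [] , _) , h) → linked⇒chain p , linked⇒chain q ,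
                                  isLeft⇒left (linked⇒chain p) (linked⇒chain q) h })
    (λ c d h → (chain⇒linked c ∷ chain⇒linked d ∷ [] , left⇒row c d h ∷ [-]) , left⇒isLeft c d h)

-- Kostka numbers of shapes with two columns

count : ℕ → List ℕ → ℕ
count i xs = length (filter (i ℕ.≟_) xs)

count-++ : ∀ i xs ys → count i (xs ++ ys) ≡ count i xs ℕ.+ count i ys
count-++ i xs ys = trans (cong length (List.filter-++ (i ℕ.≟_) xs ys)) (List.length-++ (filter (i ℕ.≟_) xs))

count-≡ : ∀ i xs → count i (i ∷ xs) ≡ suc (count i xs)
count-≡ i xs = cong length (List.filter-accept (i ℕ.≟_) {xs = xs} refl)

count-≢ : ∀ {i x} xs → i ≢ x → count i (x ∷ xs) ≡ count i xs
count-≢ {i} xs n = cong length (List.filter-reject (i ℕ.≟_) {xs = xs} n)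

count-none : ∀ {i xs} → All (i <_) xs → count i xs ≡ 0
count-none []       = refl
count-none {i} {_ ∷ xs} (p ∷ ps) = trans (count-≢ xs (ℕ.<⇒≢ p)) (count-none ps)

Increasing : List ℕ → Set
Increasing = AllPairs _<_

data Head (i : ℕ) : List ℕ → Set where
  hit  : ∀ {c} → All (i <_) c → Increasing c → Head i (i ∷ c)
  miss : ∀ {c} → All (i <_) c → Head i c

head : ∀ {i c} → All (i ≤_) c → Increasing c → Head i c
head [] [] = miss []
head (p ∷ _) (q ∷ inc) with ℕ.m≤n⇒m<n∨m≡n p
... | inj₁ l    = miss (l ∷ All.map (ℕ.<-trans l) q)
... | inj₂ refl = hit q inc

-- The letters i, i + 1, … occur in (c , d) with multiplicities ν.
Content : ℕ → List ℕ → List ℕ → List ℕ → Set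
Content i []      c d = ⊤
Content i (x ∷ ν) c d = count i c ℕ.+ count i d ≡ x × Content (suc i) ν c d

content-cong : ∀ i ν {c d c′ d′} → (∀ j → i ≤ j → count j c ≡ count j c′) →
               (∀ j → i ≤ j → count j d ≡ count j d′) → Content i ν c d → Content i ν c′ d′
content-cong i []      f g _       = tt
content-cong i (x ∷ ν) f g (e , t) =
  trans (cong₂ ℕ._+_ (sym (f i ℕ.≤-refl)) (sym (g i ℕ.≤-refl))) e ,
  content-cong (suc i) ν (λ j h → f j (ℕ.<⇒≤ h)) (λ j h → g j (ℕ.<⇒≤ h)) t

count-tail : ∀ {i} c j → suc i ≤ j → count j (i ∷ c) ≡ count j c
count-tail c j h = count-≢ c (λ e → ℕ.<⇒≢ h (sym e))

-- `upTo` unfolds to `applyUpTo` with ever more shifted functions, so the induction has to range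
-- over all `f` that enumerate the letters from `i` on.
content-applyUpTo : ∀ (f : ℕ → ℕ) i ν c d → (∀ j → f j ≡ i ℕ.+ j) →
  map (λ j → count j c ℕ.+ count j d) (applyUpTo f (length ν)) ≡ ν → Content i ν c d
content-applyUpTo f i []      c d h e = tt
content-applyUpTo f i (x ∷ ν) c d h e with refl , e′ ← List.∷-injective e =
  cong (λ k → count k c ℕ.+ count k d) (sym (trans (h 0) (ℕ.+-identityʳ i))) ,
  content-applyUpTo (f ∘ suc) (suc i) ν c d (λ j → trans (h (suc j)) (ℕ.+-suc i j)) e′

applyUpTo-content : ∀ (f : ℕ → ℕ) i ν c d → (∀ j → f j ≡ i ℕ.+ j) → Content i ν c d →
  map (λ j → count j c ℕ.+ count j d) (applyUpTo f (length ν)) ≡ ν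
applyUpTo-content f i []      c d h _       = refl
applyUpTo-content f i (x ∷ ν) c d h (e , t) = cong₂ _∷_
  (trans (cong (λ k → count k c ℕ.+ count k d) (trans (h 0) (ℕ.+-identityʳ i))) e)
  (applyUpTo-content (f ∘ suc) (suc i) ν c d (λ j → trans (h (suc j)) (ℕ.+-suc i j)) t)

-- The first h cells of d have their left neighbours outside c.
Rows≤ : ℕ → List ℕ → List ℕ → Set
Rows≤ h c d = All (uncurry _≤_) (zip c (drop h d))

record ColumnPair (i : ℕ) (ν : List ℕ) (h q : ℕ) (c d : List ℕ) : Set where
  constructor columnPair
  field
    inc₁    : Increasing c
    inc₂    : Increasing d
    lower₁  : All (i ≤_) c
    lower₂  : All (i ≤_) d
    upper₁  : All (_< i ℕ.+ length ν) c
    upper₂  : All (_< i ℕ.+ length ν) d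
    contents : Content i ν c d
    size    : length d ≡ q
    rows≤   : Rows≤ h c d
    fits    : q ≤ h ℕ.+ length c

Columns : Set
Columns = List ℕ × List ℕ

add₁ add₂ : ℕ → Columns → Columns
add₁ i (c , d) = i ∷ c , d
add₂ i (c , d) = c , i ∷ d

-- All pairs of columns with contents ν (letters from i on) and q cells in the
-- second column, when the first column already has h cells in excess.
fill : ℕ → List ℕ → ℕ → ℕ → List Columns
fill i []                      h       zero    = [ [] , [] ]
fill i []                      h       (suc q) = []
fill i (0 ∷ ν)                 h       q       = fill (suc i) ν h q
fill i (1 ∷ ν)                 (suc h) (suc q) =
  map (add₁ i) (fill (suc i) ν (suc (suc h)) (suc q)) ++ map (add₂ i) (fill (suc i) ν h q)
fill i (1 ∷ ν)                 h       q       = map (add₁ i) (fill (suc i) ν (suc h) q)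
fill i (2 ∷ ν)                 h       zero    = []
fill i (2 ∷ ν)                 h       (suc q) = map (add₁ i ∘ add₂ i) (fill (suc i) ν h q)
fill i (suc (suc (suc _)) ∷ ν) h       q       = []

-- The number of lattice paths from height `h` that never go below 0. A letter of multiplicity one
-- steps up (first column) or down (second column), one of multiplicity two enters both columns and
-- keeps the height, and a higher multiplicity is impossible in two strict columns. `q` cells remain
-- to be placed in the second column.
ballot : List ℕ → ℕ → ℕ → ℕ
ballot []                      h       zero    = 1
ballot []                      h       (suc q) = 0
ballot (0 ∷ ν)                 h       q       = ballot ν h q
ballot (1 ∷ ν)                 (suc h) (suc q) = ballot ν (suc (suc h)) (suc q) ℕ.+ ballot ν h q
ballot (1 ∷ ν)                 h       q       = ballot ν (suc h) q
ballot (2 ∷ ν)                 h       zero    = 0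
ballot (2 ∷ ν)                 h       (suc q) = ballot ν h q
ballot (suc (suc (suc _)) ∷ ν) h       q       = 0

fill-length : ∀ i ν h q → length (fill i ν h q) ≡ ballot ν h q
fill-length i [] h zero = refl
fill-length i [] h (suc q) = refl
fill-length i (0 ∷ ν) h q = fill-length (suc i) ν h q
fill-length i (1 ∷ ν) zero zero = trans (List.length-map _ (fill (suc i) ν 1 0)) (fill-length (suc i) ν 1 0)
fill-length i (1 ∷ ν) zero (suc q) = trans (List.length-map _ (fill (suc i) ν 1 (suc q))) (fill-length (suc i) ν 1 (suc q))
fill-length i (1 ∷ ν) (suc h) zero = trans (List.length-map _ (fill (suc i) ν (suc (suc h)) 0)) (fill-length (suc i) ν _ 0)
fill-length i (1 ∷ ν) (suc h) (suc q) =
  trans (List.length-++ (map (add₁ i) (fill (suc i) ν (suc (suc h)) (suc q))))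
    (cong₂ ℕ._+_
      (trans (List.length-map _ (fill (suc i) ν (suc (suc h)) (suc q))) (fill-length (suc i) ν _ (suc q)))
      (trans (List.length-map _ (fill (suc i) ν h q)) (fill-length (suc i) ν h q)))
fill-length i (2 ∷ ν) h zero = refl
fill-length i (2 ∷ ν) h (suc q) = trans (List.length-map _ (fill (suc i) ν h q)) (fill-length (suc i) ν h q)
fill-length i (suc (suc (suc _)) ∷ ν) h q = refl

drop₁ : ∀ {A : Set} h (d : List A) → drop 1 (drop h d) ≡ drop (suc h) d
drop₁ zero    d       = refl
drop₁ (suc h) []      = refl
drop₁ (suc h) (x ∷ d) = drop₁ h d

zip-tail⁺ : ∀ {i c ys} → All (i ≤_) ys → All (uncurry _≤_) (zip c (drop 1 ys)) →
            All (uncurry _≤_) (zip (i ∷ c) ys)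
zip-tail⁺ []      _ = []
zip-tail⁺ (p ∷ _) r = p ∷ r

zip-tail⁻ : ∀ {i c} ys → All (uncurry _≤_) (zip (i ∷ c) ys) → All (uncurry _≤_) (zip c (drop 1 ys))
zip-tail⁻ {c = []}    []       _       = []
zip-tail⁻ {c = _ ∷ _} []       _       = []
zip-tail⁻             (_ ∷ ys) (_ ∷ r) = r

-- Placed only in the first column, `i` becomes the left neighbour of the cell of `d` at index `h`,
-- if there is one, so the remaining rows begin one cell further down.
rows-left⁺ : ∀ {i c d} h → All (i ≤_) d → Rows≤ (suc h) c d → Rows≤ h (i ∷ c) d
rows-left⁺ {c = c} {d} h p r = zip-tail⁺ (All.drop⁺ h p)
  (subst (λ ys → All (uncurry _≤_) (zip c ys)) (sym (drop₁ h d)) r)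

rows-left⁻ : ∀ {i c d} h → Rows≤ h (i ∷ c) d → Rows≤ (suc h) c d
rows-left⁻ {c = c} {d} h r =
  subst (λ ys → All (uncurry _≤_) (zip c ys)) (drop₁ h d) (zip-tail⁻ (drop h d) r)

rows-both⁺ : ∀ {i c d} h → All (i ≤_) d → Rows≤ h c d → Rows≤ h (i ∷ c) (i ∷ d)
rows-both⁺ zero    p r = ℕ.≤-refl ∷ r
rows-both⁺ (suc h) p r = rows-left⁺ h p r

rows-both⁻ : ∀ {i c d} h → Rows≤ h (i ∷ c) (i ∷ d) → Rows≤ h c d
rows-both⁻ zero    (_ ∷ r) = r
rows-both⁻ (suc h) r       = rows-left⁻ h r

module _ {i : ℕ} {ν : List ℕ} {h q : ℕ} {c d : List ℕ} where

  private
    end : ∀ {k} → suc i ℕ.+ length ν ≡ k → i ℕ.+ suc (length ν) ≡ k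
    end e = trans (ℕ.+-suc i (length ν)) e
    up : ∀ {c} → All (_< suc i ℕ.+ length ν) c → All (_< i ℕ.+ suc (length ν)) c
    up = All.map (λ {x} → subst (x <_) (sym (end refl)))
    dn : ∀ {c} → All (_< i ℕ.+ suc (length ν)) c → All (_< suc i ℕ.+ length ν) c
    dn = All.map (λ {x} → subst (x <_) (end refl))
    i<end : i < i ℕ.+ suc (length ν)
    i<end = subst (i <_) (sym (end refl)) (ℕ.m≤m+n (suc i) (length ν))

  pair-none⁺ : ColumnPair (suc i) ν h q c d → ColumnPair i (0 ∷ ν) h q c d
  pair-none⁺ (columnPair a b l m u v e s r f) =
    columnPair a b (All.map ℕ.<⇒≤ l) (All.map ℕ.<⇒≤ m) (up u) (up v)
      (cong₂ ℕ._+_ (count-none l) (count-none m) , e) s r f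

  pair-left⁺ : ColumnPair (suc i) ν (suc h) q c d → ColumnPair i (1 ∷ ν) h q (i ∷ c) d
  pair-left⁺ (columnPair a b l m u v e s r f) =
    columnPair (l ∷ a) b (ℕ.≤-refl ∷ All.map ℕ.<⇒≤ l) (All.map ℕ.<⇒≤ m) (i<end ∷ up u) (up v)
      (cong₂ ℕ._+_ (trans (count-≡ i c) (cong suc (count-none l))) (count-none m) ,
       content-cong (suc i) ν (λ j p → sym (count-tail c j p)) (λ _ _ → refl) e)
      s (rows-left⁺ {c = c} {d} h (All.map ℕ.<⇒≤ m) r) (subst (q ≤_) (sym (ℕ.+-suc h (length c))) f)

  pair-right⁺ : ColumnPair (suc i) ν h q c d → ColumnPair i (1 ∷ ν) (suc h) (suc q) c (i ∷ d)
  pair-right⁺ (columnPair a b l m u v e s r f) =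
    columnPair a (m ∷ b) (All.map ℕ.<⇒≤ l) (ℕ.≤-refl ∷ All.map ℕ.<⇒≤ m) (up u) (i<end ∷ up v)
      (cong₂ ℕ._+_ (count-none l) (trans (count-≡ i d) (cong suc (count-none m))) ,
       content-cong (suc i) ν (λ _ _ → refl) (λ j p → sym (count-tail d j p)) e)
      (cong suc s) r (s≤s f)

  pair-both⁺ : ColumnPair (suc i) ν h q c d → ColumnPair i (2 ∷ ν) h (suc q) (i ∷ c) (i ∷ d)
  pair-both⁺ (columnPair a b l m u v e s r f) =
    columnPair (l ∷ a) (m ∷ b) (ℕ.≤-refl ∷ All.map ℕ.<⇒≤ l) (ℕ.≤-refl ∷ All.map ℕ.<⇒≤ m)
      (i<end ∷ up u) (i<end ∷ up v)
      (cong₂ ℕ._+_ (trans (count-≡ i c) (cong suc (count-none l))) (trans (count-≡ i d) (cong suc (count-none m))) ,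
       content-cong (suc i) ν (λ j p → sym (count-tail c j p)) (λ j p → sym (count-tail d j p)) e)
      (cong suc s) (rows-both⁺ {c = c} {d} h (All.map ℕ.<⇒≤ m) r)
      (subst (suc q ≤_) (sym (ℕ.+-suc h (length c))) (s≤s f))

  pair-none⁻ : ∀ {x} → All (i <_) c → All (i <_) d → ColumnPair i (x ∷ ν) h q c d →
               x ≡ 0 × ColumnPair (suc i) ν h q c d
  pair-none⁻ l m (columnPair a b _ _ u v (e , t) s r f) =
    trans (sym e) (cong₂ ℕ._+_ (count-none l) (count-none m)) ,
    columnPair a b l m (dn u) (dn v) t s r f

  pair-left⁻ : ∀ {x} → All (i <_) c → All (i <_) d → ColumnPair i (x ∷ ν) h q (i ∷ c) d →
               x ≡ 1 × ColumnPair (suc i) ν (suc h) q c d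
  pair-left⁻ l m (columnPair (_ ∷ a) b _ _ (_ ∷ u) v (e , t) s r f) =
    trans (sym e) (cong₂ ℕ._+_ (trans (count-≡ i c) (cong suc (count-none l))) (count-none m)) ,
    columnPair a b l m (dn u) (dn v)
      (content-cong (suc i) ν (count-tail c) (λ _ _ → refl) t)
      s (rows-left⁻ {c = c} {d} h r) (subst (q ≤_) (ℕ.+-suc h (length c)) f)

  pair-right⁻ : ∀ {x} → All (i <_) c → All (i <_) d → ColumnPair i (x ∷ ν) (suc h) (suc q) c (i ∷ d) →
                x ≡ 1 × ColumnPair (suc i) ν h q c d
  pair-right⁻ l m (columnPair a (_ ∷ b) _ _ u (_ ∷ v) (e , t) s r f) =
    trans (sym e) (cong₂ ℕ._+_ (count-none l) (trans (count-≡ i d) (cong suc (count-none m)))) ,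
    columnPair a b l m (dn u) (dn v)
      (content-cong (suc i) ν (λ _ _ → refl) (count-tail d) t)
      (ℕ.suc-injective s) r (ℕ.≤-pred f)

  pair-both⁻ : ∀ {x} → All (i <_) c → All (i <_) d → ColumnPair i (x ∷ ν) h (suc q) (i ∷ c) (i ∷ d) →
               x ≡ 2 × ColumnPair (suc i) ν h q c d
  pair-both⁻ l m (columnPair (_ ∷ a) (_ ∷ b) _ _ (_ ∷ u) (_ ∷ v) (e , t) s r f) =
    trans (sym e) (cong₂ ℕ._+_ (trans (count-≡ i c) (cong suc (count-none l)))
                               (trans (count-≡ i d) (cong suc (count-none m)))) ,
    columnPair a b l m (dn u) (dn v)
      (content-cong (suc i) ν (count-tail c) (count-tail d) t)
      (ℕ.suc-injective s) (rows-both⁻ {c = c} {d} h r)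
      (ℕ.≤-pred (subst (suc q ≤_) (ℕ.+-suc h (length c)) f))

-- If the least letter `i` is in the second column only, its left neighbour is an earlier letter.
-- With `h = 0` that neighbour would be the head of `c`, which is larger than `i`, or missing, which
-- `fits` forbids.
pair-right-h : ∀ {i ν h q c d} → All (i <_) c → ColumnPair i ν h q c (i ∷ d) →
               (∃ λ h′ → h ≡ suc h′) × (∃ λ q′ → q ≡ suc q′)
pair-right-h {h = suc h} l p = (h , refl) , (_ , sym (ColumnPair.size p))
pair-right-h {h = zero} {c = []} l p with refl ← ColumnPair.size p | () ← ColumnPair.fits p
pair-right-h {h = zero} {c = x ∷ c} (i<x ∷ _) p with x≤i ∷ _ ← ColumnPair.rows≤ p =
  ⊥-elim (ℕ.<⇒≱ i<x x≤i)

fill-sound : ∀ i ν h q {c d} → (c , d) ∈ fill i ν h q → ColumnPair i ν h q c d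
fill-sound i [] h zero (here refl) = columnPair [] [] [] [] [] [] tt refl (none h) z≤n
  where
  none : ∀ h → Rows≤ h [] []
  none zero    = []
  none (suc h) = []
fill-sound i (0 ∷ ν) h q m = pair-none⁺ (fill-sound (suc i) ν h q m)
fill-sound i (1 ∷ ν) zero zero m with (c , d) , m′ , refl ← ∈-map⁻ (add₁ i) m =
  pair-left⁺ (fill-sound (suc i) ν 1 0 m′)
fill-sound i (1 ∷ ν) zero (suc q) m with (c , d) , m′ , refl ← ∈-map⁻ (add₁ i) m =
  pair-left⁺ (fill-sound (suc i) ν 1 (suc q) m′)
fill-sound i (1 ∷ ν) (suc h) zero m with (c , d) , m′ , refl ← ∈-map⁻ (add₁ i) m =
  pair-left⁺ (fill-sound (suc i) ν (suc (suc h)) 0 m′)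
fill-sound i (1 ∷ ν) (suc h) (suc q) m with ∈-++⁻ (map (add₁ i) (fill (suc i) ν (suc (suc h)) (suc q))) m
... | inj₁ n with (c , d) , m′ , refl ← ∈-map⁻ (add₁ i) n =
  pair-left⁺ (fill-sound (suc i) ν (suc (suc h)) (suc q) m′)
... | inj₂ n with (c , d) , m′ , refl ← ∈-map⁻ (add₂ i) n =
  pair-right⁺ (fill-sound (suc i) ν h q m′)
fill-sound i (2 ∷ ν) h (suc q) m with (c , d) , m′ , refl ← ∈-map⁻ (add₁ i ∘ add₂ i) m =
  pair-both⁺ (fill-sound (suc i) ν h q m′)

fill-left : ∀ i ν h q {x} → x ∈ fill (suc i) ν (suc h) q → add₁ i x ∈ fill i (1 ∷ ν) h q
fill-left i ν zero    zero    m = ∈-map⁺ (add₁ i) m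
fill-left i ν zero    (suc q) m = ∈-map⁺ (add₁ i) m
fill-left i ν (suc h) zero    m = ∈-map⁺ (add₁ i) m
fill-left i ν (suc h) (suc q) m = ∈-++⁺ˡ (∈-map⁺ (add₁ i) m)

fill-complete : ∀ i ν h q {c d} → ColumnPair i ν h q c d → (c , d) ∈ fill i ν h q
fill-complete i [] h q {[]} {[]} p with refl ← ColumnPair.size p = here refl
fill-complete i [] h q {x ∷ c} {d} p with l ∷ _ ← ColumnPair.lower₁ p | u ∷ _ ← ColumnPair.upper₁ p =
  ⊥-elim (ℕ.<⇒≱ u (subst (_≤ x) (sym (ℕ.+-identityʳ i)) l))
fill-complete i [] h q {[]} {x ∷ d} p with l ∷ _ ← ColumnPair.lower₂ p | u ∷ _ ← ColumnPair.upper₂ p =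
  ⊥-elim (ℕ.<⇒≱ u (subst (_≤ x) (sym (ℕ.+-identityʳ i)) l))
fill-complete i (x ∷ ν) h q p
  with head (ColumnPair.lower₁ p) (ColumnPair.inc₁ p) | head (ColumnPair.lower₂ p) (ColumnPair.inc₂ p)
... | miss l | miss m with refl , p′ ← pair-none⁻ l m p = fill-complete (suc i) ν h q p′
... | hit l _ | miss m with refl , p′ ← pair-left⁻ l m p = fill-left i ν h q (fill-complete (suc i) ν (suc h) q p′)
... | miss l | hit m _ with (h′ , refl) , (q′ , refl) ← pair-right-h l p
  with refl , p′ ← pair-right⁻ l m p = ∈-++⁺ʳ _ (∈-map⁺ (add₂ i) (fill-complete (suc i) ν h′ q′ p′))
... | hit l _ | hit m _ with refl ← ColumnPair.size p
  with refl , p′ ← pair-both⁻ l m p = ∈-map⁺ (add₁ i ∘ add₂ i) (fill-complete (suc i) ν h _ p′)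

add₁-injective : ∀ {i x y} → add₁ i x ≡ add₁ i y → x ≡ y
add₁-injective refl = refl

add₂-injective : ∀ {i x y} → add₂ i x ≡ add₂ i y → x ≡ y
add₂-injective refl = refl

fill-unique : ∀ i ν h q → Unique (fill i ν h q)
fill-unique i [] h zero = [] ∷ []
fill-unique i [] h (suc q) = []
fill-unique i (0 ∷ ν) h q = fill-unique (suc i) ν h q
fill-unique i (1 ∷ ν) zero zero = Unique.map⁺ add₁-injective (fill-unique (suc i) ν 1 0)
fill-unique i (1 ∷ ν) zero (suc q) = Unique.map⁺ add₁-injective (fill-unique (suc i) ν 1 (suc q))
fill-unique i (1 ∷ ν) (suc h) zero = Unique.map⁺ add₁-injective (fill-unique (suc i) ν (suc (suc h)) 0)
fill-unique i (1 ∷ ν) (suc h) (suc q) =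
  Unique.++⁺ (Unique.map⁺ add₁-injective (fill-unique (suc i) ν (suc (suc h)) (suc q)))
             (Unique.map⁺ add₂-injective (fill-unique (suc i) ν h q)) disjoint
  where
  disjoint : ∀ {x} → ¬ (x ∈ map (add₁ i) (fill (suc i) ν (suc (suc h)) (suc q)) × x ∈ map (add₂ i) (fill (suc i) ν h q))
  disjoint (m , n) with _ , _ , refl ← ∈-map⁻ (add₁ i) m
    with _ , n′ , refl ← ∈-map⁻ (add₂ i) n
    with l ∷ _ ← ColumnPair.lower₁ (fill-sound (suc i) ν h q n′) = ℕ.<-irrefl refl l
fill-unique i (2 ∷ ν) h zero = []
fill-unique i (2 ∷ ν) h (suc q) = Unique.map⁺ (λ { refl → refl }) (fill-unique (suc i) ν h q)
fill-unique i (suc (suc (suc _)) ∷ ν) h q = []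

fill-size : ∀ i ν h q {c d} → (c , d) ∈ fill i ν h q → length c ℕ.+ length d ≡ sum ν
fill-size i [] h zero (here refl) = refl
fill-size i (0 ∷ ν) h q m = fill-size (suc i) ν h q m
fill-size i (1 ∷ ν) zero zero m with _ , m′ , refl ← ∈-map⁻ (add₁ i) m =
  cong suc (fill-size (suc i) ν 1 0 m′)
fill-size i (1 ∷ ν) zero (suc q) m with _ , m′ , refl ← ∈-map⁻ (add₁ i) m =
  cong suc (fill-size (suc i) ν 1 (suc q) m′)
fill-size i (1 ∷ ν) (suc h) zero m with _ , m′ , refl ← ∈-map⁻ (add₁ i) m =
  cong suc (fill-size (suc i) ν (suc (suc h)) 0 m′)
fill-size i (1 ∷ ν) (suc h) (suc q) m with ∈-++⁻ (map (add₁ i) (fill (suc i) ν (suc (suc h)) (suc q))) m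
... | inj₁ n with _ , m′ , refl ← ∈-map⁻ (add₁ i) n =
  cong suc (fill-size (suc i) ν (suc (suc h)) (suc q) m′)
... | inj₂ n with (c , d) , m′ , refl ← ∈-map⁻ (add₂ i) n =
  trans (ℕ.+-suc (length c) (length d)) (cong suc (fill-size (suc i) ν h q m′))
fill-size i (2 ∷ ν) h (suc q) m with (c , d) , m′ , refl ← ∈-map⁻ (add₁ i ∘ add₂ i) m =
  cong suc (trans (ℕ.+-suc (length c) (length d)) (cong suc (fill-size (suc i) ν h q m′)))

rows : List ℕ → List ℕ → List (List ℕ)
rows []      _       = []
rows (x ∷ c) []      = (x ∷ []) ∷ rows c []
rows (x ∷ c) (y ∷ d) = (x ∷ y ∷ []) ∷ rows c d

columns : List (List ℕ) → Columns
columns []                  = [] , []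
columns ([] ∷ T)            = columns T
columns ((x ∷ []) ∷ T)      = add₁ x (columns T)
columns ((x ∷ y ∷ _) ∷ T)   = add₁ x (add₂ y (columns T))

columns-rows : ∀ c d → length d ≤ length c → columns (rows c d) ≡ (c , d)
columns-rows []      []      _       = refl
columns-rows (x ∷ c) []      _       = cong (add₁ x) (columns-rows c [] z≤n)
columns-rows (x ∷ c) (y ∷ d) (s≤s l) = cong (add₁ x ∘ add₂ y) (columns-rows c d l)

rows-fillings⁻ : ∀ as k m {T} → T ∈ fillings as (replicate k 2 ++ replicate m 1) →
  ∃₂ λ c d → T ≡ rows c d × length c ≡ k ℕ.+ m × length d ≡ k × All (_∈ as) c × All (_∈ as) d
rows-fillings⁻ as zero zero (here refl) = [] , [] , refl , refl , refl , [] , []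
rows-fillings⁻ as zero (suc m) i
  with w , T , p , q , refl ← ∈-cartesianProductWith⁻ _∷_ (words as 1) (fillings as (replicate m 1)) i
  with x ∷ [] ← w | _ , px ∷ [] ← ∈-words⁻ as 1 p
  with c , [] , refl , l , refl , u , v ← rows-fillings⁻ as zero m q =
  x ∷ c , [] , refl , cong suc l , refl , px ∷ u , []
rows-fillings⁻ as (suc k) m i
  with w , T , p , q , refl ← ∈-cartesianProductWith⁻ _∷_ (words as 2) (fillings as (replicate k 2 ++ replicate m 1)) i
  with x ∷ y ∷ [] ← w | _ , px ∷ py ∷ [] ← ∈-words⁻ as 2 p
  with c , d , refl , l , n , u , v ← rows-fillings⁻ as k m q =
  x ∷ c , y ∷ d , refl , cong suc l , cong suc n , px ∷ u , py ∷ v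

rows-fillings⁺ : ∀ {as} k m c d → length c ≡ k ℕ.+ m → length d ≡ k → All (_∈ as) c → All (_∈ as) d →
  rows c d ∈ fillings as (replicate k 2 ++ replicate m 1)
rows-fillings⁺ zero zero [] [] _ _ _ _ = here refl
rows-fillings⁺ zero (suc m) (x ∷ c) [] l _ (p ∷ u) [] =
  ∈-cartesianProductWith⁺ _∷_ (∈-words⁺ (x ∷ []) (p ∷ [])) (rows-fillings⁺ zero m c [] (ℕ.suc-injective l) refl u [])
rows-fillings⁺ (suc k) m (x ∷ c) (y ∷ d) l n (p ∷ u) (q ∷ v) =
  ∈-cartesianProductWith⁺ _∷_ (∈-words⁺ (x ∷ y ∷ []) (p ∷ q ∷ []))
    (rows-fillings⁺ k m c d (ℕ.suc-injective l) (ℕ.suc-injective n) u v)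

semistandard-rows⁻ : ∀ c d → length d ≤ length c → IsSemistandard (rows c d) →
  Linked _<_ c × Linked _<_ d × Rows≤ 0 c d
semistandard-rows⁻ [] [] _ _ = [] , [] , []
semistandard-rows⁻ (x ∷ []) [] _ _ = [-] , [] , []
semistandard-rows⁻ (x ∷ x′ ∷ c) [] _ (_ ∷ w , (p ∷ []) ∷ s) with a , _ , _ ← semistandard-rows⁻ (x′ ∷ c) [] z≤n (w , s) =
  p ∷ a , [] , []
semistandard-rows⁻ (x ∷ []) (y ∷ []) _ ((p ∷ _) ∷ _ , _) = [-] , [-] , p ∷ []
semistandard-rows⁻ (x ∷ []) (y ∷ _ ∷ _) (s≤s ()) _
semistandard-rows⁻ (x ∷ x′ ∷ c) (y ∷ []) _ ((p ∷ _) ∷ w , (q ∷ []) ∷ s)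
  with a , _ , _ ← semistandard-rows⁻ (x′ ∷ c) [] z≤n (w , s) = q ∷ a , [-] , p ∷ []
semistandard-rows⁻ (x ∷ x′ ∷ c) (y ∷ y′ ∷ d) (s≤s l) ((p ∷ _) ∷ w , (q ∷ r ∷ []) ∷ s)
  with a , b , t ← semistandard-rows⁻ (x′ ∷ c) (y′ ∷ d) l (w , s) = q ∷ a , r ∷ b , p ∷ t

semistandard-rows⁺ : ∀ c d → length d ≤ length c → Linked _<_ c → Linked _<_ d → Rows≤ 0 c d →
  IsSemistandard (rows c d)
semistandard-rows⁺ [] [] _ _ _ _ = [] , []
semistandard-rows⁺ (x ∷ []) [] _ _ _ _ = [-] ∷ [] , [-]
semistandard-rows⁺ (x ∷ x′ ∷ c) [] _ (p ∷ a) _ _ with w , s ← semistandard-rows⁺ (x′ ∷ c) [] z≤n a [] [] =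
  [-] ∷ w , (p ∷ []) ∷ s
semistandard-rows⁺ (x ∷ []) (y ∷ []) _ _ _ (p ∷ []) = (p ∷ [-]) ∷ [] , [-]
semistandard-rows⁺ (x ∷ []) (y ∷ _ ∷ _) (s≤s ()) _ _ _
semistandard-rows⁺ (x ∷ x′ ∷ c) (y ∷ []) _ (q ∷ a) _ (p ∷ _)
  with w , s ← semistandard-rows⁺ (x′ ∷ c) [] z≤n a [] [] = (p ∷ [-]) ∷ w , (q ∷ []) ∷ s
semistandard-rows⁺ (x ∷ x′ ∷ c) (y ∷ y′ ∷ d) (s≤s l) (q ∷ a) (r ∷ b) (p ∷ t)
  with w , s ← semistandard-rows⁺ (x′ ∷ c) (y′ ∷ d) l a b t = (p ∷ [-]) ∷ w , (q ∷ r ∷ []) ∷ s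

count-∷ : ∀ i x xs → count i (x ∷ xs) ≡ count i [ x ] ℕ.+ count i xs
count-∷ i x xs = count-++ i [ x ] xs

count-rows : ∀ i c d → length d ≤ length c → count i (concat (rows c d)) ≡ count i c ℕ.+ count i d
count-rows i [] [] _ = refl
count-rows i (x ∷ c) [] _ = trans (count-∷ i x (concat (rows c [])))
  (trans (cong (count i [ x ] ℕ.+_) (count-rows i c [] z≤n))
    (trans (sym (ℕ.+-assoc (count i [ x ]) _ _)) (cong (ℕ._+ 0) (sym (count-∷ i x c)))))
count-rows i (x ∷ c) (y ∷ d) (s≤s l) = trans (count-∷ i x (y ∷ concat (rows c d)))
  (trans (cong (count i [ x ] ℕ.+_) (trans (count-∷ i y (concat (rows c d))) (cong (count i [ y ] ℕ.+_) (count-rows i c d l))))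
    (trans (trans (sym (ℕ.+-assoc (count i [ x ]) _ _)) (+-interchange (count i [ x ]) (count i [ y ]) _ _))
      (cong₂ ℕ._+_ (sym (count-∷ i x c)) (sym (count-∷ i y d)))))

content-rows : ∀ m c d → length d ≤ length c →
  content m (rows c d) ≡ map (λ j → count j c ℕ.+ count j d) (upTo m)
content-rows m c d l = List.map-cong (λ i → count-rows i c d l) (upTo m)

-- Tableaux are enumerated by rows, `fill` by columns. `columns` and `rows` are inverse because the
-- second column is no longer than the first; the count starts at letter 0 with no excess.
kostka-fill : ∀ n k ν → k ℕ.+ k ≤ n → sum ν ≡ n → kostka (twoColumn n k) ν ≡ length (fill 0 ν 0 k)
kostka-fill n k ν 2k≤n refl =
  bijection-length columns (uncurry rows)
    (Unique.filter⁺ good? (fillings-unique (twoColumn n k) (Unique.upTo⁺ (length ν))))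
    (fill-unique 0 ν 0 k) to from
  where
  m = length ν
  good? : Decidable (λ T → IsSemistandard T × content m T ≡ ν)
  good? T = isSemistandard? T ×-dec List.≡-dec ℕ._≟_ (content m T) ν
  k≤n∸k : k ≤ n ∸ k
  k≤n∸k = subst (_≤ n ∸ k) (ℕ.m+n∸m≡n k k) (ℕ.∸-monoˡ-≤ k 2k≤n)
  to : ∀ {T} → T ∈ filter good? (fillings (upTo m) (twoColumn n k)) →
       columns T ∈ fill 0 ν 0 k × uncurry rows (columns T) ≡ T
  to i with j , s , e ← ∈-filter⁻ good? {xs = fillings (upTo m) (twoColumn n k)} i
    with c , d , refl , l , r , u , v ← rows-fillings⁻ (upTo m) k (n ∸ k ∸ k) j =
    subst (_∈ fill 0 ν 0 k) (sym cr) (fill-complete 0 ν 0 k pair) , cong (uncurry rows) cr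
    where
    len : length c ≡ n ∸ k
    len = trans l (l+[n∸l∸l] {n} {k} 2k≤n)
    d≤c : length d ≤ length c
    d≤c = subst₂ _≤_ (sym r) (sym len) k≤n∸k
    cr = columns-rows c d d≤c
    ss = semistandard-rows⁻ c d d≤c s
    pair : ColumnPair 0 ν 0 k c d
    pair = columnPair (Linked⇒AllPairs ℕ.<-trans (proj₁ ss)) (Linked⇒AllPairs ℕ.<-trans (proj₁ (proj₂ ss)))
      (All.tabulate (λ _ → z≤n)) (All.tabulate (λ _ → z≤n)) (All.map ∈-upTo⁻ u) (All.map ∈-upTo⁻ v)
      (content-applyUpTo id 0 ν c d (λ _ → refl) (trans (sym (content-rows m c d d≤c)) e))
      r (proj₂ (proj₂ ss)) (subst (k ≤_) (sym len) k≤n∸k)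
  from : ∀ {x} → x ∈ fill 0 ν 0 k →
         uncurry rows x ∈ filter good? (fillings (upTo m) (twoColumn n k)) × columns (uncurry rows x) ≡ x
  from {c , d} i with columnPair a b _ _ u v t s r f ← fill-sound 0 ν 0 k i =
    ∈-filter⁺ good?
      (rows-fillings⁺ k (n ∸ k ∸ k) c d (trans len (sym (l+[n∸l∸l] {n} {k} 2k≤n))) s
        (All.map ∈-upTo⁺ u) (All.map ∈-upTo⁺ v))
      (semistandard-rows⁺ c d d≤c (AllPairs⇒Linked a) (AllPairs⇒Linked b) r ,
       trans (content-rows m c d d≤c) (applyUpTo-content id 0 ν c d (λ _ → refl) t)) ,
    columns-rows c d d≤c
    where
    d≤c : length d ≤ length c
    d≤c = subst (_≤ length c) (sym s) f
    len : length c ≡ n ∸ k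
    -- `ColumnPair` fixes only the length of the second column; that of the first follows from the
    -- total number of cells.
    len = trans (sym (ℕ.m+n∸n≡m (length c) k)) (cong (_∸ k) (trans (cong (length c ℕ.+_) (sym s)) (fill-size 0 ν 0 k i)))

kostka-ballot : ∀ n k ν → k ℕ.+ k ≤ n → sum ν ≡ n → kostka (twoColumn n k) ν ≡ ballot ν 0 k
kostka-ballot n k ν h e = trans (kostka-fill n k ν h e) (fill-length 0 ν 0 k)

chooseFrom-pascal : ∀ l r q → chooseFrom l (suc r) q ≡ chooseFrom l r q ℕ.+ chooseFrom (suc l) r q
chooseFrom-pascal zero    r zero    = refl
chooseFrom-pascal zero    r (suc q) = refl
chooseFrom-pascal (suc l) r zero    = refl
chooseFrom-pascal (suc l) r (suc q) = chooseFrom-pascal l r q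

-- Reflection principle
ballot-ones : ∀ r h q → q ℕ.+ q ≤ suc (h ℕ.+ r) →
              ballot (replicate r 1) h q ℕ.+ chooseFrom (suc h) r q ≡ choose r q
-- `chooseFrom (suc h) r q` counts the paths that reach height -1: reflecting the part before the
-- first visit moves the start to -2 - h and leaves q - h - 1 down steps. The bound says that the
-- final height h + r - 2q is at least -1.
ballot-ones zero h zero _ = refl
ballot-ones zero h (suc q) l = chooseFrom-< h 0 q (ℕ.≤-trans (s≤s (ℕ.m≤n+m q q))
  (subst (suc (q ℕ.+ q) ≤_) (ℕ.+-identityʳ h) (ℕ.≤-pred (subst (_≤ suc (h ℕ.+ 0)) (cong suc (ℕ.+-suc q q)) l))))
ballot-ones (suc r) zero zero l = ballot-ones r 1 zero z≤n
ballot-ones (suc r) (suc h) zero l = ballot-ones r (suc (suc h)) zero z≤n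
-- At height 0 only the step up is allowed; all paths that step down are bad and make up the summand
-- `choose r q` of Pascal's rule.
ballot-ones (suc r) zero (suc q) l =
  trans (cong (b ℕ.+_) (trans (chooseFrom-pascal 0 r q) (ℕ.+-comm (choose r q) _)))
    (trans (sym (ℕ.+-assoc b _ (choose r q))) (cong (ℕ._+ choose r q) (ballot-ones r 1 (suc q) l)))
  where b = ballot (replicate r 1) 1 (suc q)
ballot-ones (suc r) (suc h) (suc q) l =
  trans (cong (b₁ ℕ.+ b₂ ℕ.+_) (chooseFrom-pascal (suc h) r q))
    (trans (trans (cong (b₁ ℕ.+ b₂ ℕ.+_) (ℕ.+-comm (chooseFrom (suc h) r q) _))
                  (+-interchange b₁ b₂ (chooseFrom (suc (suc h)) r q) _))
      (cong₂ ℕ._+_ (ballot-ones r (suc (suc h)) (suc q) l₁) (ballot-ones r h q l₂)))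
  where
  b₁ = ballot (replicate r 1) (suc (suc h)) (suc q)
  b₂ = ballot (replicate r 1) h q
  l₁ : suc q ℕ.+ suc q ≤ suc (suc (suc h) ℕ.+ r)
  l₁ = subst (λ m → suc q ℕ.+ suc q ≤ suc (suc m)) (ℕ.+-suc h r) l
  l₂ : q ℕ.+ q ≤ suc (h ℕ.+ r)
  l₂ = ℕ.≤-pred (ℕ.≤-pred (subst (_≤ suc (suc (suc h) ℕ.+ r)) (cong suc (ℕ.+-suc q q)) l₁))

-- Each of the `l` leading letters goes to both columns, which uses one cell of the second column
-- and keeps the excess at 0. The rest is `ballot-ones` from height 0, with both binomials shifted
-- by `l`.
ballot-twoColumn : ∀ l r k → k ℕ.+ k ≤ suc (l ℕ.+ l ℕ.+ r) →
  ballot (replicate l 2 ++ replicate r 1) 0 k ℕ.+ chooseFrom (suc l) r k ≡ chooseFrom l r k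
ballot-twoColumn zero    r k       h = ballot-ones r 0 k h
ballot-twoColumn (suc l) r zero    h = refl
ballot-twoColumn (suc l) r (suc k) h = ballot-twoColumn l r k
  (ℕ.≤-pred (ℕ.≤-pred (subst₂ _≤_ (cong suc (ℕ.+-suc k k)) (cong (λ m → suc (suc (m ℕ.+ r))) (ℕ.+-suc l l)) h)))

l+l+[n∸l∸l] : ∀ {n l} → l ℕ.+ l ≤ n → l ℕ.+ l ℕ.+ (n ∸ l ∸ l) ≡ n
l+l+[n∸l∸l] {n} {l} h = trans (ℕ.+-assoc l l _)
  (trans (cong (l ℕ.+_) (l+[n∸l∸l] {n} {l} h)) (ℕ.m+[n∸m]≡n (ℕ.≤-trans (ℕ.m≤m+n l l) h)))

sum-twos-ones : ∀ l r → sum (replicate l 2 ++ replicate r 1) ≡ l ℕ.+ l ℕ.+ r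
sum-twos-ones zero    zero    = refl
sum-twos-ones zero    (suc r) = cong suc (sum-twos-ones zero r)
sum-twos-ones (suc l) r       =
  cong suc (trans (cong suc (sum-twos-ones l r)) (cong (ℕ._+ r) (sym (ℕ.+-suc l l))))

sum-twoColumn : ∀ {n l} → l ℕ.+ l ≤ n → sum (twoColumn n l) ≡ n
sum-twoColumn {n} {l} h = trans (sum-twos-ones l (n ∸ l ∸ l)) (l+l+[n∸l∸l] {n} {l} h)

-- The difference of two binomials in additive form, as subtraction on `ℕ` truncates.
kostka-twoColumn : ∀ n k l → k ℕ.+ k ≤ n → l ℕ.+ l ≤ n →
  kostka (twoColumn n k) (twoColumn n l) ℕ.+ chooseFrom (suc l) (n ∸ l ∸ l) k ≡ chooseFrom l (n ∸ l ∸ l) k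
kostka-twoColumn n k l hk hl =
  trans (cong (ℕ._+ chooseFrom (suc l) (n ∸ l ∸ l) k) (kostka-ballot n k (twoColumn n l) hk (sum-twoColumn {n} {l} hl)))
    (ballot-twoColumn l (n ∸ l ∸ l) k (ℕ.m≤n⇒m≤1+n (subst (k ℕ.+ k ≤_) (sym (l+l+[n∸l∸l] {n} {l} hl)) hk)))

-- A strict column holds the letter 0 at most once, so two columns hold it at most twice; `ballot`
-- computes to 0.
kostka-large : ∀ n k x ν → k ℕ.+ k ≤ n → sum (suc (suc (suc x)) ∷ ν) ≡ n →
               kostka (twoColumn n k) (suc (suc (suc x)) ∷ ν) ≡ 0
kostka-large n k x ν h e = kostka-ballot n k (suc (suc (suc x)) ∷ ν) h e

-- Inverting the Kostka matrix

length≤sum : ∀ {μ} → All (_> 0) μ → length μ ≤ sum μ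
length≤sum []                = z≤n
length≤sum {suc x ∷ μ} (_ ∷ ps) = s≤s (ℕ.≤-trans (length≤sum ps) (ℕ.m≤n+m (sum μ) x))

parts≤sum : ∀ μ → All (_≤ sum μ) μ
parts≤sum []      = []
parts≤sum (x ∷ μ) = ℕ.m≤m+n x (sum μ) ∷ All.map (λ p → ℕ.≤-trans p (ℕ.m≤n+m (sum μ) x)) (parts≤sum μ)

partition? : ∀ n → Decidable (λ μ → IsPartition μ × sum μ ≡ n)
partition? n μ = isPartition? μ ×-dec (sum μ ℕ.≟ n)

-- A partition of `n` has at most `n` parts, each at most `n`, so it is among the words that
-- `partitions` filters.
∈-partitions⁺ : ∀ {μ n} → IsPartition μ → sum μ ≡ n → μ ∈ partitions n
∈-partitions⁺ {μ} p@(_ , pos) refl = ∈-filter⁺ (partition? (sum μ))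
  (∈-concat⁺′ (∈-words⁺ μ (All.map (λ l → ∈-upTo⁺ (s≤s l)) (parts≤sum μ)))
              (∈-map⁺ (words (upTo (suc (sum μ)))) (∈-upTo⁺ (s≤s (length≤sum pos)))))
  (p , refl)

∈-partitions⁻ : ∀ {μ n} → μ ∈ partitions n → IsPartition μ × sum μ ≡ n
∈-partitions⁻ {n = n} m =
  proj₂ (∈-filter⁻ (partition? n) {xs = concatMap (words (upTo (suc n))) (upTo (suc n))} m)

partitions-unique : ∀ n → Unique (partitions n)
partitions-unique n = Unique.filter⁺ (partition? n)
  {xs = concatMap (words (upTo (suc n))) (upTo (suc n))}
  (Unique.concat⁺ {xss = map (words (upTo (suc n))) (upTo (suc n))}
    (All.map⁺ {xs = upTo (suc n)} (All.tabulate (λ {k} _ → words-unique k (Unique.upTo⁺ (suc n)))))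
    (AllPairs.map⁺ {xs = upTo (suc n)} (AllPairs.map (λ {i} {j} → disjoint i j) (Unique.upTo⁺ (suc n)))))
  where
  disjoint : ∀ i j → i ≢ j → ∀ {w} → ¬ (w ∈ words (upTo (suc n)) i × w ∈ words (upTo (suc n)) j)
  disjoint i j i≢j (p , q) =
    i≢j (trans (sym (proj₁ (∈-words⁻ (upTo (suc n)) i p))) (proj₁ (∈-words⁻ (upTo (suc n)) j q)))

ones-partition : ∀ r → IsPartition (replicate r 1)
ones-partition zero          = [] , []
ones-partition (suc zero)    = [-] , s≤s z≤n ∷ []
ones-partition (suc (suc r)) with l , p ← ones-partition (suc r) = ℕ.≤-refl ∷ l , s≤s z≤n ∷ p

twos-ones-partition : ∀ l r → IsPartition (replicate l 2 ++ replicate r 1)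
twos-ones-partition zero                r       = ones-partition r
twos-ones-partition (suc zero)          zero    = [-] , s≤s z≤n ∷ []
twos-ones-partition (suc zero)          (suc r) with l , p ← ones-partition (suc r) =
  s≤s z≤n ∷ l , s≤s z≤n ∷ p
twos-ones-partition (suc (suc l))       r       with m , p ← twos-ones-partition (suc l) r =
  ℕ.≤-refl ∷ m , s≤s z≤n ∷ p

firstPart-twos-ones : ∀ l r → firstPart (replicate l 2 ++ replicate r 1) ≤ 2
firstPart-twos-ones zero    zero    = z≤n
firstPart-twos-ones zero    (suc r) = s≤s z≤n
firstPart-twos-ones (suc l) r       = ℕ.≤-refl

firstPart-tail : ∀ {x μ} → Linked _≥_ (x ∷ μ) → firstPart μ ≤ x
firstPart-tail [-]     = z≤n
firstPart-tail (p ∷ _) = p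

shape : ∀ μ → IsPartition μ → firstPart μ ≤ 2 →
        ∃₂ λ l r → μ ≡ replicate l 2 ++ replicate r 1
shape [] _ _ = 0 , 0 , refl
shape (0 ∷ μ) (_ , () ∷ _) _
shape (1 ∷ μ) (l , _ ∷ p) _
  with shape μ (Linked.tail l , p) (ℕ.≤-trans (firstPart-tail l) (s≤s z≤n)) | firstPart-tail l
... | zero  , r , refl | _ = 0 , suc r , refl
... | suc _ , r , refl | s≤s ()
shape (2 ∷ μ) (l , _ ∷ p) _ with k , r , refl ← shape μ (Linked.tail l , p) (firstPart-tail l) =
  suc k , r , refl
shape (suc (suc (suc _)) ∷ μ) _ (s≤s (s≤s ()))

shape-twoColumn : ∀ {μ n} → IsPartition μ → firstPart μ ≤ 2 → sum μ ≡ n →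
                  ∃ λ l → l ℕ.+ l ≤ n × μ ≡ twoColumn n l
shape-twoColumn {μ} p f refl with l , r , refl ← shape μ p f =
  l , subst (l ℕ.+ l ≤_) (sym s) (ℕ.m≤m+n (l ℕ.+ l) r) ,
  cong (λ m → replicate l 2 ++ replicate m 1)
    (sym (trans (cong (λ n → n ∸ l ∸ l) (trans s (ℕ.+-assoc l l r)))
           (trans (cong (_∸ l) (ℕ.m+n∸m≡n l (l ℕ.+ r))) (ℕ.m+n∸m≡n l r))))
  where
  s : sum (replicate l 2 ++ replicate r 1) ≡ l ℕ.+ l ℕ.+ r
  s = sum-twos-ones l r

∈-half⁻ : ∀ {n k} → k ∈ upTo (suc ⌊ n /2⌋) → k ℕ.+ k ≤ n
∈-half⁻ {n} m with s≤s l ← ∈-upTo⁻ m =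
  subst (_ ≤_) (ℕ.⌊n/2⌋+⌈n/2⌉≡n n) (ℕ.+-mono-≤ l (ℕ.≤-trans l (ℕ.⌊n/2⌋≤⌈n/2⌉ n)))

∈-half⁺ : ∀ {n k} → k ℕ.+ k ≤ n → k ∈ upTo (suc ⌊ n /2⌋)
∈-half⁺ {n} {k} h = ∈-upTo⁺ (s≤s (subst (_≤ ⌊ n /2⌋) (sym (ℕ.n≡⌊n+n/2⌋ k)) (ℕ.⌊n/2⌋-mono h)))

twoColumn-∈ : ∀ {n k} → k ℕ.+ k ≤ n → twoColumn n k ∈ partitions n
twoColumn-∈ {n} {k} h = ∈-partitions⁺ (twos-ones-partition k (n ∸ k ∸ k)) (sum-twoColumn {n} {k} h)

twoColumn-injective : ∀ {n k l} → twoColumn n k ≡ twoColumn n l → k ≡ l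
twoColumn-injective {n} {k} {l} e =
  trans (sym (count-twos k (n ∸ k ∸ k)))
    (trans (cong (length ∘ filter (1 ℕ.<?_)) e) (count-twos l (n ∸ l ∸ l)))

module TwoColumnSums (M : CommutativeMonoid 0ℓ 0ℓ) where

  open CommutativeMonoid M using (Carrier; _≈_; ε) renaming (refl to ≈-refl; sym to ≈-sym; trans to ≈-trans)
  open FiniteSums M

  -- Stated over any commutative monoid, as it serves both the matrix identities over the integers
  -- and the sums of `𝔍` modulo the ideal. The number of twos recovers the index of a shape.
  ∑-twoColumn : ∀ n (f : List ℕ → Carrier) →
    (∀ {ν} → ν ∈ partitions n → ¬ (firstPart ν ≤ 2) → f ν ≈ ε) →
    ∑ (partitions n) f ≈ ∑ (upTo (suc ⌊ n /2⌋)) (f ∘ twoColumn n)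
  ∑-twoColumn n f vanish = ≈-trans (∑-support narrow? f (partitions n) vanish)
    (≈-sym (∑-bijection (twoColumn n) (λ ν → length (filter (1 ℕ.<?_) ν)) (Unique.upTo⁺ _)
      (Unique.filter⁺ narrow? (partitions-unique n)) to from (λ _ → ≈-refl)))
    where
    narrow? : Decidable (λ ν → firstPart ν ≤ 2)
    narrow? ν = firstPart ν ℕ.≤? 2
    to : ∀ {k} → k ∈ upTo (suc ⌊ n /2⌋) → twoColumn n k ∈ filter narrow? (partitions n) ×
         length (filter (1 ℕ.<?_) (twoColumn n k)) ≡ k
    to {k} m = ∈-filter⁺ narrow? (twoColumn-∈ {n} {k} (∈-half⁻ m)) (firstPart-twos-ones k (n ∸ k ∸ k)) ,
               count-twos k (n ∸ k ∸ k)
    from : ∀ {ν} → ν ∈ filter narrow? (partitions n) →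
           length (filter (1 ℕ.<?_) ν) ∈ upTo (suc ⌊ n /2⌋) × twoColumn n (length (filter (1 ℕ.<?_) ν)) ≡ ν
    from {ν} m with m′ , f ← ∈-filter⁻ narrow? {xs = partitions n} m
      with p , s ← ∈-partitions⁻ {n = n} m′ with l , h , refl ← shape-twoColumn {n = n} p f s =
      subst (_∈ upTo (suc ⌊ n /2⌋)) (sym (count-twos l (n ∸ l ∸ l))) (∈-half⁺ h) ,
      cong (twoColumn n) (count-twos l (n ∸ l ∸ l))

δ-refl : ∀ μ → δ μ μ ≡ 1ℤ
δ-refl μ with List.≡-dec ℕ._≟_ μ μ
... | yes _ = refl
... | no n  = ⊥-elim (n refl)

δ-≢ : ∀ {μ ν} → μ ≢ ν → δ μ ν ≡ 0ℤ
δ-≢ {μ} {ν} n with List.≡-dec ℕ._≟_ μ ν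
... | yes e = ⊥-elim (n e)
... | no _  = refl

kostka-wide : ∀ {n k ν} → k ℕ.+ k ≤ n → ν ∈ partitions n → ¬ (firstPart ν ≤ 2) →
              kostka (twoColumn n k) ν ≡ 0
kostka-wide {n} {k} {[]} h m w = ⊥-elim (w z≤n)
kostka-wide {n} {k} {0 ∷ ν} h m w = ⊥-elim (w z≤n)
kostka-wide {n} {k} {1 ∷ ν} h m w = ⊥-elim (w (s≤s z≤n))
kostka-wide {n} {k} {2 ∷ ν} h m w = ⊥-elim (w ℕ.≤-refl)
kostka-wide {n} {k} {suc (suc (suc x)) ∷ ν} h m w = kostka-large n k x ν h (proj₂ (∈-partitions⁻ {n = n} m))

chooseFrom-diagonal : ∀ k r → chooseFrom k r k ≡ 1
chooseFrom-diagonal zero    r = refl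
chooseFrom-diagonal (suc k) r = chooseFrom-diagonal k r

kostka-diagonal : ∀ {n k} → k ℕ.+ k ≤ n → kostka (twoColumn n k) (twoColumn n k) ≡ 1
kostka-diagonal {n} {k} h = trans (sym (ℕ.+-identityʳ _))
  (trans (cong (kostka (twoColumn n k) (twoColumn n k) ℕ.+_) (sym (chooseFrom-< (suc k) _ k ℕ.≤-refl)))
    (trans (kostka-twoColumn n k k h h) (chooseFrom-diagonal k _)))

kostka-upper : ∀ {n k l} → k ℕ.+ k ≤ n → l ℕ.+ l ≤ n → k < l → kostka (twoColumn n k) (twoColumn n l) ≡ 0
kostka-upper {n} {k} {l} hk hl k<l =
  ℕ.m+n≡0⇒m≡0 _ (trans (kostka-twoColumn n k l hk hl) (chooseFrom-< l _ k k<l))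

module InverseKostka (n : ℕ) (K⁻¹ : List ℕ → List ℕ → ℤ) (inverse : IsInverseKostka n K⁻¹) where

  open FiniteSums ℤ.+-0-commutativeMonoid
  open TwoColumnSums ℤ.+-0-commutativeMonoid

  range : List ℕ
  range = upTo (suc ⌊ n /2⌋)

  -- K is block triangular and its two-column block is unitriangular.
  inverse-wide : ∀ {ν} → ν ∈ partitions n → ¬ (firstPart ν ≤ 2) →
                 ∀ k → k ℕ.+ k ≤ n → K⁻¹ (twoColumn n k) ν ≡ 0ℤ
  inverse-wide {ν} m w = <-rec _ go
    where
    term : ℕ → List ℕ → ℤ
    term k κ = + kostka (twoColumn n k) κ ℤ.* K⁻¹ κ ν
    go : ∀ k → (∀ {l} → l < k → l ℕ.+ l ≤ n → K⁻¹ (twoColumn n l) ν ≡ 0ℤ) →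
         k ℕ.+ k ≤ n → K⁻¹ (twoColumn n k) ν ≡ 0ℤ
    go k ih h = begin
      K⁻¹ (twoColumn n k) ν              ≡⟨ ℤ.*-identityˡ _ ⟨
      1ℤ ℤ.* K⁻¹ (twoColumn n k) ν       ≡⟨ cong (λ c → + c ℤ.* K⁻¹ (twoColumn n k) ν) (kostka-diagonal {n} {k} h) ⟨
      term k (twoColumn n k)             ≡⟨ ∑-single (Unique.upTo⁺ _) (∈-half⁺ h) others ⟨
      ∑ range (term k ∘ twoColumn n)     ≡⟨ ∑-twoColumn n (term k) (λ {κ} m′ w′ → cong (λ c → + c ℤ.* K⁻¹ κ ν) (kostka-wide {n} {k} h m′ w′)) ⟨
      ∑ (partitions n) (term k)          ≡⟨ proj₁ (inverse (twoColumn-∈ {n} {k} h) m) ⟩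
      δ (twoColumn n k) ν                ≡⟨ δ-≢ (λ { refl → w (firstPart-twos-ones k (n ∸ k ∸ k)) }) ⟩
      0ℤ                                 ∎
      where
      open ≡-Reasoning
      -- Below the diagonal the entries of the inverse vanish by induction, above it the Kostka
      -- numbers vanish, so only the diagonal term survives.
      others : ∀ {l} → l ∈ range → l ≢ k → term k (twoColumn n l) ≡ 0ℤ
      others {l} i l≢k with ℕ.<-cmp l k
      ... | tri< l<k _ _ = trans (cong (+ kostka (twoColumn n k) (twoColumn n l) ℤ.*_) (ih l<k (∈-half⁻ i)))
                             (ℤ.*-zeroʳ (+ kostka (twoColumn n k) (twoColumn n l)))
      ... | tri≈ _ e _   = ⊥-elim (l≢k e)
      ... | tri> _ _ k<l = cong (λ c → + c ℤ.* K⁻¹ (twoColumn n l) ν) (kostka-upper {n} {k} {l} h (∈-half⁻ i) k<l)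

  -- By `inverse-wide` the summands through wider shapes vanish, so the two-column block of the
  -- inverse is a left inverse of the two-column block of the Kostka matrix.
  inverse-twoColumn : ∀ {k l} → k ℕ.+ k ≤ n → l ℕ.+ l ≤ n →
    ∑ℤ range (λ j → K⁻¹ (twoColumn n k) (twoColumn n j) ℤ.* + kostka (twoColumn n j) (twoColumn n l)) ≡
    δ (twoColumn n k) (twoColumn n l)
  inverse-twoColumn {k} {l} hk hl = trans
    (sym (∑-twoColumn n (λ κ → K⁻¹ (twoColumn n k) κ ℤ.* + kostka κ (twoColumn n l))
      (λ {κ} m w → cong (ℤ._* + kostka κ (twoColumn n l)) (inverse-wide m w k hk))))
    (proj₂ (inverse (twoColumn-∈ {n} {k} hk) (twoColumn-∈ {n} {l} hl)))

-- Expansion of the two-column `𝔍` and inversion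

module Expansion (P : FinitePoset) (free : PosetNotions.[3+1]-Free P) where

  open PosetNotions P using (uʷ; 𝓤; 𝓤-ring; ∑; _·_; e; 𝔍; LT; colword)
  open ChainPairs P free using (X; e*e-expansion)
  open LeftTableauSums P free using (LT-sum)
  open LadderWords P free using (_≃_; ≈⇒≃; ≃-sym; ≃-trans; quotient; ·-cong-≃)
  open Ring quotient using (_*_; 1#; 0#; _+_; -_; +-cong; +-congˡ; +-congʳ; +-assoc; +-identityʳ; *-cong; *-identityˡ; *-identityʳ; -‿inverseʳ; -‿cong; setoid; +-commutativeMonoid)
    renaming (refl to ≃-refl; reflexive to ≡⇒≃)
  open FiniteSums +-commutativeMonoid hiding (∑)
  open TwoColumnSums +-commutativeMonoid
  open IntegerMultiples 𝓤-ring hiding (∑-const)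
  open import Relation.Binary.Reasoning.Setoid setoid

  -- The literal term to which `𝔍` computes when the first part is 2, one summand for each
  -- permutation of two indices; in this form `𝔍-two` holds by `refl`.
  determinant : ℕ → ℕ → 𝓤
  determinant p q =
    sgn (0 ∷ 1 ∷ []) · (e ((+ p ℤ.+ + 0) ℤ.- + 0) * (e ((+ q ℤ.+ + 1) ℤ.- + 1) * 1#)) +
    (sgn (1 ∷ 0 ∷ []) · (e ((+ p ℤ.+ + 1) ℤ.- + 0) * (e ((+ q ℤ.+ + 0) ℤ.- + 1) * 1#)) + 0#)

  𝔍-two : ∀ ρ → 𝔍 (2 ∷ ρ) ≡ determinant (length (filter (0 ℕ.<?_) (2 ∷ ρ))) (length (filter (1 ℕ.<?_) (2 ∷ ρ)))
  𝔍-two ρ = refl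

  index₀ : ∀ p → (+ p ℤ.+ + 0) ℤ.- + 0 ≡ + p
  index₀ p = cong +_ (trans (ℕ.+-identityʳ (p ℕ.+ 0)) (ℕ.+-identityʳ p))

  index₁ : ∀ p → (+ p ℤ.+ + 1) ℤ.- + 0 ≡ + suc p
  index₁ p = cong +_ (trans (ℕ.+-identityʳ (p ℕ.+ 1)) (ℕ.+-comm p 1))

  index₂ : ∀ q → (+ q ℤ.+ + 1) ℤ.- + 1 ≡ + q
  index₂ q = cong (λ m → + m ℤ.- + 1) (ℕ.+-comm q 1)

  index₃ : ∀ q → (+ suc q ℤ.+ + 0) ℤ.- + 1 ≡ + q
  index₃ q = cong (λ m → + suc m ℤ.- + 1) (ℕ.+-identityʳ q)

  determinant-expand : ∀ p q → determinant p (suc q) ≃ e (+ p) * e (+ suc q) + - (e (+ suc p) * e (+ q))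
  determinant-expand p q = +-cong
    (≃-trans (≈⇒≃ (1·x≈x _))
      (*-cong (≡⇒≃ (cong e (index₀ p))) (≃-trans (*-identityʳ _) (≡⇒≃ (cong e (index₂ (suc q)))))))
    (≃-trans (+-identityʳ _) (≃-trans (≈⇒≃ (-1·x≈-x _))
      (-‿cong (*-cong (≡⇒≃ (cong e (index₁ p))) (≃-trans (*-identityʳ _) (≡⇒≃ (cong e (index₃ q))))))))

  e₀ : e (+ 0) ≃ 1#
  e₀ = +-identityʳ 1#

  -- The factor `e (+ 0)`, which is 1, is put in so that shapes with at most one column fall under
  -- the expansion of a product of two factors.
  𝔍-column : ∀ n → 𝔍 (twoColumn n 0) ≃ e (+ n) * e (+ 0)
  𝔍-column zero = ≃-trans (+-identityʳ _) (≃-trans (≈⇒≃ (1·x≈x 1#))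
    (≃-sym (≃-trans (*-cong e₀ e₀) (*-identityˡ 1#))))
  𝔍-column (suc n) = begin
    𝔍 (twoColumn (suc n) 0)   ≈⟨ +-identityʳ _ ⟩
    1ℤ · (e ((+ m ℤ.+ + 0) ℤ.- + 0) * 1#)  ≈⟨ ≈⇒≃ (1·x≈x _) ⟩
    e ((+ m ℤ.+ + 0) ℤ.- + 0) * 1#  ≈⟨ *-cong (≡⇒≃ (cong e (trans (index₀ m) (cong +_ (count-positive 0 (suc n)))))) (≃-sym e₀) ⟩
    e (+ suc n) * e (+ 0)     ∎
    where m = length (filter (0 ℕ.<?_) (replicate (suc n) 1))

  𝔍-twoColumn : ∀ n k → suc k ℕ.+ suc k ≤ n →
    𝔍 (twoColumn n (suc k)) ≃ e (+ (n ∸ suc k)) * e (+ suc k) + - (e (+ suc (n ∸ suc k)) * e (+ k))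
  𝔍-twoColumn n k h = ≃-trans
    (≡⇒≃ (trans (𝔍-two (replicate k 2 ++ replicate (n ∸ suc k ∸ suc k) 1))
      (cong₂ determinant (trans (count-positive (suc k) (n ∸ suc k ∸ suc k)) (l+[n∸l∸l] {n} {suc k} h))
                         (count-twos (suc k) (n ∸ suc k ∸ suc k)))))
    (determinant-expand (n ∸ suc k) k)

  expansion : ∀ {n} a b → a ℕ.+ b ≡ n → e (+ a) * e (+ b) ≃
    ∑ (upTo (suc ⌊ n /2⌋)) (λ l → (+ chooseFrom l (n ∸ l ∸ l) b) · X n l)
  expansion a b refl = e*e-expansion a b

  -- Both products in the determinant have total degree `n`, so they expand in the same `X n l`, and
  -- the coefficients differ by the Kostka number. For `k = 0` there is no second product, and the
  -- subtracted binomial is 0.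
  𝔍-expansion : ∀ n k → k ℕ.+ k ≤ n → 𝔍 (twoColumn n k) ≃
    ∑ (upTo (suc ⌊ n /2⌋)) (λ l → (+ kostka (twoColumn n k) (twoColumn n l)) · X n l)
  𝔍-expansion n zero h = ≃-trans (𝔍-column n) (≃-trans (expansion n 0 (ℕ.+-identityʳ n))
    (∑-cong (upTo (suc ⌊ n /2⌋)) (λ {l} i → ≡⇒≃ (cong (λ c → (+ c) · X n l)
      (trans (sym (kostka-twoColumn n 0 l z≤n (∈-half⁻ i))) (ℕ.+-identityʳ _))))))
  𝔍-expansion n (suc k) h = begin
    𝔍 (twoColumn n (suc k))
      ≈⟨ 𝔍-twoColumn n k h ⟩
    e (+ (n ∸ suc k)) * e (+ suc k) + - (e (+ suc (n ∸ suc k)) * e (+ k))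
      ≈⟨ +-cong (expansion (n ∸ suc k) (suc k) size) (-‿cong (expansion (suc (n ∸ suc k)) k (trans (sym (ℕ.+-suc (n ∸ suc k) k)) size))) ⟩
    ∑ range (λ l → (+ chooseFrom l (n ∸ l ∸ l) (suc k)) · X n l) + - S
      ≈⟨ +-congʳ (≃-trans (∑-cong range (λ {l} i → merge l i)) (∑-∙ _ _ range)) ⟩
    (T + S) + - S
      ≈⟨ +-assoc T S (- S) ⟩
    T + (S + - S)
      ≈⟨ +-congˡ (-‿inverseʳ S) ⟩
    T + 0#
      ≈⟨ +-identityʳ T ⟩
    T ∎
    where
    range = upTo (suc ⌊ n /2⌋)
    S = ∑ range (λ l → (+ chooseFrom l (n ∸ l ∸ l) k) · X n l)
    T = ∑ range (λ l → (+ kostka (twoColumn n (suc k)) (twoColumn n l)) · X n l)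
    size : n ∸ suc k ℕ.+ suc k ≡ n
    size = ℕ.m∸n+n≡m (ℕ.≤-trans (ℕ.m≤m+n (suc k) (suc k)) h)
    merge : ∀ l → l ∈ range → (+ chooseFrom l (n ∸ l ∸ l) (suc k)) · X n l ≃
      (+ kostka (twoColumn n (suc k)) (twoColumn n l)) · X n l + (+ chooseFrom l (n ∸ l ∸ l) k) · X n l
    -- `chooseFrom (suc l) r (suc k)` unfolds to `chooseFrom l r k`, the coefficient in the
    -- expansion of the second product.
    merge l i = ≃-trans
      (≡⇒≃ (cong (λ c → (+ c) · X n l) (sym (kostka-twoColumn n (suc k) l h (∈-half⁻ i)))))
      (≈⇒≃ (·-homo-+ (+ kostka (twoColumn n (suc k)) (twoColumn n l)) (+ chooseFrom l (n ∸ l ∸ l) k) (X n l)))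

  inversion : ∀ n l → l ℕ.+ l ≤ n → (K⁻¹ : List ℕ → List ℕ → ℤ) → IsInverseKostka n K⁻¹ →
    ∑ (partitions n) (λ ν → K⁻¹ (twoColumn n l) ν · 𝔍 ν) ≃ X n l
  inversion n l h K⁻¹ inverse = begin
    ∑ (partitions n) (λ ν → M ν · 𝔍 ν)
      ≈⟨ ∑-twoColumn n _ (λ {ν} m w → ≡⇒≃ (cong (_· 𝔍 ν) (inverse-wide m w l h))) ⟩
    ∑ range (λ k → M (twoColumn n k) · 𝔍 (twoColumn n k))
      ≈⟨ ∑-cong range (λ {k} i → ≃-trans (·-cong-≃ (M (twoColumn n k)) (𝔍-expansion n k (∈-half⁻ i)))
           (≈⇒≃ (·-distrib-∑ (M (twoColumn n k)) range (λ j → K k j · X n j)))) ⟩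
    ∑ range (λ k → ∑ range (λ j → M (twoColumn n k) · (K k j · X n j)))
      ≈⟨ ∑-swap _ range range ⟩
    ∑ range (λ j → ∑ range (λ k → M (twoColumn n k) · (K k j · X n j)))
      ≈⟨ ∑-cong range (λ {j} _ → ∑-cong range (λ {k} _ → ≃-sym (≈⇒≃ (·-assoc (M (twoColumn n k)) (K k j) (X n j))))) ⟩
    ∑ range (λ j → ∑ range (λ k → (M (twoColumn n k) ℤ.* K k j) · X n j))
      ≈⟨ ∑-cong range (λ {j} i → ≃-trans (≃-sym (≈⇒≃ (∑ℤ-· range (λ k → M (twoColumn n k) ℤ.* K k j) (X n j))))
           (≡⇒≃ (cong (_· X n j) (inverse-twoColumn {l} {j} h (∈-half⁻ i))))) ⟩
    ∑ range (λ j → δ (twoColumn n l) (twoColumn n j) · X n j)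
      ≈⟨ ∑-single (Unique.upTo⁺ _) (∈-half⁺ h)
           (λ {j} _ j≢l → ≡⇒≃ (cong (_· X n j) (δ-≢ (λ eq → j≢l (sym (twoColumn-injective {n} {l} {j} eq)))))) ⟩
    δ (twoColumn n l) (twoColumn n l) · X n l
      ≈⟨ ≡⇒≃ (cong (_· X n l) (δ-refl (twoColumn n l))) ⟩
    1ℤ · X n l
      ≈⟨ ≈⇒≃ (1·x≈x _) ⟩
    X n l ∎
    where
    open InverseKostka n K⁻¹ inverse
    M : List ℕ → ℤ
    M = K⁻¹ (twoColumn n l)
    K : ℕ → ℕ → ℤ
    K k j = + kostka (twoColumn n k) (twoColumn n j)

  𝔪-left-tableaux : ∀ μ → IsPartition μ → firstPart μ ≤ 2 →
    (K⁻¹ : List ℕ → List ℕ → ℤ) → IsInverseKostka (sum μ) K⁻¹ →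
    ∑ (partitions (sum μ)) (λ ν → K⁻¹ μ ν · 𝔍 ν) ≃ ∑ (LT μ) (λ T → uʷ (colword T))
  𝔪-left-tableaux μ p f K⁻¹ inverse with l , h , eq ← shape-twoColumn p f refl =
    -- `eq` has `μ` on both sides, so only its occurrences as an index are replaced; the degree
    -- `sum μ`, on which `inverse` depends, stays.
    subst (λ ρ → ∑ (partitions (sum μ)) (λ ν → K⁻¹ ρ ν · 𝔍 ν) ≃ ∑ (LT ρ) (λ T → uʷ (colword T))) (sym eq)
      (≃-trans (inversion (sum μ) l h K⁻¹ inverse) (≃-sym (LT-sum (sum μ) l h)))

mainTheorem11 : (P : FinitePoset) → (let open PosetNotions P) →
    [3+1]-Free →
    (μ : List ℕ) → IsPartition μ → firstPart μ ≤ 2 →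
    (K⁻¹ : List ℕ → List ℕ → ℤ) → IsInverseKostka (sum μ) K⁻¹ →
    𝔪 K⁻¹ μ ≡ ∑ (LT μ) (λ T → uʷ (colword T)) [mod I-H ]
mainTheorem11 P free = Expansion.𝔪-left-tableaux P free
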